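{- Let $n\ge 0$, let $\mathbf{k}$ be a field and $q\in\mathbf{k}$. Then the elements $\mathcal{R}_{n,k}\in\mathcal{H}_n$ for all $k\ge 0$ pairwise commute: $\mathcal{R}_{n,i}\mathcal{R}_{n,j}=\mathcal{R}_{n,j}\mathcal{R}_{n,i}$ for all $i,j\ge 0$.
   Context: The Hecke algebra $\mathcal{H}_n$ (over a field $\mathbf{k}$, parameter $q\in\mathbf{k}$) is the unital associative $\mathbf{k}$-algebra generated by $T_1,\dots,T_{n-1}$ subject to $T_i^2=(q-1)T_i+q$, $T_iT_j=T_jT_i$ for $|i-j|>1$, and $T_iT_{i+1}T_i=T_{i+1}T_iT_{i+1}$. It has a basis $(T_w)_{w\in S_n}$, where $T_w=T_{i_1}\cdots T_{i_r}$ for any reduced expression $w=s_{i_1}\cdots s_{i_r}$ with $s_i=(i,i+1)$. We regard $\mathcal{H}_0\subseteq\mathcal{H}_1\subseteq\mathcal{H}_2\subseteq\cdots$ by identifying equally named generators. Let $[k]_q=1+q+\cdots+q^{k-1}$ and $[k]!_q=[1]_q[2]_q\cdots[k]_q$. For any integer $m$ set $\mathcal{B}_m=\sum_{i=1}^m T_{m-1}T_{m-2}\cdots T_i$ and $\mathcal{B}^*_m=\sum_{i=1}^m T_iT_{i+1}\cdots T_{m-1}$ (both are $0$ for $m\le 0$). For $n,k\ge0$ set $\mathcal{B}_{n,k}=\mathcal{B}_{n-k+1}\cdots\mathcal{B}_{n-1}\mathcal{B}_n$ and $\mathcal{B}^*_{n,k}=\mathcal{B}^*_n\mathcal{B}^*_{n-1}\cdots\mathcal{B}^*_{n-k+1}$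 (empty products equal $1$), and $\mathcal{R}_{n,k}=\frac{1}{[k]!_q}\mathcal{B}^*_{n,k}\mathcal{B}_{n,k}$. For an indeterminate $q$ the product $\mathcal{B}^*_{n,k}\mathcal{B}_{n,k}$ is a combination of the $T_w$ with coefficients in $\mathbb{Z}[q]$ divisible by $[k]!_q$; for a specific value of $q$, $\mathcal{R}_{n,k}$ is defined by specializing this quotient. -}

module Defs where

open import Level using (Level; _⊔_) renaming (suc to lsuc)
open import Data.Nat as ℕ using (ℕ; zero; suc; _∸_; _<ᵇ_)
open import Data.Integer as ℤ using (ℤ; +_; -[1+_])
open import Data.Bool using (Bool; true; false; if_then_else_)
open import Data.List using (List; []; _∷_; _++_; map; concatMap; foldl; foldr; reverse; length; drop; upTo; deduplicate)
open import Data.List.Properties using () renaming (≡-dec to List-≡-dec)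
import Data.Maybe
open import Data.Maybe using (Maybe; just; nothing)
open import Data.Product using (_×_; _,_; proj₂; ∃)
open import Relation.Nullary using (¬_; does)
open import Relation.Binary.PropositionalEquality using (_≡_)
open import Algebra.Bundles using (CommutativeRing)
open import Algebra.Bundles.Raw using (RawRing)

record Field (c ℓ : Level) : Set (lsuc (c ⊔ ℓ)) where
  field
    commutativeRing : CommutativeRing c ℓ
  open CommutativeRing commutativeRing public
  field
    0≉1     : ¬ (0# ≈ 1#)
    inverse : ∀ x → ¬ (x ≈ 0#) → ∃ λ y → (x * y) ≈ 1#

-- Permutations of {0,…,n-1} in one-line notation, as lists of naturals.
-- (Only permutations ever occur below.)

Perm : Set
Perm = List ℕ

idPerm : ℕ → Perm
idPerm n = upTo n

swapPos : ℕ → Perm → Perm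
swapPos zero    (a ∷ b ∷ w) = b ∷ a ∷ w
swapPos zero    w           = w
swapPos (suc p) []          = []
swapPos (suc p) (a ∷ w)     = a ∷ swapPos p w

ascentPos : ℕ → Perm → Bool
ascentPos zero    (a ∷ b ∷ w) = a <ᵇ b
ascentPos zero    w           = true
ascentPos (suc p) []          = true
ascentPos (suc p) (a ∷ w)     = ascentPos p w

-- right multiplication by s_j (1-based generator index j)
_·s_ : Perm → ℕ → Perm
w ·s j = swapPos (j ∸ 1) w

-- ℓ(w s_j) > ℓ(w)  iff  w(j) < w(j+1)
ascent : Perm → ℕ → Bool
ascent w j = ascentPos (j ∸ 1) w

firstDescent : Perm → Maybe ℕ
firstDescent []      = nothing
firstDescent (a ∷ w) = go a w
  where
  go : ℕ → List ℕ → Maybe ℕ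
  go a []      = nothing
  go a (b ∷ w) = if a <ᵇ b then Data.Maybe.map suc (go b w) else just 1

-- a reduced word (i₁,…,i_r) with w = s_{i₁}⋯s_{i_r} (bubble sort; the
-- fuel length(w)² exceeds the number of inversions).
redWord′ : ℕ → Perm → List ℕ
redWord′ zero    w = []
redWord′ (suc f) w with firstDescent w
... | nothing = []
... | just j  = redWord′ f (w ·s j) ++ (j ∷ [])

redWord : Perm → List ℕ
redWord w = redWord′ (length w ℕ.* length w) w

-- The Hecke algebra H_n over a commutative (raw) ring A with parameter q,
-- realised on the basis (T_w)_{w ∈ S_n}: an element is a finite formal
-- combination  Σ c · T_w  (a list of (coefficient, permutation) pairs).

module Hecke {c ℓ} (A : RawRing c ℓ) (q : RawRing.Carrier A) where
  open RawRing A

  H : Set c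
  H = List (Carrier × Perm)

  coeff : H → Perm → Carrier
  coeff []             w = 0#
  coeff ((a , v) ∷ xs) w =
    if does (List-≡-dec ℕ._≟_ v w) then a + coeff xs w else coeff xs w

  _≋_ : H → H → Set ℓ
  x ≋ y = ∀ w → coeff x w ≈ coeff y w

  0H : H
  0H = []

  1H : ℕ → H
  1H n = (1# , idPerm n) ∷ []

  _⊕_ : H → H → H
  x ⊕ y = x ++ y

  _⊙_ : Carrier → H → H
  a ⊙ x = map (λ { (b , w) → (a * b , w) }) x

  -- T_w · T_j = T_{w s_j} if ℓ(w s_j) > ℓ(w), else (q-1) T_w + q T_{w s_j}
  mulGenTerm : ℕ → Carrier × Perm → H
  mulGenTerm j (a , w) =
    if ascent w j then (a , w ·s j) ∷ []
    else ((q + (- 1#)) * a , w) ∷ (q * a , w ·s j) ∷ []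

  _·T_ : H → ℕ → H
  x ·T j = concatMap (mulGenTerm j) x

  _·Tword_ : H → List ℕ → H
  x ·Tword js = foldl _·T_ x js

  -- product: x · T_w = x · T_{i₁} ⋯ T_{i_r} for a reduced word of w
  _⊗_ : H → H → H
  x ⊗ y = concatMap (λ { (b , w) → b ⊙ (x ·Tword redWord w) }) y

  Tword : ℕ → List ℕ → H
  Tword n js = 1H n ·Tword js

  range : ℕ → ℕ → List ℕ
  range a b = map (a ℕ.+_) (upTo (b ∸ a))

  sumH : List H → H
  sumH = foldr _⊕_ 0H

  𝓑 : ℕ → ℕ → H
  𝓑 n m = sumH (map (λ i → Tword n (reverse (range i m))) (range 1 (suc m)))

  𝓑* : ℕ → ℕ → H
  𝓑* n m = sumH (map (λ i → Tword n (range i m)) (range 1 (suc m)))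

  -- 𝓑_{n,k} = 𝓑_{n-k+1} ⋯ 𝓑_{n-1} 𝓑_n ;  𝓑_{n,k+1} = 𝓑_{n-k} 𝓑_{n,k}.
  -- Since 𝓑_m = 0 for all m ≤ 0, using truncated n ∸ k is exact.
  𝓑nk : ℕ → ℕ → H
  𝓑nk n zero    = 1H n
  𝓑nk n (suc k) = 𝓑 n (n ∸ k) ⊗ 𝓑nk n k

  𝓑*nk : ℕ → ℕ → H
  𝓑*nk n zero    = 1H n
  𝓑*nk n (suc k) = 𝓑*nk n k ⊗ 𝓑* n (n ∸ k)

-- ℤ[q]: polynomials as coefficient lists (constant term first).

Poly : Set
Poly = List ℤ

padd : Poly → Poly → Poly
padd []       ys       = ys
padd xs       []       = xs
padd (x ∷ xs) (y ∷ ys) = (x ℤ.+ y) ∷ padd xs ys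

pmul : Poly → Poly → Poly
pmul []       ys = []
pmul (x ∷ xs) ys = padd (map (x ℤ.*_) ys) (ℤ.0ℤ ∷ pmul xs ys)

ℤ[q] : RawRing _ _
ℤ[q] = record
  { Carrier = Poly ; _≈_ = _≡_ ; _+_ = padd ; _*_ = pmul
  ; -_ = map (λ z → ℤ.- z) ; 0# = [] ; 1# = ℤ.1ℤ ∷ [] }

qPoly : Poly
qPoly = ℤ.0ℤ ∷ ℤ.1ℤ ∷ []

qint : ℕ → Poly
qint zero    = []
qint (suc k) = ℤ.1ℤ ∷ qint k

qfact : ℕ → Poly
qfact zero    = ℤ.1ℤ ∷ []
qfact (suc k) = pmul (qfact k) (qint (suc k))

-- long division by a monic polynomial, in highest-degree-first form:
-- es = the non-leading coefficients of the divisor (highest first)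
subFront : List ℤ → List ℤ → List ℤ
subFront []       ys       = ys
subFront (x ∷ xs) []       = []
subFront (x ∷ xs) (y ∷ ys) = (y ℤ.- x) ∷ subFront xs ys

divHi : ℕ → List ℤ → List ℤ → List ℤ
divHi zero    es p        = []
divHi (suc f) es []       = []
divHi (suc f) es (a ∷ rest) =
  if length rest <ᵇ length es then []
  else a ∷ divHi f es (subFront (map (a ℤ.*_) es) rest)

-- quotient of p by the monic polynomial d
pquot : Poly → Poly → Poly
pquot p d = reverse (divHi (length p) (drop 1 (reverse d)) (reverse p))

module _ {c ℓ} (F : Field c ℓ) where
  open Field F

  ιℕ : ℕ → Carrier
  ιℕ zero    = 0#
  ιℕ (suc m) = 1# + ιℕ m

  ιℤ : ℤ → Carrier
  ιℤ (+ m)     = ιℕ m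
  ιℤ -[1+ m ]  = - ιℕ (suc m)

  evalAt : Carrier → Poly → Carrier
  evalAt q₀ []       = 0#
  evalAt q₀ (a ∷ as) = ιℤ a + q₀ * evalAt q₀ as

  module Hk (q₀ : Carrier) = Hecke rawRing q₀
  module Hq = Hecke ℤ[q] qPoly

  -- 𝓡_{n,k} = (1/[k]!_q) 𝓑*_{n,k} 𝓑_{n,k}: computed generically over ℤ[q]
  -- (coefficient of each T_w divided by [k]!_q), then specialised at q₀.
  𝓡 : (q₀ : Carrier) → ℕ → ℕ → Hk.H q₀
  𝓡 q₀ n k =
    map (λ w → (evalAt q₀ (pquot (Hq.coeff P w) (qfact k)) , w))
        (deduplicate (List-≡-dec ℕ._≟_) (map proj₂ P))
    where
    P : Hq.H
    P = Hq._⊗_ (Hq.𝓑*nk n k) (Hq.𝓑nk n k)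

-- Let P n k = 𝓑*_{n,k} 𝓑_{n,k} = [k]!_q 𝓡_{n,k}, so that P n k = b*_n (P (n-1) (k-1)) b_n,
-- and let J_n be the Jucys–Murphy element, which commutes with T_1, …, T_{n-2}.  From
-- b_n b*_n = [n] + q^n J_n + b*_{n-1} T_{n-1} b_{n-1} and T_{n-1} b_{n-1} b_n = q b_{n-1} b_n one
-- obtains by induction q^j b_n (P n (j+1)) = X b_n, where X is a combination of P (n-1) (j+1),
-- P (n-1) j and J_n (P (n-1) j).  The relations are symmetric under reversal of products,
-- hence also q^j (P n (j+1)) b*_n = b*_n X.  If the P (n-1) i commute pairwise, X commutes
-- with them, and q^j (P n i) (P n (j+1)) = b*_n (P (n-1) (i-1)) X b_n
-- = b*_n X (P (n-1) (i-1)) b_n = q^j (P n (j+1)) (P n i).  Over ℤ[q] the factors q^j and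
-- [i]!_q [j]!_q cancel, and evaluation at q carries the result to the field.
module Submission where

open import Defs
open import Data.Nat using (ℕ)
open import Level using (Level)
open import Level using (_⊔_; 0ℓ)
open import Algebra.Bundles using (Ring; CommutativeRing)
open import Algebra.Bundles.Raw using (RawRing)
import Algebra.Construct.Flip.Op as Op
import Algebra.Properties.CommutativeSemigroup as CommutativeSemigroupProperties
import Algebra.Properties.Group as GroupProperties
import Algebra.Properties.Monoid.Mult as MonoidMult
import Algebra.Properties.Ring as RingProperties
import Algebra.Properties.Semiring.Mult as SemiringMult
open import Algebra.Structures using (IsCommutativeRing)
open import Data.Bool using (Bool; true; false; if_then_else_; not)
open import Data.Bool.Properties using (not-injective; not-¬)
open import Data.Integer as ℤ using (ℤ; +_; -[1+_]; 0ℤ; 1ℤ)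
import Data.Integer.Properties as ℤ
open import Data.Integer.Tactic.RingSolver using (solve-∀)
open import Data.List using (List; []; _∷_; _∷ʳ_; _++_; applyUpTo; deduplicate; drop; foldr; length; map; reverse; upTo)
import Data.List.Properties as List
open import Data.List.Membership.Propositional using (_∈_)
open import Data.List.Membership.Propositional.Properties using (∈-map⁺; ∈-deduplicate⁺)
open import Data.List.Relation.Binary.Permutation.Propositional using (↭-sym)
open import Data.List.Relation.Binary.Permutation.Propositional.Properties using (All-resp-↭; ↭-reverse)
open import Data.List.Relation.Binary.Pointwise as Pointwise using (Pointwise; []; _∷_)
open import Data.List.Relation.Unary.All as All using (All; []; _∷_)
import Data.List.Relation.Unary.All.Properties as All
open import Data.List.Relation.Unary.AllPairs using ([]; _∷_)
open import Data.List.Relation.Unary.Any as Any using (here; there)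
open import Data.List.Relation.Unary.Unique.Propositional using (Unique)
import Data.List.Relation.Unary.Unique.Propositional.Properties as Unique
open import Data.List.Relation.Unary.Unique.DecPropositional.Properties using (deduplicate-!)
import Data.Maybe as Maybe
open import Data.Maybe using (Maybe; just; nothing)
open import Data.Nat as ℕ using (zero; suc; _∸_; _≡ᵇ_; _<ᵇ_; _≤_; _<_; z≤n; s≤s)
import Data.Nat.Properties as ℕ
open import Data.List.Relation.Unary.Unique.DecPropositional ℕ._≟_ using (unique?)
open import Data.Product using (Σ; ∃; _×_; _,_; proj₁; proj₂)
open import Function using (_∘_)
open import Relation.Binary.Definitions using (tri<; tri≈; tri>)
open import Relation.Binary.PropositionalEquality as ≡ using (_≡_; _≢_)
import Relation.Binary.Reasoning.Setoid as SetoidReasoning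
open import Relation.Nullary using (¬_; Dec; yes; no; contradiction; _×-dec_)

-- A solver for noncommutative rings

-- Two obstacles shape the proof. First, the elements of `H` are unnormalised lists, and their
-- product goes through the reduced words of one particular sorting algorithm, so no ring law is at
-- hand. The calculation is therefore done in an arbitrary ring with elements satisfying the Hecke
-- relations, and applied to the ring of operators on coefficient functions. A formal combination is
-- sent to its operator; this is multiplicative because the product along a reduced word can be made
-- to end in any descent, and coefficients are recovered by applying the operator to the coefficient
-- function of the identity. Second, `𝓡` divides coefficients by `pquot`, which is meaningful only
-- if the division is exact. Divisibility by [k]!_q is proved inside the algebra: left
-- multiplication by each of T_{n-k+1}, ..., T_{n-1} acts on `𝓑nk n k` as q, and multiplying any
-- element with this property by `𝓑*nk n k` produces the factor. Both q and [k]!_q may vanish in the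
-- field, hence every cancellation takes place over ℤ[q].

module NoncommutativeSolver {c ℓ} (R : Ring c ℓ) where
  open Ring R
  open RingProperties R
  open SetoidReasoning setoid

  Central : Carrier → Set _
  Central x = ∀ y → x * y ≈ y * x

  infixl 6 _:+_ _:-_
  infixl 7 _:*_

  data Expr : Set where
    𝟘 𝟙            : Expr
    con var        : ℕ → Expr
    _:+_ _:-_ _:*_ : Expr → Expr → Expr

  -- A signed monomial: sign (true is +), sorted central letters, word.
  Monomial : Set
  Monomial = Bool × List ℕ × List ℕ

  lexLt : List ℕ → List ℕ → Bool
  lexLt []       ys       = true
  lexLt (x ∷ xs) []       = false
  lexLt (x ∷ xs) (y ∷ ys) = if x ≡ᵇ y then lexLt xs ys else x <ᵇ y

  insertLetter : ℕ → List ℕ → List ℕ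
  insertLetter i []       = i ∷ []
  insertLetter i (j ∷ js) = if i <ᵇ j then i ∷ j ∷ js else j ∷ insertLetter i js

  -- Multiplicities are kept in unary: equal monomials of one sign stand side by side, opposite
  -- signs cancel. The order makes equal expressions reach the same list; in each use of `solve` the
  -- two lists are compared by `≡.refl`, so what has to be proved is soundness.
  insert : Monomial → List Monomial → List Monomial
  insert m [] = m ∷ []
  insert (s , cs , ws) ((s′ , cs′ , ws′) ∷ P) with List.≡-dec ℕ._≟_ cs cs′ | List.≡-dec ℕ._≟_ ws ws′
  ... | yes _ | yes _ = cancel s s′
    where
    cancel : Bool → Bool → List Monomial
    cancel true  false = P
    cancel false true  = P
    cancel s     s′    = (s , cs , ws) ∷ (s′ , cs′ , ws′) ∷ P
  ... | yes _ | no _  = if lexLt ws ws′ then (s , cs , ws) ∷ (s′ , cs′ , ws′) ∷ P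
                        else (s′ , cs′ , ws′) ∷ insert (s , cs , ws) P
  ... | no _  | _     = if lexLt cs cs′ then (s , cs , ws) ∷ (s′ , cs′ , ws′) ∷ P
                        else (s′ , cs′ , ws′) ∷ insert (s , cs , ws) P

  add : List Monomial → List Monomial → List Monomial
  add P Q = foldr insert Q P

  flip : Monomial → Monomial
  flip (s , m) = not s , m

  xnor : Bool → Bool → Bool
  xnor true  s = s
  xnor false s = not s

  mulMonomial : Monomial → Monomial → Monomial
  mulMonomial (s , cs , ws) (s′ , cs′ , ws′) = xnor s s′ , foldr insertLetter cs′ cs , ws ++ ws′

  mulBy : Monomial → List Monomial → List Monomial
  mulBy m []      = []
  mulBy m (n ∷ P) = insert (mulMonomial m n) (mulBy m P)

  mul : List Monomial → List Monomial → List Monomial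
  mul []      Q = []
  mul (m ∷ P) Q = add (mulBy m Q) (mul P Q)

  normalise : Expr → List Monomial
  normalise 𝟘         = []
  normalise 𝟙         = (true , [] , []) ∷ []
  normalise (con i)   = (true , i ∷ [] , []) ∷ []
  normalise (var i)   = (true , [] , i ∷ []) ∷ []
  normalise (e :+ e′) = add (normalise e) (normalise e′)
  normalise (e :- e′) = add (map flip (normalise e′)) (normalise e)
  normalise (e :* e′) = mul (normalise e) (normalise e′)

  module _ (Cs : List (Σ Carrier Central)) (Xs : List Carrier) where

    lookupC : List (Σ Carrier Central) → ℕ → Σ Carrier Central
    lookupC []       i       = 0# , λ y → trans (zeroˡ y) (sym (zeroʳ y))
    lookupC (x ∷ xs) zero    = x
    lookupC (x ∷ xs) (suc i) = lookupC xs i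

    lookupX : List Carrier → ℕ → Carrier
    lookupX []       i       = 0#
    lookupX (x ∷ xs) zero    = x
    lookupX (x ∷ xs) (suc i) = lookupX xs i

    central : ℕ → Carrier
    central i = proj₁ (lookupC Cs i)

    ⟦_⟧ : Expr → Carrier
    ⟦ 𝟘 ⟧      = 0#
    ⟦ 𝟙 ⟧      = 1#
    ⟦ con i ⟧  = central i
    ⟦ var i ⟧  = lookupX Xs i
    ⟦ e :+ e′ ⟧ = ⟦ e ⟧ + ⟦ e′ ⟧
    ⟦ e :- e′ ⟧ = ⟦ e ⟧ - ⟦ e′ ⟧
    ⟦ e :* e′ ⟧ = ⟦ e ⟧ * ⟦ e′ ⟧

    prodC prodX : List ℕ → Carrier
    prodC = foldr (λ i x → central i * x) 1#
    prodX = foldr (λ i x → lookupX Xs i * x) 1#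

    sign : Bool → Carrier → Carrier
    sign true  x = x
    sign false x = - x

    evalM : Monomial → Carrier
    evalM (s , cs , ws) = sign s (prodC cs * prodX ws)

    evalP : List Monomial → Carrier
    evalP = foldr (λ m x → evalM m + x) 0#

    swap+ : ∀ x y z → x + (y + z) ≈ y + (x + z)
    swap+ x y z = trans (sym (+-assoc x y z)) (trans (+-congʳ (+-comm x y)) (+-assoc y x z))

    prodC-central : ∀ cs → Central (prodC cs)
    prodC-central []       y = trans (*-identityˡ y) (sym (*-identityʳ y))
    prodC-central (i ∷ cs) y = begin
      central i * prodC cs * y   ≈⟨ *-assoc _ _ _ ⟩
      central i * (prodC cs * y) ≈⟨ *-congˡ (prodC-central cs y) ⟩
      central i * (y * prodC cs) ≈⟨ *-assoc _ _ _ ⟨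
      central i * y * prodC cs   ≈⟨ *-congʳ (proj₂ (lookupC Cs i) y) ⟩
      y * central i * prodC cs   ≈⟨ *-assoc _ _ _ ⟩
      y * (central i * prodC cs) ∎

    insertLetter-sound : ∀ i cs → prodC (insertLetter i cs) ≈ central i * prodC cs
    insertLetter-sound i [] = refl
    insertLetter-sound i (j ∷ cs) with i <ᵇ j
    ... | true  = refl
    ... | false = begin
      central j * prodC (insertLetter i cs) ≈⟨ *-congˡ (insertLetter-sound i cs) ⟩
      central j * (central i * prodC cs)    ≈⟨ *-assoc _ _ _ ⟨
      central j * central i * prodC cs      ≈⟨ *-congʳ (proj₂ (lookupC Cs j) _) ⟩
      central i * central j * prodC cs      ≈⟨ *-assoc _ _ _ ⟩
      central i * (central j * prodC cs)    ∎

    insertLetters-sound : ∀ cs cs′ → prodC (foldr insertLetter cs′ cs) ≈ prodC cs * prodC cs′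
    insertLetters-sound []       cs′ = sym (*-identityˡ _)
    insertLetters-sound (i ∷ cs) cs′ = trans (insertLetter-sound i (foldr insertLetter cs′ cs))
      (trans (*-congˡ (insertLetters-sound cs cs′)) (sym (*-assoc _ _ _)))

    prodX-++ : ∀ ws ws′ → prodX (ws ++ ws′) ≈ prodX ws * prodX ws′
    prodX-++ []       ws′ = sym (*-identityˡ _)
    prodX-++ (i ∷ ws) ws′ = trans (*-congˡ (prodX-++ ws ws′)) (sym (*-assoc _ _ _))

    cancelˡ : ∀ x y → x + (- x + y) ≈ y
    cancelˡ x y = trans (sym (+-assoc _ _ _)) (trans (+-congʳ (-‿inverseʳ x)) (+-identityˡ y))

    cancelʳ : ∀ x y → - x + (x + y) ≈ y
    cancelʳ x y = trans (sym (+-assoc _ _ _)) (trans (+-congʳ (-‿inverseˡ x)) (+-identityˡ y))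

    insert-sound : ∀ m P → evalP (insert m P) ≈ evalM m + evalP P
    insert-sound m [] = refl
    insert-sound (s , cs , ws) ((s′ , cs′ , ws′) ∷ P)
      with List.≡-dec ℕ._≟_ cs cs′ | List.≡-dec ℕ._≟_ ws ws′
    insert-sound (true  , cs , ws) ((true  , cs′ , ws′) ∷ P) | yes _      | yes _      = refl
    insert-sound (true  , cs , ws) ((false , cs′ , ws′) ∷ P) | yes ≡.refl | yes ≡.refl = sym (cancelˡ _ _)
    insert-sound (false , cs , ws) ((true  , cs′ , ws′) ∷ P) | yes ≡.refl | yes ≡.refl = sym (cancelʳ _ _)
    insert-sound (false , cs , ws) ((false , cs′ , ws′) ∷ P) | yes _      | yes _      = refl
    insert-sound (s , cs , ws) ((s′ , cs′ , ws′) ∷ P) | yes _ | no _ with lexLt ws ws′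
    ... | true  = refl
    ... | false = trans (+-congˡ (insert-sound (s , cs , ws) P)) (swap+ _ _ _)
    insert-sound (s , cs , ws) ((s′ , cs′ , ws′) ∷ P) | no _ | _ with lexLt cs cs′
    ... | true  = refl
    ... | false = trans (+-congˡ (insert-sound (s , cs , ws) P)) (swap+ _ _ _)

    add-sound : ∀ P Q → evalP (add P Q) ≈ evalP P + evalP Q
    add-sound []      Q = sym (+-identityˡ _)
    add-sound (m ∷ P) Q = trans (insert-sound m (add P Q))
      (trans (+-congˡ (add-sound P Q)) (sym (+-assoc _ _ _)))

    sign-xnor : ∀ s s′ x y → sign (xnor s s′) (x * y) ≈ sign s x * sign s′ y
    sign-xnor true  true  x y = refl
    sign-xnor true  false x y = -‿distribʳ-* x y
    sign-xnor false true  x y = -‿distribˡ-* x y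
    sign-xnor false false x y = sym (-x*-y≈x*y x y)
      where
      -x*-y≈x*y : ∀ x y → - x * - y ≈ x * y
      -x*-y≈x*y x y = trans (sym (-‿distribˡ-* x (- y)))
        (trans (-‿cong (sym (-‿distribʳ-* x y))) (-‿involutive _))

    sign-cong : ∀ s {x y} → x ≈ y → sign s x ≈ sign s y
    sign-cong true  e = e
    sign-cong false e = -‿cong e

    mulMonomial-sound : ∀ m n → evalM (mulMonomial m n) ≈ evalM m * evalM n
    mulMonomial-sound (s , cs , ws) (s′ , cs′ , ws′) =
      trans (sign-cong (xnor s s′) rearrange) (sign-xnor s s′ _ _)
      where
      rearrange : prodC (foldr insertLetter cs′ cs) * prodX (ws ++ ws′)
                ≈ prodC cs * prodX ws * (prodC cs′ * prodX ws′)
      rearrange = begin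
        prodC (foldr insertLetter cs′ cs) * prodX (ws ++ ws′)
          ≈⟨ *-cong (insertLetters-sound cs cs′) (prodX-++ ws ws′) ⟩
        prodC cs * prodC cs′ * (prodX ws * prodX ws′)   ≈⟨ *-assoc _ _ _ ⟩
        prodC cs * (prodC cs′ * (prodX ws * prodX ws′)) ≈⟨ *-congˡ (*-assoc _ _ _) ⟨
        prodC cs * (prodC cs′ * prodX ws * prodX ws′)   ≈⟨ *-congˡ (*-congʳ (prodC-central cs′ _)) ⟩
        prodC cs * (prodX ws * prodC cs′ * prodX ws′)   ≈⟨ *-congˡ (*-assoc _ _ _) ⟩
        prodC cs * (prodX ws * (prodC cs′ * prodX ws′)) ≈⟨ *-assoc _ _ _ ⟨
        prodC cs * prodX ws * (prodC cs′ * prodX ws′)   ∎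

    mulBy-sound : ∀ m P → evalP (mulBy m P) ≈ evalM m * evalP P
    mulBy-sound m []      = sym (zeroʳ _)
    mulBy-sound m (n ∷ P) = trans (insert-sound (mulMonomial m n) (mulBy m P))
      (trans (+-cong (mulMonomial-sound m n) (mulBy-sound m P)) (sym (distribˡ _ _ _)))

    mul-sound : ∀ P Q → evalP (mul P Q) ≈ evalP P * evalP Q
    mul-sound []      Q = sym (zeroˡ _)
    mul-sound (m ∷ P) Q = trans (add-sound (mulBy m Q) (mul P Q))
      (trans (+-cong (mulBy-sound m Q) (mul-sound P Q)) (sym (distribʳ _ _ _)))

    flip-sound : ∀ P → evalP (map flip P) ≈ - evalP P
    flip-sound []            = sym -0#≈0#
    flip-sound ((s , m) ∷ P) = trans (+-cong (sign-not s _) (flip-sound P)) (-‿+-comm _ _)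
      where
      sign-not : ∀ s x → sign (not s) x ≈ - sign s x
      sign-not true  x = refl
      sign-not false x = sym (-‿involutive x)

    normalise-sound : ∀ e → evalP (normalise e) ≈ ⟦ e ⟧
    normalise-sound 𝟘         = refl
    normalise-sound 𝟙         = trans (+-identityʳ _) (*-identityˡ _)
    normalise-sound (con i)   = trans (+-identityʳ _) (trans (*-identityʳ _) (*-identityʳ _))
    normalise-sound (var i)   = trans (+-identityʳ _) (trans (*-identityˡ _) (*-identityʳ _))
    normalise-sound (e :+ e′) = trans (add-sound (normalise e) (normalise e′))
      (+-cong (normalise-sound e) (normalise-sound e′))
    normalise-sound (e :- e′) = trans (add-sound (map flip (normalise e′)) (normalise e))
      (trans (+-cong (trans (flip-sound (normalise e′)) (-‿cong (normalise-sound e′))) (normalise-sound e))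
             (+-comm _ _))
    normalise-sound (e :* e′) = trans (mul-sound (normalise e) (normalise e′))
      (*-cong (normalise-sound e) (normalise-sound e′))

    solve : ∀ e e′ → normalise e ≡ normalise e′ → ⟦ e ⟧ ≈ ⟦ e′ ⟧
    solve e e′ eq = trans (sym (normalise-sound e))
      (trans (reflexive (≡.cong evalP eq)) (normalise-sound e′))

  -- An identity that holds modulo relations l ≈ r is proved by solving it in the
  -- free ring after adding the cofactor terms u * (l - r) * v, then dropping these.
  dropRelation : ∀ {x} u {l r} v → l ≈ r → x + u * (l - r) * v ≈ x
  dropRelation {x} u {l} {r} v l≈r = begin
    x + u * (l - r) * v ≈⟨ +-congˡ (*-congʳ (*-congˡ (x≈y⇒x-y≈0 l≈r))) ⟩
    x + u * 0# * v      ≈⟨ +-congˡ (*-congʳ (zeroʳ u)) ⟩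
    x + 0# * v          ≈⟨ +-congˡ (zeroˡ v) ⟩
    x + 0#              ≈⟨ +-identityʳ x ⟩
    x                   ∎
    where
    x≈y⇒x-y≈0 : ∀ {x y} → x ≈ y → x - y ≈ 0#
    x≈y⇒x-y≈0 {x} {y} x≈y = trans (+-congʳ x≈y) (-‿inverseʳ y)

-- The Hecke relations

-- The ring is arbitrary, so that the same calculations apply to operators and, through the opposite
-- ring, to mirror images. The generators are T_1, ..., T_{N-1}; `T 0` satisfies no relation and
-- enters the recursions below only in products with `b 0` or `b* 0`, which are 0.
record HeckeGenerators {c ℓ} (R : Ring c ℓ) (N : ℕ) : Set (c ⊔ ℓ) where
  open Ring R
  field
    q         : Carrier
    q-central : ∀ x → q * x ≈ x * q
    T         : ℕ → Carrier
    quadratic : ∀ j → suc j < N → T (suc j) * T (suc j) ≈ (q - 1#) * T (suc j) + q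
    braid     : ∀ j → suc (suc j) < N →
                T (suc (suc j)) * T (suc j) * T (suc (suc j)) ≈ T (suc j) * T (suc (suc j)) * T (suc j)
    far       : ∀ i j → suc (suc i) < j → j < N → T (suc i) * T j ≈ T j * T (suc i)

-- Identities between 𝓑_m, 𝓑*_m and the Jucys-Murphy elements

module HeckeAlgebra {c ℓ} (R : Ring c ℓ) (N : ℕ) (G : HeckeGenerators R N) where
  open Ring R
  open HeckeGenerators G
  open NoncommutativeSolver R
  open SetoidReasoning setoid

  infix 4 _commutes_
  _commutes_ : Carrier → Carrier → Set ℓ
  x commutes y = x * y ≈ y * x

  commutes-0 : ∀ x → x commutes 0#
  commutes-0 x = trans (zeroʳ x) (sym (zeroˡ x))

  commutes-1 : ∀ x → x commutes 1#
  commutes-1 x = trans (*-identityʳ x) (sym (*-identityˡ x))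

  commutes-+ : ∀ {x y z} → x commutes y → x commutes z → x commutes y + z
  commutes-+ xy xz = trans (distribˡ _ _ _) (trans (+-cong xy xz) (sym (distribʳ _ _ _)))

  commutes-* : ∀ {x y z} → x commutes y → x commutes z → x commutes y * z
  commutes-* xy xz = trans (sym (*-assoc _ _ _)) (trans (*-congʳ xy)
    (trans (*-assoc _ _ _) (trans (*-congˡ xz) (sym (*-assoc _ _ _)))))

  commutes-neg : ∀ {x y} → x commutes y → x commutes - y
  commutes-neg {x} {y} xy = trans (sym (-‿distribʳ-* x y)) (trans (-‿cong xy) (-‿distribˡ-* y x))
    where open RingProperties R

  -- `b` and `b*` are 𝓑_m and 𝓑*_m in Horner form: in the sum for m + 1, all summands but the last,
  -- which is 1, share the outer factor T_m.
  pow bracket b b* K : ℕ → Carrier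
  pow zero    = 1#
  pow (suc k) = q * pow k
  bracket zero    = 0#
  bracket (suc k) = 1# + q * bracket k
  b zero    = 0#
  b (suc m) = 1# + T m * b m
  b* zero    = 0#
  b* (suc m) = 1# + b* m * T m
  -- q^m times the m-th Jucys–Murphy element
  K zero          = 0#
  K (suc zero)    = 0#
  K (suc (suc m)) = pow (suc m) * T (suc m) + T (suc m) * K (suc m) * T (suc m)

  P : ℕ → ℕ → Carrier
  P n       zero    = 1#
  P zero    (suc k) = 0#
  P (suc n) (suc k) = b* (suc n) * P n k * b (suc n)

  pow-central : ∀ k → Central (pow k)
  pow-central zero    y = sym (commutes-1 y)
  pow-central (suc k) y = sym (commutes-* (sym (q-central y)) (sym (pow-central k y)))

  bracket-central : ∀ k → Central (bracket k)
  bracket-central zero    y = sym (commutes-0 y)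
  bracket-central (suc k) y =
    sym (commutes-+ (commutes-1 y) (commutes-* (sym (q-central y)) (sym (bracket-central k y))))

  qᶜ : Σ Carrier Central
  qᶜ = q , q-central

  powᶜ bracketᶜ : ℕ → Σ Carrier Central
  powᶜ k     = pow k , pow-central k
  bracketᶜ k = bracket k , bracket-central k

  bracket-suc : ∀ k → 1# + q * bracket k ≈ bracket k + pow k
  bracket-suc zero    = solve (qᶜ ∷ []) [] (𝟙 :+ con 0 :* 𝟘) (𝟘 :+ 𝟙) ≡.refl
  bracket-suc (suc k) = trans
    (solve (qᶜ ∷ bracketᶜ k ∷ powᶜ k ∷ []) []
      (𝟙 :+ con 0 :* (𝟙 :+ con 0 :* con 1))
      (𝟙 :+ con 0 :* con 1 :+ con 0 :* con 2
        :+ con 0 :* ((𝟙 :+ con 0 :* con 1) :- (con 1 :+ con 2)) :* 𝟙) ≡.refl)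
    (dropRelation _ _ (bracket-suc k))

  -- The subalgebra in question is generated by T 1, …, T (m - 1).
  Centralises : Carrier → ℕ → Set ℓ
  Centralises z m = ∀ j → suc j < m → z commutes T (suc j)

  centralises-≤ : ∀ {z m m′} → m ≤ m′ → Centralises z m′ → Centralises z m
  centralises-≤ m≤m′ h j j<m = h j (ℕ.<-≤-trans j<m m≤m′)

  module _ {z : Carrier} where
    centralises-b : ∀ m → Centralises z m → z commutes b m
    centralises-b zero          h = commutes-0 z
    -- `b 1` contains `T 0`, with which z need not commute; the factor `b 0` removes it.
    centralises-b (suc zero)    h = commutes-+ (commutes-1 z) (trans (*-congˡ (zeroʳ _))
      (trans (commutes-0 z) (*-congʳ (sym (zeroʳ _)))))
    centralises-b (suc (suc m)) h = commutes-+ (commutes-1 z)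
      (commutes-* (h m ℕ.≤-refl) (centralises-b (suc m) (centralises-≤ (ℕ.n≤1+n _) h)))

    centralises-b* : ∀ m → Centralises z m → z commutes b* m
    centralises-b* zero          h = commutes-0 z
    centralises-b* (suc zero)    h = commutes-+ (commutes-1 z) (trans (*-congˡ (zeroˡ _))
      (trans (commutes-0 z) (*-congʳ (sym (zeroˡ _)))))
    centralises-b* (suc (suc m)) h = commutes-+ (commutes-1 z)
      (commutes-* (centralises-b* (suc m) (centralises-≤ (ℕ.n≤1+n _) h)) (h m ℕ.≤-refl))

    centralises-K : ∀ m → Centralises z m → z commutes K m
    centralises-K zero          h = commutes-0 z
    centralises-K (suc zero)    h = commutes-0 z
    centralises-K (suc (suc m)) h = commutes-+
      (commutes-* (sym (pow-central (suc m) z)) (h m ℕ.≤-refl))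
      (commutes-* (commutes-* (h m ℕ.≤-refl) (centralises-K (suc m) (centralises-≤ (ℕ.n≤1+n _) h))) (h m ℕ.≤-refl))

    centralises-P : ∀ m k → Centralises z m → z commutes P m k
    centralises-P m       zero    h = commutes-1 z
    centralises-P zero    (suc k) h = commutes-0 z
    centralises-P (suc m) (suc k) h = commutes-* (commutes-* (centralises-b* (suc m) h)
      (centralises-P m k (centralises-≤ (ℕ.n≤1+n _) h))) (centralises-b (suc m) h)

  T-centralises : ∀ m → suc m < N → Centralises (T (suc m)) m
  T-centralises m m<N j j<m = sym (far j (suc m) (s≤s j<m) m<N)

  -- For j < m the induction hypothesis and far commutation suffice. For j = m, `K` is unfolded
  -- twice; write x = T_{m+2}, t = T_{m+1}, y = K_{m+1}, where x and y commute. Then x t y t x t = x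
  -- t y x t x = x t x y t x = t x t y t x by two braid moves, and t commutes with the remaining
  -- part q^{m+2} x + q^{m+1} x t x by the braid and quadratic relations.
  K-centralises-step : ∀ m → suc (suc m) < N → Centralises (K (suc (suc m))) (suc m) →
                       Centralises (K (suc (suc (suc m)))) (suc (suc m))
  K-centralises-step m m<N ih j j<m with ℕ.<-cmp j m
  ... | tri< j<m′ _ _ = sym (commutes-+
          (commutes-* (sym (pow-central (suc (suc m)) _)) farT)
          (commutes-* (commutes-* farT (sym (ih j (s≤s j<m′)))) farT))
    where
    farT : T (suc j) commutes T (suc (suc m))
    farT = far j (suc (suc m)) (s≤s (s≤s j<m′)) m<N

  ... | tri> _ _ m<j = contradiction (ℕ.≤-trans (s≤s m<j) (ℕ.≤-pred j<m)) ℕ.1+n≰n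
  ... | tri≈ _ ≡.refl _ =
    trans (solve (qᶜ ∷ powᶜ (suc m) ∷ []) (T (suc (suc m)) ∷ T (suc m) ∷ K (suc m) ∷ [])
      (k :* t)
      (t :* k
        :+ s :* br :* t :+ s :* br :* x :+ (𝟘 :- s :* (p :- 𝟙)) :* br :* 𝟙
        :+ (𝟘 :- x :* t :* y) :* br :* 𝟙 :+ 𝟙 :* br :* (y :* t :* x)
        :+ s :* t :* x :* (t :* t :- ((p :- 𝟙) :* t :+ p)) :* 𝟙
        :+ (𝟘 :- s :* x :* t) :* (x :* x :- ((p :- 𝟙) :* x :+ p)) :* 𝟙
        :+ x :* t :* (y :* x :- x :* y) :* (t :* x)) ≡.refl)
    (trans (dropRelation _ _ Kx≈xK) (trans (dropRelation _ _ (quadratic (suc m) m<N))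
    (trans (dropRelation _ _ (quadratic m (ℕ.<⇒≤ m<N))) (trans (dropRelation _ _ br≈)
    (trans (dropRelation _ _ br≈) (trans (dropRelation _ _ br≈) (trans (dropRelation _ _ br≈) (dropRelation _ _ br≈))))))))
    where
    x t y p s k br : Expr
    x = var 0
    t = var 1
    y = var 2
    p = con 0
    s = con 1
    k = p :* s :* x :+ x :* (s :* t :+ t :* y :* t) :* x
    br = x :* t :* x :- t :* x :* t
    br≈ = braid m m<N
    Kx≈xK : K (suc m) * T (suc (suc m)) ≈ T (suc (suc m)) * K (suc m)
    Kx≈xK = sym (centralises-K (suc m) (T-centralises (suc m) m<N))

  K-centralises : ∀ m → m < N → Centralises (K (suc m)) m
  K-centralises (suc zero)    m<N j (s≤s ())
  K-centralises (suc (suc m)) m<N =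
    K-centralises-step m m<N (K-centralises (suc m) (ℕ.<⇒≤ m<N))

  -- There is no braid relation with `T 0`; the outer factors make the equation true for m = 0 as
  -- well, so that the induction in `b-b*` is uniform.
  braid-b : ∀ m → suc m < N →
            b* m * (T (suc m) * T m * T (suc m)) * b m ≈ b* m * (T m * T (suc m) * T m) * b m
  braid-b zero    m<N = trans (zeroʳ _) (sym (zeroʳ _))
  braid-b (suc m) m<N = *-congʳ (*-congˡ (braid m m<N))

  -- Expand (1 + t b)(1 + b* t) with t = T_{m+1} and put the induction hypothesis into t (b b*) t.
  -- As t commutes with `b m` and `b* m`, the braid relation turns its last summand into b*_m T_m t
  -- T_m b_m, which completes b*_{m+1} t b_{m+1}. The relation for t² raises the bracket, and the t
  -- left over has coefficient 1 + q [m+1] - [m+1] = q^{m+1}, as in the new `K`.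
  b-b* : ∀ m → m < N → b (suc m) * b* (suc m) ≈ bracket (suc m) + K (suc m) + b* m * T m * b m
  b-b* zero    m<N = solve (qᶜ ∷ []) (T 0 ∷ [])
    ((𝟙 :+ var 0 :* 𝟘) :* (𝟙 :+ 𝟘 :* var 0)) (𝟙 :+ con 0 :* 𝟘 :+ 𝟘 :+ 𝟘 :* var 0 :* 𝟘) ≡.refl
  b-b* (suc m) m<N = trans
    (solve (qᶜ ∷ bracketᶜ (suc m) ∷ powᶜ (suc m) ∷ [])
           (T (suc m) ∷ T m ∷ b m ∷ b* m ∷ K (suc m) ∷ [])
      ((𝟙 :+ t :* b₁) :* (𝟙 :+ b*₁ :* t))
      (𝟙 :+ p :* n :+ (s :* t :+ t :* k :* t) :+ b*₁ :* t :* b₁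
        :+ 𝟙 :* (𝟙 :+ p :* n :- (n :+ s)) :* t
        :+ n :* (t :* t :- ((p :- 𝟙) :* t :+ p)) :* 𝟙
        :+ 𝟙 :* (d :* (t :* u :* t) :* c′ :- d :* (u :* t :* u) :* c′) :* 𝟙
        :+ t :* d :* u :* (c′ :* t :- t :* c′) :* 𝟙
        :+ 𝟙 :* (t :* d :- d :* t) :* (u :* t :* c′)
        :+ t :* (b₁ :* b*₁ :- (n :+ k :+ d :* u :* c′)) :* t) ≡.refl)
    (trans (dropRelation _ _ (b-b* m (ℕ.<⇒≤ m<N))) (trans (dropRelation _ _ (centralises-b* m T-cent))
    (trans (dropRelation _ _ (sym (centralises-b m T-cent))) (trans (dropRelation _ _ (braid-b m m<N))
    (trans (dropRelation _ _ (quadratic m m<N)) (dropRelation _ _ (bracket-suc (suc m))))))))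
    where
    T-cent = T-centralises m m<N
    t = var 0
    u = var 1
    c′ = var 2
    d = var 3
    k = var 4
    p = con 0
    n = con 1
    s = con 2
    b₁ = 𝟙 :+ u :* c′
    b*₁ = 𝟙 :+ d :* u

  -- With t = T_{m+2}, u = T_{m+1}, c = b_{m+1} and B = 1 + u c, the product of the two factors is B
  -- (1 + t B). In t u c t B the factor c passes t, the braid relation gives u t u c B, and the
  -- induction hypothesis u c B = q c B supplies the q. The other terms are t B + t t B = q t B + q
  -- B.
  T-b-b : ∀ m → m < N → T m * (b m * b (suc m)) ≈ q * (b m * b (suc m))
  T-b-b zero          m<N = trans (*-congˡ (zeroˡ _)) (trans (zeroʳ _)
    (sym (trans (*-congˡ (zeroˡ _)) (zeroʳ _))))
  T-b-b (suc zero)    m<N = trans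
    (solve (qᶜ ∷ []) (T 1 ∷ T 0 ∷ [])
      (t :* (b₁ :* (𝟙 :+ t :* b₁)))
      (p :* (b₁ :* (𝟙 :+ t :* b₁)) :+ 𝟙 :* (t :* t :- ((p :- 𝟙) :* t :+ p)) :* 𝟙) ≡.refl)
    (dropRelation _ _ (quadratic 0 m<N))
    where
    t = var 0
    p = con 0
    b₁ = 𝟙 :+ var 1 :* 𝟘
  T-b-b (suc (suc m)) m<N = trans
    (solve (qᶜ ∷ []) (T (suc (suc m)) ∷ T (suc m) ∷ b (suc m) ∷ [])
      (t :* b₁b₂)
      (p :* b₁b₂
        :+ 𝟙 :* (t :* t :- ((p :- 𝟙) :* t :+ p)) :* b₁
        :+ (t :- p) :* u :* (c′ :* t :- t :* c′) :* b₁
        :+ 𝟙 :* (t :* u :* t :- u :* t :* u) :* (c′ :* b₁)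
        :+ u :* t :* (u :* (c′ :* b₁) :- p :* (c′ :* b₁)) :* 𝟙) ≡.refl)
    (trans (dropRelation _ _ (T-b-b (suc m) (ℕ.<⇒≤ m<N))) (trans (dropRelation _ _ (braid m m<N))
    (trans (dropRelation _ _ (sym (centralises-b (suc m) (T-centralises (suc m) m<N))))
      (dropRelation _ _ (quadratic (suc m) m<N)))))
    where
    t = var 0
    u = var 1
    c′ = var 2
    p = con 0
    b₁ = 𝟙 :+ u :* c′
    b₁b₂ = b₁ :* (𝟙 :+ t :* b₁)

  P-1 : ∀ m → P m 1 ≈ b* m * b m
  P-1 zero    = sym (zeroˡ _)
  P-1 (suc m) = *-congʳ (*-identityʳ _)

  -- The recursion b-P is scaled by q^k to avoid negative powers of q.
  X : ℕ → ℕ → Carrier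
  X m k = q * (pow k * pow k) * P m (suc k)
        + bracket (suc k) * (bracket (suc m) - bracket k + K (suc m)) * P m k

  -- Apply `b-b*` to the first two factors of b_{m+1} b*_{m+1} (P m k) b_{m+1}. In its summand b*_m
  -- T_m b_m the induction hypothesis moves b_m across `P m k`; then T_m passes the `P (m - 1) i`
  -- and acts on b_m b_{m+1} as q. A term with T_m K_m remains; since K_{m+1} = q^m T_m + T_m K_m
  -- T_m and the last T_m again acts as q, it is expressed through K_{m+1}.
  b-P : ∀ m k → m < N → pow k * (b (suc m) * P (suc m) (suc k)) ≈ X m k * b (suc m)
  b-P m zero m<N = trans
    (solve (qᶜ ∷ bracketᶜ (suc m) ∷ [])
           (b (suc m) ∷ b* (suc m) ∷ K (suc m) ∷ P m 1 ∷ b m ∷ b* m ∷ T m ∷ [])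
      (𝟙 :* (B :* (B* :* 𝟙 :* B)))
      ((p :* (𝟙 :* 𝟙) :* p₁ :+ (𝟙 :+ p :* 𝟘) :* (n :- 𝟘 :+ k) :* 𝟙) :* B
        :+ (𝟘 :- p) :* (p₁ :- d :* c′) :* B
        :+ d :* (t :* (c′ :* B) :- p :* (c′ :* B)) :* 𝟙
        :+ 𝟙 :* (B :* B* :- (n :+ k :+ d :* t :* c′)) :* B) ≡.refl)
    (trans (dropRelation _ _ (b-b* m m<N)) (trans (dropRelation _ _ (T-b-b m m<N)) (dropRelation _ _ (P-1 m))))
    where
    p = con 0
    n = con 1
    B = var 0
    B* = var 1
    k = var 2
    p₁ = var 3
    c′ = var 4
    d = var 5
    t = var 6
  b-P zero (suc k) m<N = solve (qᶜ ∷ powᶜ k ∷ bracketᶜ k ∷ []) (b 1 ∷ b* 1 ∷ [])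
    (con 0 :* con 1 :* (var 0 :* (var 1 :* 𝟘 :* var 0)))
    ((con 0 :* (con 0 :* con 1 :* (con 0 :* con 1)) :* 𝟘
      :+ (𝟙 :+ con 0 :* (𝟙 :+ con 0 :* con 2)) :*
         (𝟙 :+ con 0 :* 𝟘 :- (𝟙 :+ con 0 :* con 2) :+ 𝟘) :* 𝟘) :* var 0)
    ≡.refl
  b-P (suc m) (suc k) m<N = trans
    (solve (qᶜ ∷ powᶜ k ∷ powᶜ (suc m) ∷ bracketᶜ k ∷ bracketᶜ (suc m) ∷ [])
           (b (suc (suc m)) ∷ b* (suc (suc m)) ∷ b* (suc m) ∷ b (suc m) ∷ P m k ∷ P m (suc k)
             ∷ T (suc m) ∷ K (suc m) ∷ [])
      (p :* s :* (B :* (B* :* z :* B)))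
      ((p :* (p :* s :* (p :* s)) :* (d :* p₂ :* c′)
         :+ (𝟙 :+ p :* A) :* (N₁ :- A :+ K₁) :* z) :* B
        :+ (𝟘 :- (N₁ :+ K₁)) :* (𝟙 :+ p :* A :- (A :+ p :* s)) :* (z :* B)
        :+ A :* p :* (N₁ :- (n :+ r)) :* (z :* B)
        :+ (𝟘 :- A) :* (K₁ :* d :- d :* K₁) :* (p₁ :* c′ :* B)
        :+ (p :* p :* s :* s :* d :* p₂ :+ p :* A :* (n :- g) :* d :* p₁
             :- A :* d :* t :* k′ :* p₁ :- A :* r :* d :* p₁) :* (t :* (c′ :* B) :- p :* (c′ :* B)) :* 𝟙
        :+ (p :* A :* (n :- g) :* d :- A :* r :* d :- A :* d :* t :* k′) :* (t :* p₁ :- p₁ :* t) :* (c′ :* B)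
        :+ p :* p :* s :* s :* d :* (t :* p₂ :- p₂ :* t) :* (c′ :* B)
        :+ p :* d :* t :* (s :* (c′ :* z) :- (p :* (s :* s) :* p₂ :+ A :* (n :- g :+ k′) :* p₁) :* c′) :* B
        :+ p :* s :* (B :* B* :- (N₁ :+ K₁ :+ d :* t :* c′)) :* (z :* B)) ≡.refl)
    (trans (dropRelation _ _ (b-b* (suc m) m<N)) (trans (dropRelation _ _ (b-P m k (ℕ.<⇒≤ m<N)))
    (trans (dropRelation _ _ (centralises-P m (suc k) T-cent)) (trans (dropRelation _ _ (centralises-P m k T-cent))
    (trans (dropRelation _ _ (T-b-b (suc m) m<N))
    (trans (dropRelation _ _ (centralises-b* (suc m) (K-centralises (suc m) m<N)))
    (trans (dropRelation _ _ (bracket-suc (suc m))) (dropRelation _ _ (bracket-suc (suc k))))))))))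
    where
    T-cent = T-centralises m m<N
    p = con 0
    s = con 1
    r = con 2
    g = con 3
    n = con 4
    B = var 0
    B* = var 1
    d = var 2
    c′ = var 3
    p₁ = var 4
    p₂ = var 5
    t = var 6
    k′ = var 7
    A = 𝟙 :+ p :* g
    N₁ = 𝟙 :+ p :* n
    K₁ = r :* t :+ t :* k′ :* t
    z = d :* p₁ :* c′

  -- Divisibility by the q-factorial

  F F* : ℕ → ℕ → Carrier
  F n zero     = 1#
  F n (suc k)  = b (n ∸ k) * F n k
  F* n zero    = 1#
  F* n (suc k) = F* n k * b* (n ∸ k)

  factorial : ℕ → Carrier
  factorial zero    = 1#
  factorial (suc k) = factorial k * bracket (suc k)

  -- The recursion for 𝓑_{n,k} adds the factor of smallest index, the one for `P` that of largest
  -- index; this lemma and `F*-suc` peel the products from the other end.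
  F-suc : ∀ n k → F (suc n) (suc k) ≈ F n k * b (suc n)
  F-suc n zero    = commutes-1 _
  F-suc n (suc k) = trans (*-congˡ (F-suc n k)) (sym (*-assoc _ _ _))

  F*-suc : ∀ n k → F* (suc n) (suc k) ≈ b* (suc n) * F* n k
  F*-suc n zero    = sym (commutes-1 _)
  F*-suc n (suc k) = trans (*-congʳ (F*-suc n k)) (*-assoc _ _ _)

  F*-vanish : ∀ {n k} → n ≤ k → F* n (suc k) ≈ 0#
  F*-vanish {n} {k} n≤k = trans (*-congˡ (reflexive (≡.cong b* (ℕ.m≤n⇒m∸n≡0 n≤k)))) (zeroʳ _)

  F*-F : ∀ n k → F* n k * F n k ≈ P n k
  F*-F n       zero    = *-identityˡ _
  F*-F zero    (suc k) = trans (*-congʳ (F*-vanish {0} {k} z≤n)) (zeroˡ _)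
  F*-F (suc n) (suc k) = begin
    F* (suc n) (suc k) * F (suc n) (suc k)    ≈⟨ *-cong (F*-suc n k) (F-suc n k) ⟩
    b* (suc n) * F* n k * (F n k * b (suc n)) ≈⟨ solve [] (b* (suc n) ∷ F* n k ∷ F n k ∷ b (suc n) ∷ [])
      (var 0 :* var 1 :* (var 2 :* var 3)) (var 0 :* (var 1 :* var 2) :* var 3) ≡.refl ⟩
    b* (suc n) * (F* n k * F n k) * b (suc n) ≈⟨ *-congʳ (*-congˡ (F*-F n k)) ⟩
    b* (suc n) * P n k * b (suc n)            ∎

  T-b-commute : ∀ {r t} → r < t → t < N → T t * b r ≈ b r * T t
  T-b-commute {r} {suc t} r<t t<N = centralises-b r (centralises-≤ (ℕ.≤-pred r<t) (T-centralises t t<N))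

  b*-T-commute : ∀ {r t} → r < t → t < N → b* r * T t ≈ T t * b* r
  b*-T-commute {r} {suc t} r<t t<N =
    sym (centralises-b* r (centralises-≤ (ℕ.≤-pred r<t) (T-centralises t t<N)))

  -- On y the parabolic subalgebra generated by T_{m+1}, ..., T_{n-1} acts through its index
  -- representation.
  Absorbs : ℕ → ℕ → Carrier → Set ℓ
  Absorbs m n y = ∀ j → m ≤ j → suc j < n → T (suc j) * y ≈ q * y

  scale-past : ∀ {x y z} → x * y ≈ y * x → x * z ≈ q * z → x * (y * z) ≈ q * (y * z)
  scale-past {x} {y} {z} xy xz = begin
    x * (y * z) ≈⟨ *-assoc _ _ _ ⟨
    x * y * z   ≈⟨ *-congʳ xy ⟩
    y * x * z   ≈⟨ *-assoc _ _ _ ⟩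
    y * (x * z) ≈⟨ *-congˡ xz ⟩
    y * (q * z) ≈⟨ solve (qᶜ ∷ []) (y ∷ z ∷ []) (var 0 :* (con 0 :* var 1)) (con 0 :* (var 0 :* var 1)) ≡.refl ⟩
    q * (y * z) ∎

  n∸k≡suc : ∀ {n k} → k < n → n ∸ k ≡ suc (n ∸ suc k)
  n∸k≡suc {suc n} {k} (s≤s k≤n) = ℕ.+-∸-assoc 1 k≤n

  ∸-between : ∀ n k {j} → n ∸ suc k ≤ j → ¬ (n ∸ k ≤ j) → n ∸ k ≡ suc j
  ∸-between n k lo hi = ℕ.≤-antisym
    (ℕ.≤-trans (ℕ.m≤n+m∸n (n ∸ k) 1)
      (s≤s (ℕ.≤-trans (ℕ.≤-reflexive (≡.trans (ℕ.∸-+-assoc n k 1) (≡.cong (n ∸_) (ℕ.+-comm k 1)))) lo)))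
    (ℕ.≰⇒> hi)

  ∸≡suc⇒< : ∀ n k {j} → n ∸ k ≡ suc j → k < n
  ∸≡suc⇒< n k eq = ℕ.m∸n≢0⇒n<m λ eq₀ → ℕ.1+n≢0 (≡.trans (≡.sym eq) eq₀)

  -- The new factor b_{n-k} commutes with every T_i for i > n - k. The one generator that is new to
  -- the range, T_{n-k}, meets b_{n-k} b_{n-k+1}, where `T-b-b` applies.
  F-absorbs : ∀ n k → n ≤ N → Absorbs (n ∸ k) n (F n k)
  F-absorbs n zero    n≤N j n≤j j<n = contradiction (ℕ.≤-trans (ℕ.<⇒≤ j<n) n≤j) ℕ.1+n≰n
  F-absorbs n (suc k) n≤N j lo j<n with n ∸ k ℕ.≤? j
  ... | yes n∸k≤j = scale-past (T-b-commute (s≤s n∸k≤j) (ℕ.<-≤-trans j<n n≤N)) (F-absorbs n k n≤N j n∸k≤j j<n)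
  F-absorbs n (suc zero)    n≤N j lo j<n | no n≰j =
    contradiction (ℕ.≤-trans (ℕ.≤-reflexive (≡.cong suc (∸-between n 0 lo n≰j))) j<n) ℕ.1+n≰n
  F-absorbs n (suc (suc k)) n≤N j lo j<n | no n∸k≰j
    rewrite n∸k≡suc (ℕ.<⇒≤ (∸≡suc⇒< n (suc k) (∸-between n (suc k) lo n∸k≰j)))
          | ∸-between n (suc k) lo n∸k≰j = begin
    T (suc j) * (b (suc j) * (b (suc (suc j)) * F n k)) ≈⟨ *-congˡ (*-assoc _ _ _) ⟨
    T (suc j) * (b (suc j) * b (suc (suc j)) * F n k)   ≈⟨ *-assoc _ _ _ ⟨
    T (suc j) * (b (suc j) * b (suc (suc j))) * F n k   ≈⟨ *-congʳ (T-b-b (suc j) (ℕ.<-≤-trans j<n n≤N)) ⟩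
    q * (b (suc j) * b (suc (suc j))) * F n k           ≈⟨ *-assoc _ _ _ ⟩
    q * (b (suc j) * b (suc (suc j)) * F n k)           ≈⟨ *-congˡ (*-assoc _ _ _) ⟩
    q * (b (suc j) * (b (suc (suc j)) * F n k))         ∎

  -- The `w n i` for i ≤ k are the T_v of the minimal representatives v of the right cosets of S_k
  -- in S_{k+1}, realised on the last generators up to T_n, and `e n (k + 1)` is their sum. Hence
  -- they act as q^i and [k+1]_q on whatever absorbs these generators.
  w e : ℕ → ℕ → Carrier
  w n zero    = 1#
  w n (suc k) = w n k * T (n ∸ k)
  e n zero    = 0#
  e n (suc k) = e n k + w n k

  commutes-w : ∀ n k {z} → (∀ i → i < k → z commutes T (n ∸ i)) → z commutes w n k
  commutes-w n zero    h = commutes-1 _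
  commutes-w n (suc k) h = commutes-* (commutes-w n k (λ i i<k → h i (ℕ.m≤n⇒m≤1+n i<k))) (h k ℕ.≤-refl)

  commutes-e : ∀ n k {z} → (∀ i → i < k → z commutes T (n ∸ i)) → z commutes e n (suc k)
  commutes-e n zero    h = commutes-+ (commutes-0 _) (commutes-1 _)
  commutes-e n (suc k) h =
    commutes-+ (commutes-e n k (λ i i<k → h i (ℕ.m≤n⇒m≤1+n i<k))) (commutes-w n (suc k) h)

  -- Induction on k, multiplying by b*_{n-k} from the right. This factor commutes with T_n, ...,
  -- T_{n-k+1}, hence with `e n (k + 1)`. In the second summand it is split as 1 + b*_{n-k-1}
  -- T_{n-k-1}: the 1 enlarges `e`, the rest lengthens `w`.
  F*-split : ∀ n k → n < N → k ≤ n →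
             F* (suc n) (suc k) ≈ F* n k * e n (suc k) + F* n (suc k) * w n (suc k)
  F*-split n zero    n<N k≤n = solve [] (b* n ∷ T n ∷ [])
    (𝟙 :* (𝟙 :+ var 0 :* var 1)) (𝟙 :* (𝟘 :+ 𝟙) :+ 𝟙 :* var 0 :* (𝟙 :* var 1)) ≡.refl
  F*-split n (suc k) n<N k<n = begin
    F* (suc n) (suc k) * b* (n ∸ k)
      ≈⟨ *-congʳ (F*-split n k n<N (ℕ.<⇒≤ k<n)) ⟩
    (F* n k * e n (suc k) + F* n k * b* (n ∸ k) * w n (suc k)) * b* (n ∸ k)
      ≈⟨ trans
        (solve [] (F* n k ∷ e n (suc k) ∷ b* (n ∸ k) ∷ w n (suc k) ∷ b* (n ∸ suc k) ∷ T (n ∸ suc k) ∷ [])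
          ((f :* x :+ f :* β :* y) :* β)
          (f :* β :* (x :+ y) :+ f :* β :* ρ :* (y :* t)
            :+ f :* (x :* β :- β :* x) :* 𝟙
            :+ f :* β :* y :* (β :- (𝟙 :+ ρ :* t)) :* 𝟙
            :+ f :* β :* (y :* ρ :- ρ :* y) :* t) ≡.refl)
        (trans (dropRelation _ _ (sym (commutes-w n (suc k) (λ i i≤k → b*-T-commute
                  (ℕ.∸-monoʳ-< i≤k k<n) (n∸i<N i)))))
          (trans (dropRelation _ _ (reflexive (≡.cong b* (n∸k≡suc k<n))))
            (dropRelation _ _ (sym (commutes-e n k (λ i i<k → b*-T-commute
                  (ℕ.∸-monoʳ-< i<k (ℕ.<⇒≤ k<n)) (n∸i<N i))))))) ⟩
    F* n k * b* (n ∸ k) * (e n (suc k) + w n (suc k))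
      + F* n k * b* (n ∸ k) * b* (n ∸ suc k) * (w n (suc k) * T (n ∸ suc k)) ∎
    where
    n∸i<N : ∀ i → n ∸ i < N
    n∸i<N i = ℕ.≤-<-trans (ℕ.m∸n≤m n i) n<N
    f = var 0
    x = var 1
    β = var 2
    y = var 3
    ρ = var 4
    t = var 5

  absorb-T : ∀ {m n y t} → Absorbs m n y → m < t → t < n → T t * y ≈ q * y
  absorb-T {t = suc j} h m<t t<n = h j (ℕ.≤-pred m<t) t<n

  w-absorb : ∀ n k i {y} → k ≤ n → i ≤ k → Absorbs (n ∸ k) (suc n) y → w n i * y ≈ pow i * y
  w-absorb n k zero    {y} k≤n i≤k h = refl
  w-absorb n k (suc i) {y} k≤n i<k h = begin
    w n i * T (n ∸ i) * y   ≈⟨ *-assoc _ _ _ ⟩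
    w n i * (T (n ∸ i) * y) ≈⟨ *-congˡ (absorb-T h (ℕ.∸-monoʳ-< i<k k≤n) (s≤s (ℕ.m∸n≤m n i))) ⟩
    w n i * (q * y)         ≈⟨ solve (qᶜ ∷ []) (w n i ∷ y ∷ []) (var 0 :* (con 0 :* var 1)) (con 0 :* (var 0 :* var 1)) ≡.refl ⟩
    q * (w n i * y)         ≈⟨ *-congˡ (w-absorb n k i k≤n (ℕ.<⇒≤ i<k) h) ⟩
    q * (pow i * y)         ≈⟨ *-assoc _ _ _ ⟨
    q * pow i * y           ∎

  e-absorb : ∀ n k i {y} → k ≤ n → i ≤ suc k → Absorbs (n ∸ k) (suc n) y → e n i * y ≈ bracket i * y
  e-absorb n k zero    {y} k≤n i≤k h = refl
  e-absorb n k (suc i) {y} k≤n (s≤s i≤k) h = begin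
    (e n i + w n i) * y         ≈⟨ distribʳ _ _ _ ⟩
    e n i * y + w n i * y       ≈⟨ +-cong (e-absorb n k i k≤n (ℕ.m≤n⇒m≤1+n i≤k) h) (w-absorb n k i k≤n i≤k h) ⟩
    bracket i * y + pow i * y   ≈⟨ distribʳ _ _ _ ⟨
    (bracket i + pow i) * y     ≈⟨ *-congʳ (bracket-suc i) ⟨
    bracket (suc i) * y         ∎

  -- T_{j+1} passes the factors of index above j + 2, the braid relation for T_{j+1} T_{j+2} T_{j+1}
  -- leaves T_{j+2} on the right, and this passes the factors of index below j + 1. So the index
  -- rises by one on the way.
  T-w : ∀ n k j → n < N → k < n → n ∸ k ≤ suc j → suc j < n →
        T (suc j) * w n (suc k) ≈ w n (suc k) * T (suc (suc j))
  T-w n zero    j n<N k<n lo j<n = contradiction (ℕ.≤-trans j<n lo) ℕ.1+n≰n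
  T-w n (suc k) j n<N k<n lo j<n with n ∸ k ℕ.≤? suc j
  ... | yes n∸k≤j = begin
    T (suc j) * (w n (suc k) * T (n ∸ suc k))         ≈⟨ *-assoc _ _ _ ⟨
    T (suc j) * w n (suc k) * T (n ∸ suc k)           ≈⟨ *-congʳ (T-w n k j n<N (ℕ.<⇒≤ k<n) n∸k≤j j<n) ⟩
    w n (suc k) * T (suc (suc j)) * T (n ∸ suc k)     ≈⟨ *-assoc _ _ _ ⟩
    w n (suc k) * (T (suc (suc j)) * T (n ∸ suc k))   ≈⟨ *-congˡ (farT (n ∸ suc k) (ℕ.m<n⇒0<n∸m k<n)
      (≡.subst (ℕ._≤ suc j) (n∸k≡suc (ℕ.<⇒≤ k<n)) n∸k≤j)) ⟩
    w n (suc k) * (T (n ∸ suc k) * T (suc (suc j)))   ≈⟨ *-assoc _ _ _ ⟨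
    w n (suc k) * T (n ∸ suc k) * T (suc (suc j))     ∎
    where
    farT : ∀ t → 0 < t → t < suc j → T (suc (suc j)) * T t ≈ T t * T (suc (suc j))
    farT (suc i) 0<t t<j = sym (far i (suc (suc j)) (s≤s t<j) (ℕ.≤-<-trans j<n n<N))
  ... | no n∸k≰j
    rewrite ∸-between n k lo n∸k≰j
          | ≡.sym (ℕ.suc-injective (≡.trans (≡.sym (∸-between n k lo n∸k≰j)) (n∸k≡suc (ℕ.<⇒≤ k<n)))) = trans
    (solve [] (T (suc j) ∷ w n k ∷ T (suc (suc j)) ∷ [])
      (t :* (y :* u :* t))
      (y :* u :* t :* u
        :+ (𝟘 :- y) :* (u :* t :* u :- t :* u :* t) :* 𝟙
        :+ 𝟙 :* (t :* y :- y :* t) :* (u :* t)) ≡.refl)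
    (trans (dropRelation _ _ (commutes-w n k T-T)) (dropRelation _ _ (braid j (ℕ.≤-<-trans j<n n<N))))
    where
    t = var 0
    y = var 1
    u = var 2
    T-T : ∀ i → i < k → T (suc j) commutes T (n ∸ i)
    T-T i i<k = far j (n ∸ i)
      (≡.subst (ℕ._< n ∸ i) (∸-between n k lo n∸k≰j) (ℕ.∸-monoʳ-< i<k (ℕ.<⇒≤ (ℕ.<⇒≤ k<n))))
      (ℕ.≤-<-trans (ℕ.m∸n≤m n i) n<N)

  w-Absorbs : ∀ n k {y} → n < N → k < n → Absorbs (n ∸ k) (suc n) y → Absorbs (n ∸ suc k) n (w n (suc k) * y)
  w-Absorbs n k {y} n<N k<n h j lo j<n = begin
    T (suc j) * (w n (suc k) * y)         ≈⟨ *-assoc _ _ _ ⟨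
    T (suc j) * w n (suc k) * y           ≈⟨ *-congʳ (T-w n k j n<N k<n n∸k≤j j<n) ⟩
    w n (suc k) * T (suc (suc j)) * y     ≈⟨ *-assoc _ _ _ ⟩
    w n (suc k) * (T (suc (suc j)) * y)   ≈⟨ *-congˡ (h (suc j) n∸k≤j (s≤s j<n)) ⟩
    w n (suc k) * (q * y)                 ≈⟨ solve (qᶜ ∷ []) (w n (suc k) ∷ y ∷ [])
      (var 0 :* (con 0 :* var 1)) (con 0 :* (var 0 :* var 1)) ≡.refl ⟩
    q * (w n (suc k) * y)                 ∎
    where
    n∸k≤j : n ∸ k ≤ suc j
    n∸k≤j = ≡.subst (ℕ._≤ suc j) (≡.sym (n∸k≡suc k<n)) (s≤s lo)

  -- Induction on n for all k and y at once, by `F*-split`. In the first summand `e n (k + 1)` acts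
  -- on y as [k+1]_q, and the hypothesis for k supplies [k]!_q. In the second, `w n (k + 1) * y`
  -- absorbs the generators with indices lowered by one, so the hypothesis for k + 1 gives [k+1]!_q
  -- at once.
  factorial-divides : ∀ n k {y} → n ≤ N → Absorbs (n ∸ k) n y → ∃ λ z → F* n k * y ≈ factorial k * z
  factorial-divides n       zero    {y} n≤N h = y , refl
  factorial-divides zero    (suc k) {y} n≤N h =
    0# , trans (*-congʳ (F*-vanish {0} {k} z≤n)) (trans (zeroˡ y) (sym (zeroʳ _)))
  factorial-divides (suc n) (suc k) {y} n<N h with k ℕ.≤? n
  ... | no k≰n = 0# , trans (*-congʳ (F*-vanish (ℕ.≰⇒> k≰n))) (trans (zeroˡ y) (sym (zeroʳ _)))
  ... | yes k≤n with factorial-divides n k (ℕ.<⇒≤ n<N) (λ j lo j<n → h j lo (ℕ.m≤n⇒m≤1+n j<n)) | second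
    where
    second : ∃ λ z → F* n (suc k) * (w n (suc k) * y) ≈ factorial (suc k) * z
    second with k ℕ.<? n
    ... | yes k<n = factorial-divides n (suc k) (ℕ.<⇒≤ n<N) (w-Absorbs n k n<N k<n h)
    -- Here k = n, and the product contains the factor `b* 0`.
    ... | no k≮n  = 0# , trans (*-congʳ (F*-vanish (ℕ.≮⇒≥ k≮n))) (trans (zeroˡ _) (sym (zeroʳ _)))
  ... | z₁ , eq₁ | z₂ , eq₂ = z₁ + z₂ , (begin
    F* (suc n) (suc k) * y
      ≈⟨ *-congʳ (F*-split n k n<N k≤n) ⟩
    (F* n k * e n (suc k) + F* n (suc k) * w n (suc k)) * y
      ≈⟨ trans
        (solve (bracketᶜ (suc k) ∷ []) (F* n k ∷ e n (suc k) ∷ F* n (suc k) ∷ w n (suc k) ∷ y ∷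
                factorial k ∷ z₁ ∷ z₂ ∷ [])
          ((f :* x :+ f′ :* u) :* η)
          (φ :* c′ :* (ζ₁ :+ ζ₂)
            :+ 𝟙 :* (f′ :* (u :* η) :- φ :* c′ :* ζ₂) :* 𝟙
            :+ c′ :* (f :* η :- φ :* ζ₁) :* 𝟙
            :+ f :* (x :* η :- c′ :* η) :* 𝟙) ≡.refl)
        (trans (dropRelation _ _ (e-absorb n k (suc k) k≤n ℕ.≤-refl h))
          (trans (dropRelation _ _ eq₁) (dropRelation _ _ eq₂))) ⟩
    factorial (suc k) * (z₁ + z₂) ∎)
    where
    c′ = con 0
    f = var 0
    x = var 1
    f′ = var 2
    u = var 3
    η = var 4
    φ = var 5
    ζ₁ = var 6
    ζ₂ = var 7

  factorial-divides-P : ∀ n k → n ≤ N → ∃ λ z → P n k ≈ factorial k * z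
  factorial-divides-P n k n≤N with factorial-divides n k n≤N (F-absorbs n k n≤N)
  ... | z , eq = z , trans (sym (F*-F n k)) eq

-- Commutation of the elements `P n k`

module _ {c ℓ} (R : Ring c ℓ) (N : ℕ) (G : HeckeGenerators R N)
         (q-cancel : ∀ x y → Ring._≈_ R (Ring._*_ R (HeckeGenerators.q G) x) (Ring._*_ R (HeckeGenerators.q G) y) →
                     Ring._≈_ R x y) where
  open Ring R
  open HeckeGenerators G
  open NoncommutativeSolver R
  open SetoidReasoning setoid
  open HeckeAlgebra R N G

  -- In the opposite ring `b` and `b*` trade places while `K` and `P` stay the same, so `b-P` read
  -- there yields the mirror identity `P-b*` without a second calculation.
  opposite : HeckeGenerators (Op.ring R) N
  opposite = record
    { q = q
    ; q-central = λ x → sym (q-central x)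
    ; T = T
    ; quadratic = λ j j<N → trans (quadratic j j<N) (+-congʳ (sym (T-[q-1] (suc j))))
    ; braid = λ j j<N → trans (sym (*-assoc _ _ _)) (trans (braid j j<N) (*-assoc _ _ _))
    ; far = λ i j i<j j<N → sym (far i j i<j j<N)
    }
    where
    T-[q-1] : ∀ i → T i * (q - 1#) ≈ (q - 1#) * T i
    T-[q-1] i = solve (qᶜ ∷ []) (T i ∷ []) (var 0 :* (con 0 :- 𝟙)) ((con 0 :- 𝟙) :* var 0) ≡.refl

  private
    module O = HeckeAlgebra (Op.ring R) N opposite

  pow-op : ∀ k → O.pow k ≈ pow k
  pow-op zero    = refl
  pow-op (suc k) = trans (*-congʳ (pow-op k)) (sym (q-central _))

  bracket-op : ∀ k → O.bracket k ≈ bracket k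
  bracket-op zero    = refl
  bracket-op (suc k) = +-congˡ (trans (*-congʳ (bracket-op k)) (sym (q-central _)))

  b-op : ∀ m → O.b m ≈ b* m
  b-op zero    = refl
  b-op (suc m) = +-congˡ (*-congʳ (b-op m))

  b*-op : ∀ m → O.b* m ≈ b m
  b*-op zero    = refl
  b*-op (suc m) = +-congˡ (*-congˡ (b*-op m))

  K-op : ∀ m → O.K m ≈ K m
  K-op zero          = refl
  K-op (suc zero)    = refl
  K-op (suc (suc m)) = +-cong
    (trans (*-congˡ (pow-op (suc m))) (sym (pow-central (suc m) _)))
    (trans (*-congˡ (*-congʳ (K-op (suc m)))) (sym (*-assoc _ _ _)))

  P-op : ∀ m k → O.P m k ≈ P m k
  P-op m       zero    = refl
  P-op zero    (suc k) = refl
  P-op (suc m) (suc k) = trans (*-cong (b-op (suc m)) (*-cong (P-op m k) (b*-op (suc m)))) (sym (*-assoc _ _ _))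

  -- Reversal leaves K_{m+1} to the right of `P m k`; the original order is restored because K_{m+1}
  -- centralises the subalgebra that contains `P m k`.
  X-op : ∀ m k → m < N → O.X m k ≈ X m k
  X-op m k m<N = begin
    O.P m (suc k) * (O.pow k * O.pow k * q)
      + O.P m k * ((O.bracket (suc m) - O.bracket k + O.K (suc m)) * O.bracket (suc k))
      ≈⟨ +-cong (*-cong (P-op m (suc k)) (*-congʳ (*-cong (pow-op k) (pow-op k))))
          (*-cong (P-op m k) (*-cong (+-cong (+-cong (bracket-op (suc m)) (-‿cong (bracket-op k)))
            (K-op (suc m))) (bracket-op (suc k)))) ⟩
    P m (suc k) * (pow k * pow k * q)
      + P m k * ((bracket (suc m) - bracket k + K (suc m)) * bracket (suc k))
      ≈⟨ trans
        (solve (qᶜ ∷ powᶜ k ∷ bracketᶜ (suc m) ∷ bracketᶜ k ∷ bracketᶜ (suc k) ∷ [])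
               (P m (suc k) ∷ P m k ∷ K (suc m) ∷ [])
          (var 0 :* (con 1 :* con 1 :* con 0) :+ var 1 :* ((con 2 :- con 3 :+ var 2) :* con 4))
          (con 0 :* (con 1 :* con 1) :* var 0 :+ con 4 :* (con 2 :- con 3 :+ var 2) :* var 1
            :+ (𝟘 :- con 4) :* (var 2 :* var 1 :- var 1 :* var 2) :* 𝟙) ≡.refl)
        (dropRelation _ _ (centralises-P m k (K-centralises m m<N))) ⟩
    X m k ∎

  P-b* : ∀ m k → m < N → P (suc m) (suc k) * b* (suc m) * pow k ≈ b* (suc m) * X m k
  P-b* m k m<N = begin
    P (suc m) (suc k) * b* (suc m) * pow k       ≈⟨ *-cong (*-cong (P-op (suc m) (suc k)) (b-op (suc m))) (pow-op k) ⟨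
    O.P (suc m) (suc k) * O.b (suc m) * O.pow k  ≈⟨ O.b-P m k m<N ⟩
    O.b (suc m) * O.X m k                        ≈⟨ *-cong (b-op (suc m)) (X-op m k m<N) ⟩
    b* (suc m) * X m k                           ∎

  pow-cancel : ∀ k {x y} → pow k * x ≈ pow k * y → x ≈ y
  pow-cancel zero    eq = trans (sym (*-identityˡ _)) (trans eq (*-identityˡ _))
  pow-cancel (suc k) eq = pow-cancel k (q-cancel _ _ (trans (sym (*-assoc _ _ _)) (trans eq (*-assoc _ _ _))))

  P-commute : ∀ n i j → n ≤ N → P n i * P n j ≈ P n j * P n i
  P-commute n       zero    j       n≤N = sym (commutes-1 _)
  P-commute n       (suc i) zero    n≤N = commutes-1 _
  P-commute zero    (suc i) (suc j) n≤N = refl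
  P-commute (suc m) (suc i) (suc j) m<N = pow-cancel j (begin
    pow j * (b* (suc m) * P m i * b (suc m) * P (suc m) (suc j))
      ≈⟨ solve (powᶜ j ∷ []) (b* (suc m) ∷ P m i ∷ b (suc m) ∷ P (suc m) (suc j) ∷ [])
        (con 0 :* (var 0 :* var 1 :* var 2 :* var 3)) (var 0 :* var 1 :* (con 0 :* (var 2 :* var 3))) ≡.refl ⟩
    b* (suc m) * P m i * (pow j * (b (suc m) * P (suc m) (suc j)))
      ≈⟨ *-congˡ (b-P m j m<N) ⟩
    b* (suc m) * P m i * (X m j * b (suc m))
      ≈⟨ *-assoc _ _ _ ⟨
    b* (suc m) * P m i * X m j * b (suc m)
      ≈⟨ *-congʳ (*-assoc _ _ _) ⟩
    b* (suc m) * (P m i * X m j) * b (suc m)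
      ≈⟨ *-congʳ (*-congˡ P-X) ⟩
    b* (suc m) * (X m j * P m i) * b (suc m)
      ≈⟨ *-congʳ (*-assoc _ _ _) ⟨
    b* (suc m) * X m j * P m i * b (suc m)
      ≈⟨ *-congʳ (*-congʳ (P-b* m j m<N)) ⟨
    P (suc m) (suc j) * b* (suc m) * pow j * P m i * b (suc m)
      ≈⟨ solve (powᶜ j ∷ []) (b* (suc m) ∷ P m i ∷ b (suc m) ∷ P (suc m) (suc j) ∷ [])
        (var 3 :* var 0 :* con 0 :* var 1 :* var 2) (con 0 :* (var 3 :* (var 0 :* var 1 :* var 2))) ≡.refl ⟩
    pow j * (P (suc m) (suc j) * (b* (suc m) * P m i * b (suc m))) ∎)
    where
    m≤N = ℕ.<⇒≤ m<N
    P-X : P m i commutes X m j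
    P-X = commutes-+
      (commutes-* (commutes-* (sym (q-central _)) (commutes-* (sym (pow-central j _)) (sym (pow-central j _))))
        (P-commute m i (suc j) m≤N))
      (commutes-* (commutes-* (sym (bracket-central (suc j) _))
          (commutes-+ (commutes-+ (sym (bracket-central (suc m) _)) (commutes-neg (sym (bracket-central j _))))
            (sym (centralises-P m i (K-centralises m m<N)))))
        (P-commute m i j m≤N))

-- The ring ℤ[q]

at : Poly → ℕ → ℤ
at []      i       = 0ℤ
at (a ∷ p) zero    = a
at (a ∷ p) (suc i) = at p i

-- Equality up to trailing zeros.
infix 4 _≈ₚ_
record _≈ₚ_ (p r : Poly) : Set where
  constructor mk≈
  field at≡ : ∀ i → at p i ≡ at r i
open _≈ₚ_

at-padd : ∀ p r i → at (padd p r) i ≡ at p i ℤ.+ at r i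
at-padd []      r       i       = ≡.sym (ℤ.+-identityˡ _)
at-padd (a ∷ p) []      i       = ≡.sym (ℤ.+-identityʳ _)
at-padd (a ∷ p) (b ∷ r) zero    = ≡.refl
at-padd (a ∷ p) (b ∷ r) (suc i) = at-padd p r i

at-neg : ∀ p i → at (map (λ z → ℤ.- z) p) i ≡ ℤ.- at p i
at-neg []      i       = ≡.refl
at-neg (a ∷ p) zero    = ≡.refl
at-neg (a ∷ p) (suc i) = at-neg p i

at-scale : ∀ x p i → at (map (x ℤ.*_) p) i ≡ x ℤ.* at p i
at-scale x []      i       = ≡.sym (ℤ.*-zeroʳ x)
at-scale x (a ∷ p) zero    = ≡.refl
at-scale x (a ∷ p) (suc i) = at-scale x p i

at-pmul-zero : ∀ x p r → at (pmul (x ∷ p) r) 0 ≡ x ℤ.* at r 0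
at-pmul-zero x p r = ≡.trans (at-padd (map (x ℤ.*_) r) _ 0)
  (≡.trans (ℤ.+-identityʳ _) (at-scale x r 0))

at-pmul-suc : ∀ x p r i → at (pmul (x ∷ p) r) (suc i) ≡ x ℤ.* at r (suc i) ℤ.+ at (pmul p r) i
at-pmul-suc x p r i = ≡.trans (at-padd (map (x ℤ.*_) r) _ (suc i))
  (≡.cong (λ a → a ℤ.+ _) (at-scale x r (suc i)))

pmul-congʳ : ∀ p {r s} → r ≈ₚ s → pmul p r ≈ₚ pmul p s
pmul-congʳ p {r} {s} (mk≈ eq) = mk≈ (go p)
  where
  go : ∀ p i → at (pmul p r) i ≡ at (pmul p s) i
  go []      i       = ≡.refl
  go (x ∷ p) zero    = ≡.trans (at-pmul-zero x p r)
    (≡.trans (≡.cong (x ℤ.*_) (eq 0)) (≡.sym (at-pmul-zero x p s)))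
  go (x ∷ p) (suc i) = ≡.trans (at-pmul-suc x p r i)
    (≡.trans (≡.cong₂ ℤ._+_ (≡.cong (x ℤ.*_) (eq (suc i))) (go p i)) (≡.sym (at-pmul-suc x p s i)))

at-pmul-[] : ∀ p i → at (pmul p []) i ≡ 0ℤ
at-pmul-[] []      i       = ≡.refl
at-pmul-[] (x ∷ p) zero    = ≡.refl
at-pmul-[] (x ∷ p) (suc i) = at-pmul-[] p i

at-pmul-∷-zero : ∀ p y r → at (pmul p (y ∷ r)) 0 ≡ at p 0 ℤ.* y
at-pmul-∷-zero []      y r = ≡.refl
at-pmul-∷-zero (x ∷ p) y r = at-pmul-zero x p (y ∷ r)

-- `pmul` recurses on its first factor. The same recursion on the second factor yields
-- commutativity, from which right distributivity and then associativity follow.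
at-pmul-∷-suc : ∀ p y r i → at (pmul p (y ∷ r)) (suc i) ≡ at p (suc i) ℤ.* y ℤ.+ at (pmul p r) i
at-pmul-∷-suc []      y r i       = ≡.refl
at-pmul-∷-suc (x ∷ p) y r zero    = ≡.trans (at-pmul-suc x p (y ∷ r) 0)
  (≡.trans (ℤ.+-comm (x ℤ.* at r 0) _)
    (≡.cong₂ ℤ._+_ (at-pmul-∷-zero p y r) (≡.sym (at-pmul-zero x p r))))
at-pmul-∷-suc (x ∷ p) y r (suc i)
  rewrite at-pmul-suc x p (y ∷ r) (suc i) | at-pmul-∷-suc p y r i | at-pmul-suc x p r i =
  swap (x ℤ.* at r (suc i)) (at p (suc i) ℤ.* y) _
  where
  swap : ∀ a b c → a ℤ.+ (b ℤ.+ c) ≡ b ℤ.+ (a ℤ.+ c)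
  swap = solve-∀

at-pmul-comm : ∀ p r i → at (pmul p r) i ≡ at (pmul r p) i
at-pmul-comm []      r i       = ≡.sym (at-pmul-[] r i)
at-pmul-comm (x ∷ p) r zero    = ≡.trans (at-pmul-zero x p r)
  (≡.trans (ℤ.*-comm x _) (≡.sym (at-pmul-∷-zero r x p)))
at-pmul-comm (x ∷ p) r (suc i) = ≡.trans (at-pmul-suc x p r i)
  (≡.trans (≡.cong₂ ℤ._+_ (ℤ.*-comm x _) (at-pmul-comm p r i)) (≡.sym (at-pmul-∷-suc r x p i)))

at-pmul-distribˡ : ∀ p r s i → at (pmul p (padd r s)) i ≡ at (pmul p r) i ℤ.+ at (pmul p s) i
at-pmul-distribˡ []      r s i       = ≡.refl
at-pmul-distribˡ (x ∷ p) r s zero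
  rewrite at-pmul-zero x p (padd r s) | at-pmul-zero x p r | at-pmul-zero x p s | at-padd r s 0 =
  ℤ.*-distribˡ-+ x (at r 0) (at s 0)
at-pmul-distribˡ (x ∷ p) r s (suc i)
  rewrite at-pmul-suc x p (padd r s) i | at-pmul-suc x p r i | at-pmul-suc x p s i
        | at-padd r s (suc i) | at-pmul-distribˡ p r s i =
  rearrange x (at r (suc i)) (at s (suc i)) (at (pmul p r) i) (at (pmul p s) i)
  where
  rearrange : ∀ x a b c d → x ℤ.* (a ℤ.+ b) ℤ.+ (c ℤ.+ d) ≡ x ℤ.* a ℤ.+ c ℤ.+ (x ℤ.* b ℤ.+ d)
  rearrange = solve-∀

at-pmul-scale : ∀ x p r i → at (pmul (map (x ℤ.*_) p) r) i ≡ x ℤ.* at (pmul p r) i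
at-pmul-scale x []      r i       = ≡.sym (ℤ.*-zeroʳ x)
at-pmul-scale x (y ∷ p) r zero
  rewrite at-pmul-zero (x ℤ.* y) (map (x ℤ.*_) p) r | at-pmul-zero y p r = ℤ.*-assoc x y _
at-pmul-scale x (y ∷ p) r (suc i)
  rewrite at-pmul-suc (x ℤ.* y) (map (x ℤ.*_) p) r i | at-pmul-suc y p r i | at-pmul-scale x p r i =
  rearrange x y (at r (suc i)) (at (pmul p r) i)
  where
  rearrange : ∀ x y a b → x ℤ.* y ℤ.* a ℤ.+ x ℤ.* b ≡ x ℤ.* (y ℤ.* a ℤ.+ b)
  rearrange = solve-∀

at-pmul-distribʳ : ∀ s p r i → at (pmul (padd p r) s) i ≡ at (pmul p s) i ℤ.+ at (pmul r s) i
at-pmul-distribʳ s p r i = ≡.trans (at-pmul-comm (padd p r) s i)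
  (≡.trans (at-pmul-distribˡ s p r i) (≡.cong₂ ℤ._+_ (at-pmul-comm s p i) (at-pmul-comm s r i)))

at-pmul-assoc : ∀ p r s i → at (pmul (pmul p r) s) i ≡ at (pmul p (pmul r s)) i
at-pmul-assoc []      r s i       = ≡.refl
at-pmul-assoc (x ∷ p) r s zero
  rewrite at-pmul-distribʳ s (map (x ℤ.*_) r) (0ℤ ∷ pmul p r) 0 | at-pmul-scale x r s 0
        | at-pmul-zero 0ℤ (pmul p r) s | at-pmul-zero x p (pmul r s) = ℤ.+-identityʳ _
at-pmul-assoc (x ∷ p) r s (suc i)
  rewrite at-pmul-distribʳ s (map (x ℤ.*_) r) (0ℤ ∷ pmul p r) (suc i) | at-pmul-scale x r s (suc i)
        | at-pmul-suc 0ℤ (pmul p r) s i | at-pmul-suc x p (pmul r s) i | at-pmul-assoc p r s i =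
  ≡.cong (λ a → x ℤ.* at (pmul r s) (suc i) ℤ.+ a) (ℤ.+-identityˡ _)

-- Under `≡` the lists form no ring: for nonempty p the difference p - p is a list of zeros, not
-- `[]`. This is why the modules on formal combinations take the equality of scalars as a separate
-- parameter.
≈ₚ-isCommutativeRing : IsCommutativeRing _≈ₚ_ padd pmul (map (λ z → ℤ.- z)) [] (1ℤ ∷ [])
≈ₚ-isCommutativeRing = record
  { isRing = record
    { +-isAbelianGroup = record
      { isGroup = record
        { isMonoid = record
          { isSemigroup = record
            { isMagma = record
              { isEquivalence = record
                { refl  = mk≈ λ i → ≡.refl
                ; sym   = λ (mk≈ e) → mk≈ λ i → ≡.sym (e i)
                ; trans = λ (mk≈ e) (mk≈ f) → mk≈ λ i → ≡.trans (e i) (f i)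
                }
              ; ∙-cong = λ {p} {p′} {r} {r′} (mk≈ e) (mk≈ f) → mk≈ λ i →
                  ≡.trans (at-padd p r i) (≡.trans (≡.cong₂ ℤ._+_ (e i) (f i)) (≡.sym (at-padd p′ r′ i)))
              }
            ; assoc = λ p r s → mk≈ λ i → assoc p r s i
            }
          ; identity = (λ p → mk≈ λ i → ≡.refl)
                     , (λ p → mk≈ λ i → ≡.trans (at-padd p [] i) (ℤ.+-identityʳ _))
          }
        ; inverse = (λ p → mk≈ λ i → ≡.trans (at-padd (map (λ z → ℤ.- z) p) p i)
                      (≡.trans (≡.cong (λ a → a ℤ.+ at p i) (at-neg p i)) (ℤ.+-inverseˡ (at p i))))
                  , (λ p → mk≈ λ i → ≡.trans (at-padd p (map (λ z → ℤ.- z) p) i)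
                      (≡.trans (≡.cong (λ a → at p i ℤ.+ a) (at-neg p i)) (ℤ.+-inverseʳ (at p i))))
        ; ⁻¹-cong = λ {p} {r} (mk≈ e) → mk≈ λ i →
            ≡.trans (at-neg p i) (≡.trans (≡.cong ℤ.-_ (e i)) (≡.sym (at-neg r i)))
        }
      ; comm = λ p r → mk≈ λ i →
          ≡.trans (at-padd p r i) (≡.trans (ℤ.+-comm (at p i) _) (≡.sym (at-padd r p i)))
      }
    ; *-cong = λ {p} {p′} {r} {r′} e f → mk≈ λ i →
        ≡.trans (at≡ (pmul-congʳ p f) i) (≡.trans (at-pmul-comm p r′ i)
          (≡.trans (at≡ (pmul-congʳ r′ e) i) (at-pmul-comm r′ p′ i)))
    ; *-assoc = λ p r s → mk≈ (at-pmul-assoc p r s)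
    ; *-identity = (λ p → mk≈ (identityˡ p))
                 , (λ p → mk≈ λ i → ≡.trans (at-pmul-comm p (1ℤ ∷ []) i) (identityˡ p i))
    ; distrib = (λ p r s → mk≈ λ i → ≡.trans (at-pmul-distribˡ p r s i) (≡.sym (at-padd (pmul p r) _ i)))
              , (λ p r s → mk≈ λ i → ≡.trans (at-pmul-distribʳ p r s i) (≡.sym (at-padd (pmul r p) _ i)))
    }
  ; *-comm = λ p r → mk≈ (at-pmul-comm p r)
  }
  where
  assoc : ∀ p r s i → at (padd (padd p r) s) i ≡ at (padd p (padd r s)) i
  assoc p r s i rewrite at-padd (padd p r) s i | at-padd p r i | at-padd p (padd r s) i | at-padd r s i =
    ℤ.+-assoc (at p i) _ _
  identityˡ : ∀ p i → at (pmul (1ℤ ∷ []) p) i ≡ at p i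
  identityˡ p zero    = ≡.trans (at-pmul-zero 1ℤ [] p) (ℤ.*-identityˡ _)
  identityˡ p (suc i) = ≡.trans (at-pmul-suc 1ℤ [] p i) (≡.trans (ℤ.+-identityʳ _) (ℤ.*-identityˡ _))

ℤ[q]-commutativeRing : CommutativeRing 0ℓ 0ℓ
ℤ[q]-commutativeRing = record { isCommutativeRing = ≈ₚ-isCommutativeRing }

-- Cancellation and exact division of polynomials

module DivisionIdentities {c ℓ} (R : CommutativeRing c ℓ) where
  open CommutativeRing R
  open NoncommutativeSolver ring

  asCentral : ∀ x → Σ Carrier Central
  asCentral x = x , *-comm x

  top-difference : ∀ {Q M L X Y U V} → Q * M ≈ L →
                   V - Q * U + L * (Y - X) ≈ (V + L * Y) - Q * (U + M * X)
  top-difference {Q} {M} {L} {X} {Y} {U} {V} QM≈L = trans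
    (solve (asCentral Q ∷ asCentral L ∷ asCentral X ∷ asCentral Y ∷ asCentral M ∷ []) (V ∷ U ∷ [])
      (var 0 :- con 0 :* var 1 :+ con 1 :* (con 3 :- con 2))
      ((var 0 :+ con 1 :* con 3) :- con 0 :* (var 1 :+ con 4 :* con 2)
        :+ 𝟙 :* (con 0 :* con 4 :- con 1) :* con 2) ≡.refl)
    (dropRelation _ _ QM≈L)

  division-step : ∀ {A D E L M Q S W r} → W * M ≈ L → D ≈ E + M * 1# →
                  S - W * (A * E) ≈ D * Q + r → S + L * A ≈ D * (Q + W * A) + r
  division-step {A} {D} {E} {L} {M} {Q} {S} {W} {r} WM≈L D≈E+M eq = trans
    (solve (asCentral L ∷ asCentral W ∷ asCentral M ∷ asCentral A ∷ asCentral E ∷ asCentral D ∷ asCentral Q ∷ [])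
           (S ∷ r ∷ [])
      (var 0 :+ con 0 :* con 3)
      (con 5 :* (con 6 :+ con 1 :* con 3) :+ var 1
        :+ (𝟘 :- 𝟙) :* (con 1 :* con 2 :- con 0) :* con 3
        :+ (𝟘 :- con 1 :* con 3) :* (con 5 :- (con 4 :+ con 2 :* 𝟙)) :* 𝟙
        :+ 𝟙 :* (var 0 :- con 1 :* (con 3 :* con 4) :- (con 5 :* con 6 :+ var 1)) :* 𝟙) ≡.refl)
    (trans (dropRelation _ _ eq) (trans (dropRelation _ _ D≈E+M) (dropRelation _ _ WM≈L)))

  quotient-difference : ∀ {D p r y z} → p ≈ D * z → p ≈ D * y + r → D * (z - y) ≈ r
  quotient-difference {D} {p} {r} {y} {z} p≈ p≈′ = trans
    (solve (asCentral D ∷ asCentral y ∷ asCentral z ∷ asCentral p ∷ []) (r ∷ [])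
      (con 0 :* (con 2 :- con 1))
      (var 0 :+ 𝟙 :* (con 3 :- (con 0 :* con 1 :+ var 0)) :* 𝟙 :+ (𝟘 :- 𝟙) :* (con 3 :- con 0 :* con 2) :* 𝟙) ≡.refl)
    (trans (dropRelation _ _ p≈) (dropRelation _ _ p≈′))

module _ where
  open DivisionIdentities ℤ[q]-commutativeRing
  open CommutativeRing ℤ[q]-commutativeRing hiding (zero)
  open NoncommutativeSolver ring
  open GroupProperties +-group using () renaming (x∙y⁻¹≈ε⇒x≈y to x-y≈0⇒x≈y)

  x≈y⇒x-y≈0 : ∀ {x y} → x ≈ y → x - y ≈ 0#
  x≈y⇒x-y≈0 {x} {y} x≈y = trans (+-congʳ {x = - y} x≈y) (-‿inverseʳ y)

  Cancellable : Poly → Set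
  Cancellable d = ∀ x y → d * x ≈ d * y → x ≈ y

  cancellable-if : ∀ d → (∀ z → d * z ≈ 0# → z ≈ 0#) → Cancellable d
  cancellable-if d h x y eq = x-y≈0⇒x≈y x y (h (x - y)
    (trans (solve′ x y) (x≈y⇒x-y≈0 eq)))
    where
    solve′ : ∀ x y → d * (x - y) ≈ d * x - d * y
    solve′ x y = solve [] (d ∷ x ∷ y ∷ []) (var 0 :* (var 1 :- var 2)) (var 0 :* var 1 :- var 0 :* var 2) ≡.refl

  cancellable-* : ∀ {d d′} → Cancellable d → Cancellable d′ → Cancellable (d * d′)
  cancellable-* {d} {d′} h h′ x y eq =
    h′ x y (h _ _ (trans (sym (*-assoc d d′ x)) (trans eq (*-assoc d d′ y))))

  -- As the constant term is 1, the lowest coefficient of z must vanish; then z is q times its tail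
  -- and the argument repeats.
  cancellable-1∷ : ∀ p → Cancellable (1ℤ ∷ p)
  cancellable-1∷ p = cancellable-if (1ℤ ∷ p) λ z eq → mk≈ (go z (at≡ eq))
    where
    go : ∀ z → (∀ i → at (pmul (1ℤ ∷ p) z) i ≡ 0ℤ) → ∀ i → at z i ≡ 0ℤ
    go []      eq i = ≡.refl
    go (y ∷ z) eq = λ { zero → y≡0 ; (suc i) → go z rest i }
      where
      y≡0 : y ≡ 0ℤ
      y≡0 = ≡.trans (≡.sym (ℤ.*-identityˡ y)) (≡.trans (≡.sym (at-pmul-∷-zero (1ℤ ∷ p) y z)) (eq 0))
      rest : ∀ i → at (pmul (1ℤ ∷ p) z) i ≡ 0ℤ
      rest i = ≡.trans (≡.sym (ℤ.+-identityˡ _)) (≡.trans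
        (≡.cong (λ a → a ℤ.+ at (pmul (1ℤ ∷ p) z) i)
          (≡.sym (≡.trans (≡.cong (at p i ℤ.*_) y≡0) (ℤ.*-zeroʳ (at p i)))))
        (≡.trans (≡.sym (at-pmul-∷-suc (1ℤ ∷ p) y z i)) (eq (suc i))))

  cancellable-q : Cancellable qPoly
  cancellable-q x y (mk≈ eq) = mk≈ λ i → ≡.trans (≡.sym (shift x i)) (≡.trans (eq (suc i)) (shift y i))
    where
    shift : ∀ z i → at (pmul qPoly z) (suc i) ≡ at z i
    shift z i = ≡.trans (at-pmul-suc 0ℤ (1ℤ ∷ []) z i)
      (≡.trans (ℤ.+-identityˡ (at (pmul (1ℤ ∷ []) z) i)) (at≡ (*-identityˡ z) i))

  cancellable-qfact : ∀ k → Cancellable (qfact k)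
  cancellable-qfact zero    = cancellable-1∷ []
  cancellable-qfact (suc k) = cancellable-* {qfact k} (cancellable-qfact k) (cancellable-1∷ (qint k))

  Monic : Poly → ℕ → Set
  Monic d m = at d m ≡ 1ℤ × (∀ i → m < i → at d i ≡ 0ℤ)

  at-monic-* : ∀ {d m} → Monic d m → ∀ z i → (∀ j → i < j → at z j ≡ 0ℤ) → at (pmul d z) (i ℕ.+ m) ≡ at z i
  at-monic-* {d} {m} mon [] i h = at-pmul-[] d (i ℕ.+ m)
  at-monic-* {d} {m} mon@(lead , high) (y ∷ z) (suc i) h = ≡.trans (at-pmul-∷-suc d y z (i ℕ.+ m))
    (≡.trans (≡.cong₂ ℤ._+_ (≡.cong (ℤ._* y) (high (suc i ℕ.+ m) (s≤s (ℕ.m≤n+m m i))))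
      (at-monic-* {d} {m} mon z i (λ j i<j → h (suc j) (s≤s i<j)))) (ℤ.+-identityˡ (at z i)))
  at-monic-* {d} {zero}  (lead , high) (y ∷ z) zero h = ≡.trans (at-pmul-∷-zero d y z)
    (≡.trans (≡.cong (ℤ._* y) lead) (ℤ.*-identityˡ y))
  at-monic-* {d} {suc m} (lead , high) (y ∷ z) zero h = ≡.trans (at-pmul-∷-suc d y z m)
    (≡.trans (≡.cong₂ ℤ._+_ (≡.trans (≡.cong (ℤ._* y) lead) (ℤ.*-identityˡ y))
      (≡.trans (at≡ (pmul-congʳ d {z} {[]} (mk≈ λ j → h (suc j) (s≤s z≤n))) m) (at-pmul-[] d m)))
      (ℤ.+-identityʳ y))

  at-beyond : ∀ p {i} → length p ≤ i → at p i ≡ 0ℤ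
  at-beyond []      h       = ≡.refl
  at-beyond (a ∷ p) (s≤s h) = at-beyond p h

  -- Descend from the top: once the higher coefficients of z vanish, the coefficient of d z at i + m
  -- is that of z at i, and it lies beyond the end of r. This is the uniqueness of division with
  -- remainder.
  monic-*-small : ∀ {d m} → Monic d m → ∀ z r → length r ≤ m → d * z ≈ r → z ≈ 0#
  monic-*-small {d} {m} mon z r small (mk≈ eq) = mk≈ λ i → below (length z) i (ℕ.m≤m+n _ _)
    where
    below : ∀ n i → length z ≤ n ℕ.+ i → at z i ≡ 0ℤ
    below zero    i h = at-beyond z h
    below (suc n) i h = ≡.trans (≡.sym (at-monic-* {d} {m} mon z i λ j i<j →
        below n j (ℕ.≤-trans h (ℕ.≤-trans (ℕ.≤-reflexive (≡.sym (ℕ.+-suc n i))) (ℕ.+-monoʳ-≤ n i<j)))))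
      (≡.trans (eq (i ℕ.+ m)) (at-beyond r (ℕ.≤-trans small (ℕ.m≤n+m m i))))

  qpow : ℕ → Poly
  qpow zero    = 1#
  qpow (suc k) = 0ℤ ∷ qpow k

  const : ℤ → Poly
  const a = a ∷ []

  0∷-* : ∀ p r → (0ℤ ∷ p) * r ≈ 0ℤ ∷ p * r
  0∷-* p r = mk≈ λ where
    zero    → at-pmul-zero 0ℤ p r
    (suc i) → ≡.trans (at-pmul-suc 0ℤ p r i) (ℤ.+-identityˡ _)

  0∷-cong : ∀ {p r} → p ≈ r → 0ℤ ∷ p ≈ 0ℤ ∷ r
  0∷-cong (mk≈ eq) = mk≈ λ { zero → ≡.refl ; (suc i) → eq i }

  qpow-+ : ∀ j k → qpow (j ℕ.+ k) ≈ qpow j * qpow k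
  qpow-+ zero    k = sym (*-identityˡ (qpow k))
  qpow-+ (suc j) k = trans (0∷-cong (qpow-+ j k)) (sym (0∷-* (qpow j) (qpow k)))

  ∷ʳ-≈ : ∀ p a → p ∷ʳ a ≈ p + qpow (length p) * const a
  ∷ʳ-≈ []      a = sym (*-identityˡ (const a))
  ∷ʳ-≈ (x ∷ p) a = trans (mk≈ eq) (+-congˡ {x ∷ p} (sym (0∷-* (qpow (length p)) (const a))))
    where
    eq : ∀ i → at (x ∷ (p ∷ʳ a)) i ≡ at (padd (x ∷ p) (0ℤ ∷ pmul (qpow (length p)) (const a))) i
    eq zero    = ≡.sym (ℤ.+-identityʳ x)
    eq (suc i) = at≡ (∷ʳ-≈ p a) i

  -- `divHi` has the highest coefficient first, so each of its lists stands for the polynomial of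
  -- the reversed list. The head of such a list is the leading coefficient.
  reverse-∷ : ∀ a p → reverse (a ∷ p) ≈ reverse p + qpow (length p) * const a
  reverse-∷ a p = trans (reflexive (List.unfold-reverse a p))
    (trans (∷ʳ-≈ (reverse p) a)
      (+-congˡ {reverse p} (*-congʳ {const a} (reflexive (≡.cong qpow (List.length-reverse p))))))

  map-≈ : ∀ a p → map (a ℤ.*_) p ≈ const a * p
  map-≈ a p = mk≈ λ where
    zero    → ≡.trans (at-scale a p 0) (≡.sym (at-pmul-zero a [] p))
    (suc i) → ≡.trans (at-scale a p (suc i)) (≡.sym (≡.trans (at-pmul-suc a [] p i) (ℤ.+-identityʳ _)))

  length-subFront : ∀ xs ys → length (subFront xs ys) ≡ length ys
  length-subFront []       ys       = ≡.refl
  length-subFront (x ∷ xs) []       = ≡.refl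
  length-subFront (x ∷ xs) (y ∷ ys) = ≡.cong suc (length-subFront xs ys)

  reverse-subFront : ∀ xs ys → length xs ≤ length ys →
    reverse (subFront xs ys) ≈ reverse ys - qpow (length ys ∸ length xs) * reverse xs
  reverse-subFront [] ys h = solve (asCentral (qpow (length ys)) ∷ []) (reverse ys ∷ []) (var 0) (var 0 :- con 0 :* 𝟘) ≡.refl
  reverse-subFront (x ∷ xs) (y ∷ ys) (s≤s h) =
    trans (reverse-∷ (y ℤ.- x) (subFront xs ys))
    (trans (+-cong (reverse-subFront xs ys h) (*-congʳ {const (y ℤ.- x)} (reflexive (≡.cong qpow (length-subFront xs ys)))))
    (trans (top-difference {Q} {M} {L} {X} {Y} {reverse xs} {reverse ys} QM≈L)
      (+-cong (sym (reverse-∷ y ys)) (-‿cong (*-congˡ {Q} (sym (reverse-∷ x xs)))))))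
    where
    Q = qpow (length ys ∸ length xs)
    L = qpow (length ys)
    M = qpow (length xs)
    X = const x
    Y = const y
    QM≈L : Q * M ≈ L
    QM≈L = trans (sym (qpow-+ (length ys ∸ length xs) (length xs))) (reflexive (≡.cong qpow (ℕ.m∸n+n≡m h)))

  -- The head of the quotient belongs to the power of q given by the length of its tail; the
  -- division equation relies on this degree.
  length-divHi : ∀ f es p → length p ≤ f → length (divHi f es p) ≡ length p ∸ length es
  length-divHi zero    es []         h = ≡.sym (ℕ.0∸n≡0 (length es))
  length-divHi (suc f) es []         h = ≡.sym (ℕ.0∸n≡0 (length es))
  length-divHi (suc f) es (a ∷ rest) (s≤s h) with length rest <ᵇ length es in eq
  ... | true  = ≡.sym (ℕ.m≤n⇒m∸n≡0 (ℕ.<ᵇ⇒< (length rest) (length es) (≡.subst Data.Bool.T (≡.sym eq) _)))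
  ... | false = ≡.trans (≡.cong suc (≡.trans (length-divHi f es rest′ (≡.subst (_≤ f) (≡.sym len) h))
                   (≡.cong (_∸ length es) len)))
                 (≡.sym (ℕ.+-∸-assoc 1 {length rest} {length es} (ℕ.≮⇒≥ λ lt → ≡.subst Data.Bool.T eq (ℕ.<⇒<ᵇ lt))))
    where
    rest′ = subFront (map (a ℤ.*_) es) rest
    len : length rest′ ≡ length rest
    len = length-subFront (map (a ℤ.*_) es) rest

  -- With divisor q^M + E and W = L - M, one step passes from a q^L + R to R - a q^W E, that is, it
  -- subtracts a q^W times the divisor. The remainder is what is left once the list is no longer
  -- than `es`.
  divHi-spec : ∀ f es p → length p ≤ f → ∃ λ r → length r ≤ length es ×
               reverse p ≈ reverse (1ℤ ∷ es) * reverse (divHi f es p) + r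
  divHi-spec zero    es [] h = [] , z≤n , solve [] (reverse (1ℤ ∷ es) ∷ []) 𝟘 (var 0 :* 𝟘 :+ 𝟘) ≡.refl
  divHi-spec (suc f) es [] h = [] , z≤n , solve [] (reverse (1ℤ ∷ es) ∷ []) 𝟘 (var 0 :* 𝟘 :+ 𝟘) ≡.refl
  divHi-spec (suc f) es (a ∷ rest) (s≤s h) with length rest <ᵇ length es in eq
  ... | true  = reverse (a ∷ rest)
              , ≡.subst (_≤ length es) (≡.sym (List.length-reverse (a ∷ rest)))
                  (ℕ.<ᵇ⇒< (length rest) (length es) (≡.subst Data.Bool.T (≡.sym eq) _))
              , solve [] (reverse (1ℤ ∷ es) ∷ reverse (a ∷ rest) ∷ []) (var 1) (var 0 :* 𝟘 :+ var 1) ≡.refl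
  ... | false with divHi-spec f es (subFront (map (a ℤ.*_) es) rest)
                     (≡.subst (_≤ f) (≡.sym (length-subFront (map (a ℤ.*_) es) rest)) h)
  ...   | r , small , ih = r , small ,
    trans (reverse-∷ a rest)
    (trans (division-step {A} {D} {E} {L} {M} {Q} {reverse rest} {W} {r} WM≈L (reverse-∷ 1ℤ es) R-WAE≈DQ+r)
      (+-congʳ {r} (*-congˡ {D} (sym QWA))))
    where
    es′ = map (a ℤ.*_) es
    rest′ = subFront es′ rest
    L = qpow (length rest)
    W = qpow (length rest ∸ length es)
    M = qpow (length es)
    A = const a
    E = reverse es
    D = reverse (1ℤ ∷ es)
    Q = reverse (divHi f es rest′)
    es≤rest : length es ≤ length rest
    es≤rest = ℕ.≮⇒≥ λ lt → ≡.subst Data.Bool.T eq (ℕ.<⇒<ᵇ lt)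
    WM≈L : W * M ≈ L
    WM≈L = trans (sym (qpow-+ (length rest ∸ length es) (length es))) (reflexive (≡.cong qpow (ℕ.m∸n+n≡m es≤rest)))
    QWA : reverse (a ∷ divHi f es rest′) ≈ Q + W * A
    QWA = trans (reverse-∷ a (divHi f es rest′)) (+-congˡ {Q} (*-congʳ {A} (reflexive (≡.cong qpow
      (≡.trans (length-divHi f es rest′ (≡.subst (_≤ f) (≡.sym (length-subFront es′ rest)) h))
        (≡.cong (_∸ length es) (length-subFront es′ rest)))))))
    R-WAE≈DQ+r : reverse rest - W * (A * E) ≈ D * Q + r
    R-WAE≈DQ+r = trans (+-congˡ {reverse rest} (-‿cong (*-cong
        (reflexive (≡.cong (λ l → qpow (length rest ∸ l)) (≡.sym (List.length-map (a ℤ.*_) es))))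
        (trans (sym (map-≈ a E)) (reflexive (List.reverse-map (a ℤ.*_) es))))))
      (trans (sym (reverse-subFront es′ rest
        (≡.subst (_≤ length rest) (≡.sym (List.length-map (a ℤ.*_) es)) es≤rest))) ih)

  -- Monic in the literal sense, without trailing zeros: `pquot` takes the last entry of the divisor
  -- for its leading coefficient, so this property must hold of the list and not merely up to `≈ₚ`.
  record LastOne (d : Poly) : Set where
    constructor lastOne
    field
      init : Poly
      d≡   : d ≡ init ∷ʳ 1ℤ

  at-∷ʳ : ∀ p a → at (p ∷ʳ a) (length p) ≡ a
  at-∷ʳ []      a = ≡.refl
  at-∷ʳ (x ∷ p) a = at-∷ʳ p a

  -- Comparing p = d z with the division equation leaves d (z - quot) equal to a remainder shorter
  -- than d, which forces the difference to vanish.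
  pquot-≈ : ∀ {d p z} → LastOne d → p ≈ d * z → pquot p d ≈ z
  pquot-≈ {d} {p} {z} (lastOne ds ≡.refl) eq with divHi-spec (length p) (reverse ds) (reverse p)
    (ℕ.≤-reflexive (List.length-reverse p))
  ... | r , small , spec = x-y≈0⇒x≈y quot z (sym-0 (monic-*-small {D} {length ds} mon (z - quot) r small′
    (quotient-difference {D} {p} {r} {quot} {z} eq p≈)))
    where
    D = ds ∷ʳ 1ℤ
    drop-reverse : drop 1 (reverse (ds ∷ʳ 1ℤ)) ≡ reverse ds
    drop-reverse = ≡.cong (drop 1) (List.reverse-++ ds (1ℤ ∷ []))
    quot = pquot p D
    small′ : length r ≤ length ds
    small′ = ≡.subst (length r ≤_) (List.length-reverse ds) small
    rev-D : reverse (1ℤ ∷ reverse ds) ≡ D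
    rev-D = ≡.trans (List.unfold-reverse 1ℤ (reverse ds)) (≡.cong (_∷ʳ 1ℤ) (List.reverse-involutive ds))
    p≈ : p ≈ D * quot + r
    p≈ = trans (reflexive (≡.sym (List.reverse-involutive p)))
      (trans spec (+-congʳ {r} (*-cong (reflexive rev-D)
        (reflexive (≡.cong (λ es → reverse (divHi (length p) es (reverse p))) (≡.sym drop-reverse))))))
    mon : Monic D (length ds)
    mon = at-∷ʳ ds 1ℤ , λ i lt → at-beyond D
      (ℕ.≤-trans (ℕ.≤-reflexive (≡.trans (List.length-++ ds) (ℕ.+-comm (length ds) 1))) lt)
    sym-0 : z - quot ≈ 0# → quot - z ≈ 0#
    sym-0 e = x≈y⇒x-y≈0 (sym (x-y≈0⇒x≈y z quot e))

padd-∷ʳ : ∀ p r a → length p ≤ length r → padd p (r ∷ʳ a) ≡ padd p r ∷ʳ a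
padd-∷ʳ []      r       a h       = ≡.refl
padd-∷ʳ (x ∷ p) (y ∷ r) a (s≤s h) = ≡.cong (_ ∷_) (padd-∷ʳ p r a h)

length≤padd : ∀ p r → length p ≤ length (padd p r)
length≤padd []      r       = z≤n
length≤padd (x ∷ p) []      = ℕ.≤-refl
length≤padd (x ∷ p) (y ∷ r) = s≤s (length≤padd p r)

length≤pmul : ∀ x p r → length r ≤ length (pmul (x ∷ p) r)
length≤pmul x p r = ≡.subst (ℕ._≤ length (pmul (x ∷ p) r)) (List.length-map (x ℤ.*_) r)
  (length≤padd (map (x ℤ.*_) r) (0ℤ ∷ pmul p r))

lastOne-1∷* : ∀ y ys → pmul (1ℤ ∷ []) (y ∷ ys) ≡ y ∷ ys
lastOne-1∷* y ys = ≡.cong₂ _∷_ (≡.trans (ℤ.+-identityʳ _) (ℤ.*-identityˡ y))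
  (≡.trans (padd-[] (map (1ℤ ℤ.*_) ys)) (≡.trans (List.map-cong ℤ.*-identityˡ ys) (List.map-id ys)))
  where
  padd-[] : ∀ p → padd p [] ≡ p
  padd-[] []      = ≡.refl
  padd-[] (x ∷ p) = ≡.refl

-- In the sum that defines `pmul` the shifted summand is strictly longer than the other one, so its
-- last entry survives `padd`, and by induction this entry is 1.
lastOne-* : ∀ ps {r} → LastOne r → LastOne (pmul (ps ∷ʳ 1ℤ) r)
lastOne-* [] (lastOne [] ≡.refl) = lastOne [] ≡.refl
lastOne-* [] (lastOne (x ∷ rs) ≡.refl) = lastOne (x ∷ rs) (lastOne-1∷* x (rs ∷ʳ 1ℤ))
lastOne-* (x ∷ []) {r} h with lastOne-* [] h | length≤pmul 1ℤ [] r
... | lastOne init eq | len rewrite eq = lastOne _ (padd-∷ʳ (map (x ℤ.*_) r) (0ℤ ∷ init) 1ℤ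
  (≡.subst₂ ℕ._≤_ (≡.sym (List.length-map (x ℤ.*_) r))
    (≡.trans (List.length-++ init) (ℕ.+-comm (length init) 1)) len))
lastOne-* (x ∷ y ∷ ps) {r} h with lastOne-* (y ∷ ps) h | length≤pmul y (ps ∷ʳ 1ℤ) r
... | lastOne init eq | len rewrite eq = lastOne _ (padd-∷ʳ (map (x ℤ.*_) r) (0ℤ ∷ init) 1ℤ
  (≡.subst₂ ℕ._≤_ (≡.sym (List.length-map (x ℤ.*_) r))
    (≡.trans (List.length-++ init) (ℕ.+-comm (length init) 1)) len))

lastOne-qint : ∀ k → LastOne (qint (suc k))
lastOne-qint zero    = lastOne [] ≡.refl
lastOne-qint (suc k) with lastOne-qint k
... | lastOne init eq = lastOne (1ℤ ∷ init) (≡.cong (1ℤ ∷_) eq)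

lastOne-qfact : ∀ k → LastOne (qfact k)
lastOne-qfact zero    = lastOne [] ≡.refl
lastOne-qfact (suc k) with qfact k | lastOne-qfact k
... | _ | lastOne init ≡.refl = lastOne-* init (lastOne-qint k)

-- Evaluation of integer polynomials in the field

module Evaluation {c ℓ} (F : Field c ℓ) (q₀ : Field.Carrier F) where
  open Field F hiding (zero)
  open RingProperties ring
  open SetoidReasoning setoid
  open MonoidMult +-monoid using (×-homo-+) renaming (_×_ to _·_)
  open SemiringMult semiring using (×1-homo-*)

  ι : ℤ → Carrier
  ι = ιℤ F

  ιℕ-· : ∀ m → ιℕ F m ≈ m · 1#
  ιℕ-· zero    = refl
  ιℕ-· (suc m) = +-congˡ (ιℕ-· m)

  ιℕ-+ : ∀ m n → ιℕ F (m ℕ.+ n) ≈ ιℕ F m + ιℕ F n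
  ιℕ-+ m n = trans (ιℕ-· (m ℕ.+ n)) (trans (×-homo-+ 1# m n) (+-cong (sym (ιℕ-· m)) (sym (ιℕ-· n))))

  ιℕ-* : ∀ m n → ιℕ F (m ℕ.* n) ≈ ιℕ F m * ιℕ F n
  ιℕ-* m n = trans (ιℕ-· (m ℕ.* n)) (trans (×1-homo-* m n) (*-cong (sym (ιℕ-· m)) (sym (ιℕ-· n))))

  ι-neg : ∀ a → ι (ℤ.- a) ≈ - ι a
  ι-neg (+ zero)  = sym -0#≈0#
  ι-neg (+ suc n) = refl
  ι-neg -[1+ n ]  = sym (-‿involutive _)

  ι-⊖ : ∀ m n → ι (m ℤ.⊖ n) ≈ ιℕ F m - ιℕ F n
  ι-⊖ zero    zero    = sym (-‿inverseʳ _)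
  ι-⊖ zero    (suc n) = sym (+-identityˡ _)
  ι-⊖ (suc m) zero    = sym (trans (+-congˡ -0#≈0#) (+-identityʳ _))
  ι-⊖ (suc m) (suc n) = begin
    ι (suc m ℤ.⊖ suc n)              ≡⟨ ≡.cong ι (ℤ.[1+m]⊖[1+n]≡m⊖n m n) ⟩
    ι (m ℤ.⊖ n)                      ≈⟨ ι-⊖ m n ⟩
    x - y                            ≈⟨ +-congˡ (+-identityˡ (- y)) ⟨
    x + (0# - y)                     ≈⟨ +-congˡ (+-congʳ (-‿inverseʳ 1#)) ⟨
    x + (1# - 1# - y)                ≈⟨ +-congˡ (+-assoc _ _ _) ⟩
    x + (1# + (- 1# - y))            ≈⟨ +-assoc _ _ _ ⟨
    x + 1# + (- 1# - y)              ≈⟨ +-cong (+-comm x 1#) (-‿+-comm 1# y) ⟩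
    1# + x - (1# + y)                ∎
    where
    x = ιℕ F m
    y = ιℕ F n

  ι-+ : ∀ a b → ι (a ℤ.+ b) ≈ ι a + ι b
  ι-+ (+ m)    (+ n)    = ιℕ-+ m n
  ι-+ (+ m)    -[1+ n ] = ι-⊖ m (suc n)
  ι-+ -[1+ m ] (+ n)    = trans (ι-⊖ n (suc m)) (+-comm _ _)
  ι-+ -[1+ m ] -[1+ n ] = begin
    - ιℕ F (suc (suc (m ℕ.+ n)))     ≡⟨ ≡.cong (λ k → - ιℕ F (suc k)) (ℕ.+-suc m n) ⟨
    - ιℕ F (suc m ℕ.+ suc n)         ≈⟨ -‿cong (ιℕ-+ (suc m) (suc n)) ⟩
    - (ιℕ F (suc m) + ιℕ F (suc n))  ≈⟨ -‿+-comm _ _ ⟨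
    - ιℕ F (suc m) - ιℕ F (suc n)    ∎

  ι-+* : ∀ m b → ι (+ m ℤ.* b) ≈ ιℕ F m * ι b
  ι-+* m (+ n)    = trans (reflexive (≡.cong ι (≡.sym (ℤ.pos-* m n)))) (ιℕ-* m n)
  ι-+* m -[1+ n ] = begin
    ι (+ m ℤ.* (ℤ.- + suc n))  ≡⟨ ≡.cong ι (ℤ.neg-distribʳ-* (+ m) (+ suc n)) ⟨
    ι (ℤ.- (+ m ℤ.* + suc n))  ≈⟨ ι-neg (+ m ℤ.* + suc n) ⟩
    - ι (+ m ℤ.* + suc n)      ≈⟨ -‿cong (ι-+* m (+ suc n)) ⟩
    - (ιℕ F m * ιℕ F (suc n))  ≈⟨ -‿distribʳ-* _ _ ⟩
    ιℕ F m * - ιℕ F (suc n)    ∎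

  ι-* : ∀ a b → ι (a ℤ.* b) ≈ ι a * ι b
  ι-* (+ m)    b = ι-+* m b
  ι-* -[1+ m ] b = begin
    ι ((ℤ.- + suc m) ℤ.* b)  ≡⟨ ≡.cong ι (ℤ.neg-distribˡ-* (+ suc m) b) ⟨
    ι (ℤ.- (+ suc m ℤ.* b))  ≈⟨ ι-neg (+ suc m ℤ.* b) ⟩
    - ι (+ suc m ℤ.* b)      ≈⟨ -‿cong (ι-+* (suc m) b) ⟩
    - (ιℕ F (suc m) * ι b)   ≈⟨ -‿distribˡ-* _ _ ⟩
    - ιℕ F (suc m) * ι b     ∎

  eval : Poly → Carrier
  eval = evalAt F q₀

  eval-zero : ∀ p → (∀ i → at p i ≡ 0ℤ) → eval p ≈ 0#
  eval-zero []      h = refl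
  eval-zero (a ∷ p) h = trans (+-cong (reflexive (≡.cong ι (h 0)))
      (trans (*-congˡ (eval-zero p (λ i → h (suc i)))) (zeroʳ q₀)))
    (+-identityˡ 0#)

  eval-cong : ∀ {p r} → p ≈ₚ r → eval p ≈ eval r
  eval-cong {[]}    {r}     (mk≈ h) = sym (eval-zero r (λ i → ≡.sym (h i)))
  eval-cong {a ∷ p} {[]}    (mk≈ h) = eval-zero (a ∷ p) h
  eval-cong {a ∷ p} {b ∷ r} (mk≈ h) = +-cong (reflexive (≡.cong ι (h 0)))
    (*-congˡ (eval-cong {p} {r} (mk≈ λ i → h (suc i))))

  eval-+ : ∀ p r → eval (padd p r) ≈ eval p + eval r
  eval-+ []      r       = sym (+-identityˡ _)
  eval-+ (a ∷ p) []      = sym (+-identityʳ _)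
  eval-+ (a ∷ p) (b ∷ r) = begin
    ι (a ℤ.+ b) + q₀ * eval (padd p r)                ≈⟨ +-cong (ι-+ a b) (*-congˡ (eval-+ p r)) ⟩
    ι a + ι b + q₀ * (eval p + eval r)                ≈⟨ +-congˡ (distribˡ q₀ _ _) ⟩
    ι a + ι b + (q₀ * eval p + q₀ * eval r)           ≈⟨ interchange _ _ _ _ ⟩
    ι a + q₀ * eval p + (ι b + q₀ * eval r)           ∎
    where open CommutativeSemigroupProperties +-commutativeSemigroup using (interchange)

  eval-neg : ∀ p → eval (map (λ z → ℤ.- z) p) ≈ - eval p
  eval-neg []      = sym -0#≈0#
  eval-neg (a ∷ p) = begin
    ι (ℤ.- a) + q₀ * eval (map (λ z → ℤ.- z) p)  ≈⟨ +-cong (ι-neg a) (*-congˡ (eval-neg p)) ⟩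
    - ι a + q₀ * - eval p                        ≈⟨ +-congˡ (-‿distribʳ-* q₀ (eval p)) ⟨
    - ι a - q₀ * eval p                          ≈⟨ -‿+-comm _ _ ⟩
    - (ι a + q₀ * eval p)                        ∎

  eval-scale : ∀ x p → eval (map (x ℤ.*_) p) ≈ ι x * eval p
  eval-scale x []      = sym (zeroʳ _)
  eval-scale x (a ∷ p) = begin
    ι (x ℤ.* a) + q₀ * eval (map (x ℤ.*_) p)  ≈⟨ +-cong (ι-* x a) (*-congˡ (eval-scale x p)) ⟩
    ι x * ι a + q₀ * (ι x * eval p)           ≈⟨ +-congˡ (x∙yz≈y∙xz q₀ (ι x) (eval p)) ⟩
    ι x * ι a + ι x * (q₀ * eval p)           ≈⟨ distribˡ _ _ _ ⟨
    ι x * (ι a + q₀ * eval p)                 ∎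
    where open CommutativeSemigroupProperties *-commutativeSemigroup using (x∙yz≈y∙xz)

  eval-* : ∀ p r → eval (pmul p r) ≈ eval p * eval r
  eval-* []      r = sym (zeroˡ _)
  eval-* (x ∷ p) r = begin
    eval (padd (map (x ℤ.*_) r) (0ℤ ∷ pmul p r))          ≈⟨ eval-+ (map (x ℤ.*_) r) _ ⟩
    eval (map (x ℤ.*_) r) + (0# + q₀ * eval (pmul p r))   ≈⟨ +-cong (eval-scale x r) (+-identityˡ _) ⟩
    ι x * eval r + q₀ * eval (pmul p r)                   ≈⟨ +-congˡ (*-congˡ (eval-* p r)) ⟩
    ι x * eval r + q₀ * (eval p * eval r)                 ≈⟨ +-congˡ (*-assoc _ _ _) ⟨
    ι x * eval r + q₀ * eval p * eval r                   ≈⟨ distribʳ _ _ _ ⟨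
    (ι x + q₀ * eval p) * eval r                          ∎

  eval-1 : eval (1ℤ ∷ []) ≈ 1#
  eval-1 = trans (+-cong (+-identityʳ 1#) (zeroʳ q₀)) (+-identityʳ 1#)

  eval-q : eval qPoly ≈ q₀
  eval-q = trans (+-identityˡ _) (trans (*-congˡ eval-1) (*-identityʳ q₀))

-- Reduced words

module Permutations where
  open import Relation.Binary.PropositionalEquality using (refl; sym; trans; cong; cong₂; subst)
  open import Data.Bool using (T)
  open import Data.Nat using (_+_; _*_)

  <ᵇ-true : ∀ {a b} → a < b → (a <ᵇ b) ≡ true
  <ᵇ-true {a} {b} a<b with a <ᵇ b | ℕ.<⇒<ᵇ a<b
  ... | true | _ = refl

  <ᵇ-false : ∀ {a b} → b ≤ a → (a <ᵇ b) ≡ false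
  <ᵇ-false {a} {b} b≤a with a <ᵇ b in eq
  ... | true  = contradiction (ℕ.≤-trans (ℕ.<ᵇ⇒< a b (subst T (sym eq) _)) b≤a) ℕ.1+n≰n
  ... | false = refl

  <ᵇ-true⁻¹ : ∀ {a b} → (a <ᵇ b) ≡ true → a < b
  <ᵇ-true⁻¹ {a} {b} eq = ℕ.<ᵇ⇒< a b (subst T (sym eq) _)

  <ᵇ-false⁻¹ : ∀ {a b} → (a <ᵇ b) ≡ false → b ≤ a
  <ᵇ-false⁻¹ {a} {b} eq = ℕ.≮⇒≥ λ a<b → subst T eq (ℕ.<⇒<ᵇ a<b)

  <ᵇ-flip : ∀ {a b} → a ≢ b → (b <ᵇ a) ≡ not (a <ᵇ b)
  <ᵇ-flip {a} {b} a≢b with a <ᵇ b in eq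
  ... | true  = <ᵇ-false (ℕ.<⇒≤ (ℕ.<ᵇ⇒< a b (subst T (sym eq) _)))
  ... | false = <ᵇ-true (ℕ.≤∧≢⇒< (<ᵇ-false⁻¹ eq) (λ b≡a → a≢b (sym b≡a)))

  length-swapPos : ∀ p w → length (swapPos p w) ≡ length w
  length-swapPos zero    []          = refl
  length-swapPos zero    (a ∷ [])    = refl
  length-swapPos zero    (a ∷ b ∷ w) = refl
  length-swapPos (suc p) []          = refl
  length-swapPos (suc p) (a ∷ w)     = cong suc (length-swapPos p w)

  swapPos-involutive : ∀ p w → swapPos p (swapPos p w) ≡ w
  swapPos-involutive zero    []          = refl
  swapPos-involutive zero    (a ∷ [])    = refl
  swapPos-involutive zero    (a ∷ b ∷ w) = refl
  swapPos-involutive (suc p) []          = refl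
  swapPos-involutive (suc p) (a ∷ w)     = cong (a ∷_) (swapPos-involutive p w)

  all-swapPos : ∀ {P : ℕ → Set} p {w} → All P w → All P (swapPos p w)
  all-swapPos zero    []            = []
  all-swapPos zero    (x ∷ [])      = x ∷ []
  all-swapPos zero    (x ∷ y ∷ h)   = y ∷ x ∷ h
  all-swapPos (suc p) []            = []
  all-swapPos (suc p) (x ∷ h)       = x ∷ all-swapPos p h

  unique-swapPos : ∀ p {w} → Unique w → Unique (swapPos p w)
  unique-swapPos zero    []                              = []
  unique-swapPos zero    (x ∷ [])                        = x ∷ []
  unique-swapPos zero    ((a≢b ∷ a∉) ∷ b∉ ∷ u)          = ((λ b≡a → a≢b (sym b≡a)) ∷ b∉) ∷ a∉ ∷ u
  unique-swapPos (suc p) []                              = []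
  unique-swapPos (suc p) (x ∷ u)                         = all-swapPos p x ∷ unique-swapPos p u

  -- Ascents, swaps and inversions only compare entries, so any n distinct entries may stand for a
  -- permutation; this condition is preserved by every swap and is decidable.
  Valid : ℕ → Perm → Set
  Valid n w = length w ≡ n × Unique w

  valid-swapPos : ∀ {n} p {w} → Valid n w → Valid n (swapPos p w)
  valid-swapPos p {w} (len , u) = trans (length-swapPos p w) len , unique-swapPos p u

  valid-idPerm : ∀ n → Valid n (idPerm n)
  valid-idPerm n = List.length-upTo n , Unique.upTo⁺ n

  ascentPos-swapPos : ∀ p {w} → Unique w → suc p < length w → ascentPos p (swapPos p w) ≡ not (ascentPos p w)
  ascentPos-swapPos zero    {a ∷ b ∷ w} ((a≢b ∷ _) ∷ _) h       = <ᵇ-flip a≢b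
  ascentPos-swapPos zero    {a ∷ []}    u               (s≤s ())
  ascentPos-swapPos (suc p) {a ∷ w}     (_ ∷ u)         (s≤s h) = ascentPos-swapPos p u h

  descent⇒< : ∀ p w → ascentPos p w ≡ false → suc p < length w
  descent⇒< zero    (a ∷ b ∷ w) h = s≤s (s≤s z≤n)
  descent⇒< (suc p) (a ∷ w)     h = s≤s (descent⇒< p w h)

  smaller : ℕ → Perm → ℕ
  smaller a []      = 0
  smaller a (b ∷ w) = (if b <ᵇ a then 1 else 0) + smaller a w

  inversions : Perm → ℕ
  inversions []      = 0
  inversions (a ∷ w) = smaller a w + inversions w

  private
    +-swap : ∀ x y z → x + (y + z) ≡ y + (x + z)
    +-swap x y z = trans (sym (ℕ.+-assoc x y z)) (trans (cong (λ m → m + z) (ℕ.+-comm x y)) (ℕ.+-assoc y x z))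

  smaller-swapPos : ∀ a p w → smaller a (swapPos p w) ≡ smaller a w
  smaller-swapPos a zero    []          = refl
  smaller-swapPos a zero    (b ∷ [])    = refl
  smaller-swapPos a zero    (b ∷ c ∷ w) = +-swap (if c <ᵇ a then 1 else 0) (if b <ᵇ a then 1 else 0) (smaller a w)
  smaller-swapPos a (suc p) []          = refl
  smaller-swapPos a (suc p) (b ∷ w)     = cong (λ m → (if b <ᵇ a then 1 else 0) + m) (smaller-swapPos a p w)

  inversions-descent : ∀ p {w} → Unique w → ascentPos p w ≡ false →
                       inversions w ≡ suc (inversions (swapPos p w))
  inversions-descent zero {a ∷ b ∷ w} ((a≢b ∷ _) ∷ _) h
    rewrite h | trans (<ᵇ-flip a≢b) (cong not h) = cong suc (+-swap (smaller a w) (smaller b w) (inversions w))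
  inversions-descent (suc p) {a ∷ w} (_ ∷ u) h
    rewrite inversions-descent p u h | smaller-swapPos a p w = ℕ.+-suc (smaller a w) _

  inversions-decrease : ∀ p {w} → Unique w → ascentPos p w ≡ false → inversions (swapPos p w) < inversions w
  inversions-decrease p u d = ℕ.≤-reflexive (sym (inversions-descent p u d))

  smaller≤length : ∀ a w → smaller a w ≤ length w
  smaller≤length a []      = z≤n
  smaller≤length a (b ∷ w) with b <ᵇ a
  ... | true  = s≤s (smaller≤length a w)
  ... | false = ℕ.m≤n⇒m≤1+n (smaller≤length a w)

  inversions≤length² : ∀ w → inversions w ≤ length w * length w
  inversions≤length² []      = z≤n
  inversions≤length² (a ∷ w) = ℕ.m≤n⇒m≤1+n (ℕ.+-mono-≤ (smaller≤length a w)
    (ℕ.≤-trans (inversions≤length² w) (ℕ.*-monoʳ-≤ (length w) (ℕ.n≤1+n (length w)))))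

  firstDescent′ : Perm → Maybe ℕ
  firstDescent′ []          = nothing
  firstDescent′ (a ∷ [])    = nothing
  firstDescent′ (a ∷ b ∷ w) = if a <ᵇ b then Maybe.map suc (firstDescent′ (b ∷ w)) else just 1

  -- firstDescent is defined through a local function that cannot be named here.
  -- The metavariable below is solved (by the clause for true) to that function
  -- followed by Maybe.map suc.
  mutual
    go⁺ : ℕ → List ℕ → ℕ → List ℕ → Maybe ℕ
    go⁺ = _

    firstDescent-go⁺ : ∀ a b v → firstDescent (a ∷ b ∷ v) ≡ (if a <ᵇ b then go⁺ a (b ∷ v) b v else just 1)
    firstDescent-go⁺ a b v with a <ᵇ b | b ∷ v
    ... | true  | x = refl
    ... | false | x = refl

  go⁺-firstDescent′ : ∀ a w b v → go⁺ a w b v ≡ Maybe.map suc (firstDescent′ (b ∷ v))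
  go⁺-firstDescent′ a w b []      = refl
  go⁺-firstDescent′ a w b (c ∷ v) with b <ᵇ c
  ... | true  = cong (Maybe.map suc) (go⁺-firstDescent′ a w c v)
  ... | false = refl

  firstDescent≡ : ∀ w → firstDescent w ≡ firstDescent′ w
  firstDescent≡ []          = refl
  firstDescent≡ (a ∷ [])    = refl
  firstDescent≡ (a ∷ b ∷ w) with a <ᵇ b | go⁺-firstDescent′ a (b ∷ w) b w | firstDescent-go⁺ a b w
  ... | true  | e | p = trans p e
  ... | false | e | p = p

  firstDescent′-just : ∀ w {j} → firstDescent′ w ≡ just j → ∃ λ i → j ≡ suc i × ascentPos i w ≡ false
  firstDescent′-just (a ∷ b ∷ w) eq with a <ᵇ b in a<b | firstDescent′ (b ∷ w) in eq′
  firstDescent′-just (a ∷ b ∷ w) refl | true  | just j with firstDescent′-just (b ∷ w) eq′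
  ... | i , refl , h = suc i , refl , h
  firstDescent′-just (a ∷ b ∷ w) refl | false | _ = 0 , refl , a<b

  -- The bound i ≤ p leaves three cases for `basis-descent`: equal, adjacent and distant descents.
  firstDescent′-exists : ∀ p w → ascentPos p w ≡ false →
                         ∃ λ i → firstDescent′ w ≡ just (suc i) × i ≤ p × ascentPos i w ≡ false
  firstDescent′-exists p (a ∷ b ∷ w) h with a <ᵇ b in a<b
  firstDescent′-exists p       (a ∷ b ∷ w) h | false = 0 , refl , z≤n , a<b
  firstDescent′-exists zero    (a ∷ b ∷ w) h | true  = contradiction (trans (sym h) a<b) λ ()
  firstDescent′-exists (suc p) (a ∷ b ∷ w) h | true with firstDescent′-exists p (b ∷ w) h
  ... | i , eq , i≤p , d = suc i , cong (Maybe.map suc) eq , s≤s i≤p , d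
  firstDescent′-exists zero          []       ()
  firstDescent′-exists (suc p)       []       ()
  firstDescent′-exists (suc zero)    (a ∷ []) ()
  firstDescent′-exists (suc (suc p)) (a ∷ []) ()

  -- Each call of `redWord′` removes one inversion. The fuel of `redWord` depends only on the
  -- length, hence does not drop from w to w s_i, and the recursion `redWord-step` rests on this
  -- independence of the fuel.
  redWord′-fuel : ∀ f f′ {w} → Unique w → inversions w ≤ f → inversions w ≤ f′ → redWord′ f w ≡ redWord′ f′ w
  redWord′-fuel zero     zero     u h h′ = refl
  redWord′-fuel zero     (suc f′) {w} u h h′ with firstDescent w | firstDescent≡ w
  ... | nothing | _  = refl
  ... | just j  | eq with firstDescent′-just w (sym eq)
  ...   | i , refl , d = contradiction (subst (_≤ 0) (inversions-descent i u d) h) λ ()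
  redWord′-fuel (suc f) zero {w} u h h′ = sym (redWord′-fuel zero (suc f) {w} u h′ h)
  redWord′-fuel (suc f) (suc f′) {w} u h h′ with firstDescent w | firstDescent≡ w
  ... | nothing | _  = refl
  ... | just j  | eq with firstDescent′-just w (sym eq)
  ...   | i , refl , d = cong (_++ suc i ∷ []) (redWord′-fuel f f′ (unique-swapPos i u)
            (ℕ.≤-pred (subst (_≤ suc f) (inversions-descent i u d) h))
            (ℕ.≤-pred (subst (_≤ suc f′) (inversions-descent i u d) h′)))

  redWord-step : ∀ {w i} → Unique w → firstDescent′ w ≡ just (suc i) → ascentPos i w ≡ false →
                 redWord w ≡ redWord (swapPos i w) ++ suc i ∷ []
  redWord-step {w} {i} u eq d = trans
    (redWord′-fuel (length w * length w) (suc (inversions w′)) u (inversions≤length² w)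
      (ℕ.≤-reflexive (inversions-descent i u d)))
    (trans unfold (cong (_++ suc i ∷ [])
      (redWord′-fuel (inversions w′) (length w′ * length w′) (unique-swapPos i u) ℕ.≤-refl (inversions≤length² w′))))
    where
    w′ = swapPos i w
    unfold : redWord′ (suc (inversions w′)) w ≡ redWord′ (inversions w′) w′ ++ suc i ∷ []
    unfold with firstDescent w | trans (firstDescent≡ w) eq
    ... | just _ | refl = refl

  redWord-nothing : ∀ {w} → firstDescent′ w ≡ nothing → redWord w ≡ []
  redWord-nothing {w} eq = go (length w * length w)
    where
    go : ∀ f → redWord′ f w ≡ []
    go zero    = refl
    go (suc f) with firstDescent w | trans (firstDescent≡ w) eq
    ... | nothing | refl = refl

  redWord-idPerm : ∀ n → redWord (idPerm n) ≡ []
  redWord-idPerm n = redWord-nothing {idPerm n} (increasing (λ i → i) (λ i → ℕ.≤-refl) n)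
    where
    increasing : ∀ f → (∀ i → f i < f (suc i)) → ∀ n → firstDescent′ (applyUpTo f n) ≡ nothing
    increasing f h zero          = refl
    increasing f h (suc zero)    = refl
    increasing f h (suc (suc n)) = trans
      (cong (λ b → if b then Maybe.map suc (firstDescent′ (applyUpTo (λ i → f (suc i)) (suc n))) else just 1) (<ᵇ-true (h 0)))
      (cong (Maybe.map suc) (increasing (λ i → f (suc i)) (λ i → h (suc i)) (suc n)))

  InRange : ℕ → List ℕ → Set
  InRange n = All (λ j → 0 < j × j < n)

  redWord-inRange : ∀ {n} w → length w ≡ n → InRange n (redWord w)
  redWord-inRange {n} w len = go (length w * length w) w len
    where
    go : ∀ f w → length w ≡ n → InRange n (redWord′ f w)
    go zero    w len = []
    go (suc f) w len with firstDescent w | firstDescent≡ w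
    ... | nothing | _  = []
    ... | just j  | eq with firstDescent′-just w (sym eq)
    ...   | i , refl , d = All.++⁺ (go f (swapPos i w) (trans (length-swapPos i w) len))
              ((s≤s z≤n , subst (suc i <_) len (descent⇒< i w d)) ∷ [])

  swapPos-far : ∀ i j w → suc i < j → swapPos i (swapPos j w) ≡ swapPos j (swapPos i w)
  swapPos-far zero    (suc (suc j)) []          h       = refl
  swapPos-far zero    (suc (suc j)) (a ∷ [])    h       = refl
  swapPos-far zero    (suc (suc j)) (a ∷ b ∷ w) h       = refl
  swapPos-far zero    (suc zero)    w           (s≤s ())
  swapPos-far (suc i) (suc j)       []          h       = refl
  swapPos-far (suc i) (suc j)       (a ∷ w)     (s≤s h) = cong (a ∷_) (swapPos-far i j w h)

  ascentPos-farʳ : ∀ i j w → suc i < j → ascentPos j (swapPos i w) ≡ ascentPos j w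
  ascentPos-farʳ zero    (suc (suc j)) []          h       = refl
  ascentPos-farʳ zero    (suc (suc j)) (a ∷ [])    h       = refl
  ascentPos-farʳ zero    (suc (suc j)) (a ∷ b ∷ w) h       = refl
  ascentPos-farʳ zero    (suc zero)    w           (s≤s ())
  ascentPos-farʳ (suc i) (suc j)       []          h       = refl
  ascentPos-farʳ (suc i) (suc j)       (a ∷ w)     (s≤s h) = ascentPos-farʳ i j w h

  ascentPos-farˡ : ∀ i j w → suc i < j → ascentPos i (swapPos j w) ≡ ascentPos i w
  ascentPos-farˡ zero    (suc (suc j)) []          h       = refl
  ascentPos-farˡ zero    (suc (suc j)) (a ∷ [])    h       = refl
  ascentPos-farˡ zero    (suc (suc j)) (a ∷ b ∷ w) h       = refl
  ascentPos-farˡ zero    (suc zero)    w           (s≤s ())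
  ascentPos-farˡ (suc i) (suc j)       []          h       = refl
  ascentPos-farˡ (suc i) (suc j)       (a ∷ w)     (s≤s h) = ascentPos-farˡ i j w h

  -- Three decreasing entries in consecutive positions: both paths of the hexagon, from w down to
  -- the minimal element of its coset under two adjacent transpositions, consist of descents and end
  -- at the same permutation.
  record DoubleDescent (r : ℕ) (w : Perm) : Set where
    field
      descent-1   : ascentPos (suc r) (swapPos r w) ≡ false
      descent-2   : ascentPos r (swapPos (suc r) w) ≡ false
      descent-21  : ascentPos r (swapPos (suc r) (swapPos r w)) ≡ false
      descent-12  : ascentPos (suc r) (swapPos r (swapPos (suc r) w)) ≡ false
      swapPos-braid : swapPos r (swapPos (suc r) (swapPos r w)) ≡ swapPos (suc r) (swapPos r (swapPos (suc r) w))

  doubleDescent : ∀ r w → ascentPos r w ≡ false → ascentPos (suc r) w ≡ false → DoubleDescent r w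
  doubleDescent zero (c ∷ b ∷ a ∷ w) c≥b b≥a = record
    { descent-1     = c≥a
    ; descent-2     = c≥a
    ; descent-21    = b≥a
    ; descent-12    = c≥b
    ; swapPos-braid = refl
    }
    where
    c≥a : (c <ᵇ a) ≡ false
    c≥a = <ᵇ-false (ℕ.≤-trans (<ᵇ-false⁻¹ {b} {a} b≥a) (<ᵇ-false⁻¹ {c} {b} c≥b))
  doubleDescent (suc r) (a ∷ w) h h′ = record
    { descent-1     = descent-1
    ; descent-2     = descent-2
    ; descent-21    = descent-21
    ; descent-12    = descent-12
    ; swapPos-braid = cong (a ∷_) swapPos-braid
    }
    where open DoubleDescent (doubleDescent r w h h′)

open Permutations

-- Representation by operators

-- The Hecke algebra acts from the right on coefficient functions Perm → A,
-- considered on valid permutations only; products of operators are written in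
-- the order in which they act, so that T_w ↦ operator is a homomorphism.
module Operators {c ℓ ℓ′} (A : RawRing c ℓ) (_≈ᴬ_ : RawRing.Carrier A → RawRing.Carrier A → Set ℓ′)
  (isCommutativeRing : IsCommutativeRing _≈ᴬ_ (RawRing._+_ A) (RawRing._*_ A) (RawRing.-_ A) (RawRing.0# A) (RawRing.1# A))
  (q : RawRing.Carrier A) (n : ℕ) where

  scalars : CommutativeRing c ℓ′
  scalars = record { isCommutativeRing = isCommutativeRing }

  open CommutativeRing scalars hiding (zero; isCommutativeRing)
  open NoncommutativeSolver ring using (Central; solve; Expr; con; _:+_; _:*_; _:-_; 𝟘; 𝟙)
  open Hecke A q
  open SetoidReasoning setoid

  Vector : Set c
  Vector = Perm → Carrier

  infix 4 _≈ᵛ_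
  _≈ᵛ_ : Vector → Vector → Set ℓ′
  φ ≈ᵛ ψ = ∀ w → Valid n w → φ w ≈ ψ w

  -- `cong` is part of the data because functions are compared on valid permutations only.
  -- Additivity gives distributivity over a right factor, and homogeneity makes the scalars central.
  record Operator : Set (c ⊔ ℓ′) where
    field
      apply  : Vector → Vector
      cong   : ∀ {φ ψ} → φ ≈ᵛ ψ → apply φ ≈ᵛ apply ψ
      +-homo : ∀ φ ψ → apply (λ w → φ w + ψ w) ≈ᵛ (λ w → apply φ w + apply ψ w)
      *-homo : ∀ a φ → apply (λ w → a * φ w) ≈ᵛ (λ w → a * apply φ w)
  open Operator public

  record _≈ᵒ_ (f g : Operator) : Set (c ⊔ ℓ′) where
    constructor mkᵒ
    field apply≈ : ∀ φ → apply f φ ≈ᵛ apply g φ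
  open _≈ᵒ_ public

  all : ∀ x → Σ Carrier Central
  all x = x , *-comm x

  interchange : ∀ a b x y → a + b + (x + y) ≈ a + x + (b + y)
  interchange a b x y = solve (all a ∷ all b ∷ all x ∷ all y ∷ []) []
    (con 0 :+ con 1 :+ (con 2 :+ con 3)) (con 0 :+ con 2 :+ (con 1 :+ con 3)) ≡.refl

  neg-* : ∀ a x → - (a * x) ≈ a * - x
  neg-* a x = trans (sym (+-identityˡ _)) (trans (solve (all a ∷ all x ∷ []) []
    (𝟘 :- con 0 :* con 1) (con 0 :* (𝟘 :- con 1)) ≡.refl) (*-congˡ (+-identityˡ _)))

  neg-+ : ∀ x y → - (x + y) ≈ - x + - y
  neg-+ x y = trans (sym (+-identityˡ _)) (trans (solve (all x ∷ all y ∷ []) []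
    (𝟘 :- (con 0 :+ con 1)) ((𝟘 :- con 0) :+ (𝟘 :- con 1)) ≡.refl) (+-cong (+-identityˡ _) (+-identityˡ _)))

  operators : Ring (c ⊔ ℓ′) (c ⊔ ℓ′)
  operators = record
    { Carrier = Operator
    ; _≈_ = _≈ᵒ_
    ; _+_ = λ f g → record
      { apply  = λ φ w → apply f φ w + apply g φ w
      ; cong   = λ e w v → +-cong (cong f e w v) (cong g e w v)
      ; +-homo = λ φ ψ w v → trans (+-cong (+-homo f φ ψ w v) (+-homo g φ ψ w v)) (interchange _ _ _ _)
      ; *-homo = λ a φ w v → trans (+-cong (*-homo f a φ w v) (*-homo g a φ w v)) (sym (distribˡ _ _ _))
      }
    ; _*_ = λ f g → record
      { apply  = λ φ → apply g (apply f φ)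
      ; cong   = λ e → cong g (cong f e)
      ; +-homo = λ φ ψ w v → trans (cong g (+-homo f φ ψ) w v) (+-homo g _ _ w v)
      ; *-homo = λ a φ w v → trans (cong g (*-homo f a φ) w v) (*-homo g a _ w v)
      }
    ; -_ = λ f → record
      { apply  = λ φ w → - apply f φ w
      ; cong   = λ e w v → -‿cong (cong f e w v)
      ; +-homo = λ φ ψ w v → trans (-‿cong (+-homo f φ ψ w v)) (neg-+ _ _)
      ; *-homo = λ a φ w v → trans (-‿cong (*-homo f a φ w v)) (neg-* _ _)
      }
    ; 0# = record
      { apply  = λ φ w → 0#
      ; cong   = λ e w v → refl
      ; +-homo = λ φ ψ w v → sym (+-identityˡ _)
      ; *-homo = λ a φ w v → sym (zeroʳ _)
      }
    ; 1# = record
      { apply  = λ φ → φ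
      ; cong   = λ e → e
      ; +-homo = λ φ ψ w v → refl
      ; *-homo = λ a φ w v → refl
      }
    ; isRing = record
      { +-isAbelianGroup = record
        { isGroup = record
          { isMonoid = record
            { isSemigroup = record
              { isMagma = record
                { isEquivalence = record
                  { refl  = mkᵒ λ φ w v → refl
                  ; sym   = λ (mkᵒ e) → mkᵒ λ φ w v → sym (e φ w v)
                  ; trans = λ (mkᵒ e) (mkᵒ e′) → mkᵒ λ φ w v → trans (e φ w v) (e′ φ w v)
                  }
                ; ∙-cong = λ (mkᵒ e) (mkᵒ e′) → mkᵒ λ φ w v → +-cong (e φ w v) (e′ φ w v)
                }
              ; assoc = λ f g h → mkᵒ λ φ w v → +-assoc _ _ _
              }
            ; identity = (λ f → mkᵒ λ φ w v → +-identityˡ _) , (λ f → mkᵒ λ φ w v → +-identityʳ _)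
            }
          ; inverse = (λ f → mkᵒ λ φ w v → -‿inverseˡ _) , (λ f → mkᵒ λ φ w v → -‿inverseʳ _)
          ; ⁻¹-cong = λ (mkᵒ e) → mkᵒ λ φ w v → -‿cong (e φ w v)
          }
        ; comm = λ f g → mkᵒ λ φ w v → +-comm _ _
        }
      ; *-cong = λ {f} {f′} {g} {g′} (mkᵒ e) (mkᵒ e′) → mkᵒ λ φ w v → trans (cong g (e φ) w v) (e′ _ w v)
      ; *-assoc = λ f g h → mkᵒ λ φ w v → refl
      ; *-identity = (λ f → mkᵒ λ φ w v → refl) , (λ f → mkᵒ λ φ w v → refl)
      ; distrib = (λ f g h → mkᵒ λ φ w v → refl) , (λ f g h → mkᵒ λ φ w v → +-homo f _ _ w v)
      }
    }

  module E = Ring operators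

  scalar : Carrier → Operator
  scalar a = record
    { apply  = λ φ w → a * φ w
    ; cong   = λ e w v → *-congˡ (e w v)
    ; +-homo = λ φ ψ w v → distribˡ _ _ _
    ; *-homo = λ b φ w v → solve (all a ∷ all b ∷ all (φ w) ∷ []) []
                 (con 0 :* (con 1 :* con 2)) (con 1 :* (con 0 :* con 2)) ≡.refl
    }

  scalar-central : ∀ a f → scalar a E.* f E.≈ f E.* scalar a
  scalar-central a f = mkᵒ λ φ → *-homo f a φ

  scalar-cong : ∀ {a b} → a ≈ b → scalar a E.≈ scalar b
  scalar-cong eq = mkᵒ λ φ w v → *-congʳ eq

  scalar-+ : ∀ a b → scalar (a + b) E.≈ scalar a E.+ scalar b
  scalar-+ a b = mkᵒ λ φ w v → distribʳ _ _ _

  scalar-* : ∀ a b → scalar (a * b) E.≈ scalar a E.* scalar b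
  scalar-* a b = mkᵒ λ φ w v → trans (*-congʳ (*-comm a b)) (*-assoc b a (φ w))

  scalar-neg : ∀ a → scalar (- a) E.≈ E.- scalar a
  scalar-neg a = mkᵒ λ φ w v → trans (*-comm (- a) (φ w)) (trans (sym (neg-* _ _)) (-‿cong (*-comm _ _)))

  scalar-1 : scalar 1# E.≈ E.1#
  scalar-1 = mkᵒ λ φ w v → *-identityˡ _

  scalar-0 : scalar 0# E.≈ E.0#
  scalar-0 = mkᵒ λ φ w v → zeroˡ _

  p : Carrier
  p = q + - 1#

  -- The coefficient of T_w in x T_{i+1}: only T_w and T_{w s} can contribute to it. If w has an
  -- ascent, T_{w s} contributes q; if it has a descent, T_{w s} contributes 1 and T_w contributes q
  -- - 1.
  act : ℕ → Vector → Vector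
  act i φ w = if ascentPos i w then q * φ (swapPos i w) else φ (swapPos i w) + p * φ w

  generator : ℕ → Operator
  generator i = record
    { apply  = act i
    ; cong   = λ {φ} {ψ} → act-cong φ ψ
    ; +-homo = act-+
    ; *-homo = act-*
    }
    where
    act-cong : ∀ φ ψ → φ ≈ᵛ ψ → act i φ ≈ᵛ act i ψ
    act-cong φ ψ e w v with ascentPos i w
    ... | true  = *-congˡ (e _ (valid-swapPos i v))
    ... | false = +-cong (e _ (valid-swapPos i v)) (*-congˡ (e w v))
    act-+ : ∀ φ ψ → act i (λ w → φ w + ψ w) ≈ᵛ (λ w → act i φ w + act i ψ w)
    act-+ φ ψ w v with ascentPos i w
    ... | true  = distribˡ _ _ _
    ... | false = solve (all p ∷ all (φ (swapPos i w)) ∷ all (ψ (swapPos i w)) ∷ all (φ w) ∷ all (ψ w) ∷ []) []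
      (con 1 :+ con 2 :+ con 0 :* (con 3 :+ con 4)) (con 1 :+ con 0 :* con 3 :+ (con 2 :+ con 0 :* con 4)) ≡.refl
    act-* : ∀ a φ → act i (λ w → a * φ w) ≈ᵛ (λ w → a * act i φ w)
    act-* a φ w v with ascentPos i w
    ... | true  = solve (all q ∷ all a ∷ all (φ (swapPos i w)) ∷ []) []
      (con 0 :* (con 1 :* con 2)) (con 1 :* (con 0 :* con 2)) ≡.refl
    ... | false = solve (all p ∷ all a ∷ all (φ (swapPos i w)) ∷ all (φ w) ∷ []) []
      (con 1 :* con 2 :+ con 0 :* (con 1 :* con 3)) (con 1 :* (con 2 :+ con 0 :* con 3)) ≡.refl

  -- `act (suc i) φ (a ∷ w)` is by definition `act i (φ ∘ (a ∷_)) w`, so here and in the next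
  -- relations only position 0 calls for calculation. The right side is (q - 1) T + q in the form to
  -- which the product of operators unfolds, with q - 1 acting before T.
  act-quadratic : ∀ i φ w → Unique w → suc i < length w →
                  act i (act i φ) w ≈ act i (λ u → q * φ u + - φ u) w + q * φ w
  act-quadratic zero φ (a ∷ []) u (s≤s ())
  act-quadratic zero φ (a ∷ b ∷ w) ((a≢b ∷ _) ∷ _) h with a <ᵇ b | b <ᵇ a | <ᵇ-flip a≢b
  ... | true  | false | _ = solve (all q ∷ all (φ (a ∷ b ∷ w)) ∷ all (φ (b ∷ a ∷ w)) ∷ []) []
    (con 0 :* (con 1 :+ (con 0 :- 𝟙) :* con 2))
    (con 0 :* (con 0 :* con 2 :- con 2) :+ con 0 :* con 1) ≡.refl
  ... | false | true  | _ = solve (all q ∷ all (φ (a ∷ b ∷ w)) ∷ all (φ (b ∷ a ∷ w)) ∷ []) []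
    (con 0 :* con 1 :+ (con 0 :- 𝟙) :* (con 2 :+ (con 0 :- 𝟙) :* con 1))
    (con 0 :* con 2 :- con 2 :+ (con 0 :- 𝟙) :* (con 0 :* con 1 :- con 1) :+ con 0 :* con 1) ≡.refl
  act-quadratic (suc i) φ (a ∷ w) (_ ∷ u) (s≤s h) = act-quadratic i (φ ∘ (a ∷_)) w u h

  act-far : ∀ i j φ w → suc i < j → act i (act j φ) w ≈ act j (act i φ) w
  act-far zero    (suc (suc j)) φ []          h = refl
  act-far zero    (suc (suc j)) φ (a ∷ [])    h = refl
  act-far zero    (suc (suc j)) φ (a ∷ b ∷ w) h with a <ᵇ b | ascentPos j w
  ... | true  | true  = refl
  ... | true  | false = solve (all q ∷ all p ∷ all (φ (b ∷ a ∷ swapPos j w)) ∷ all (φ (b ∷ a ∷ w)) ∷ []) []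
    (con 0 :* (con 2 :+ con 1 :* con 3)) (con 0 :* con 2 :+ con 1 :* (con 0 :* con 3)) ≡.refl
  ... | false | true  = solve
    (all q ∷ all p ∷ all (φ (b ∷ a ∷ swapPos j w)) ∷ all (φ (a ∷ b ∷ swapPos j w)) ∷ []) []
    (con 0 :* con 2 :+ con 1 :* (con 0 :* con 3)) (con 0 :* (con 2 :+ con 1 :* con 3)) ≡.refl
  ... | false | false = solve
    (all p ∷ all (φ (b ∷ a ∷ swapPos j w)) ∷ all (φ (b ∷ a ∷ w)) ∷ all (φ (a ∷ b ∷ swapPos j w)) ∷ all (φ (a ∷ b ∷ w)) ∷ []) []
    (con 1 :+ con 0 :* con 2 :+ con 0 :* (con 3 :+ con 0 :* con 4))
    (con 1 :+ con 0 :* con 3 :+ con 0 :* (con 2 :+ con 0 :* con 4)) ≡.refl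
  act-far zero    (suc zero)    φ w           (s≤s ())
  act-far (suc i) (suc j)       φ []          (s≤s h) = refl
  act-far (suc i) (suc j)       φ (a ∷ w)     (s≤s h) = act-far i j (φ ∘ (a ∷_)) w h

  -- The two sides of the braid relation at a ∷ b ∷ c ∷ w as expressions, for
  -- given truth values x, y, z of a < b, a < c and b < c.
  private
    env : Vector → ℕ → ℕ → ℕ → Perm → List (Σ Carrier Central)
    env φ a b c w = all q ∷ all p ∷
      all (φ (a ∷ b ∷ c ∷ w)) ∷ all (φ (a ∷ c ∷ b ∷ w)) ∷ all (φ (b ∷ a ∷ c ∷ w)) ∷
      all (φ (b ∷ c ∷ a ∷ w)) ∷ all (φ (c ∷ a ∷ b ∷ w)) ∷ all (φ (c ∷ b ∷ a ∷ w)) ∷ []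

    step : Bool → Expr → Expr → Expr
    step true  e e′ = con 0 :* e
    step false e e′ = e :+ con 1 :* e′

    lhs rhs : Bool → Bool → Bool → Expr
    lhs x y z = step z (step y (step x (con 7) (con 6)) (step (not z) (con 2) (con 3))) (step x (step y (con 5) (con 4)) (step z (con 3) (con 2)))
    rhs x y z = step x (step y (step z (con 7) (con 5)) (step (not x) (con 2) (con 4))) (step z (step y (con 6) (con 3)) (step x (con 4) (con 2)))

  act-braid : ∀ i φ w → Unique w → suc (suc i) < length w →
              act (suc i) (act i (act (suc i) φ)) w ≈ act i (act (suc i) (act i φ)) w
  act-braid zero φ (a ∷ []) u (s≤s ())
  act-braid zero φ (a ∷ b ∷ []) u (s≤s (s≤s ()))
  act-braid zero φ (a ∷ b ∷ c ∷ w) ((a≢b ∷ a≢c ∷ _) ∷ (b≢c ∷ _) ∷ _) h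
    with a <ᵇ b in ab | b <ᵇ a | <ᵇ-flip a≢b
       | a <ᵇ c in ac | c <ᵇ a | <ᵇ-flip a≢c
       | b <ᵇ c in bc | c <ᵇ b | <ᵇ-flip b≢c
  ... | true  | _ | ≡.refl | true  | _ | ≡.refl | true  | _ | ≡.refl = solve (env φ a b c w) [] (lhs true true true) (rhs true true true) ≡.refl
  ... | true  | _ | ≡.refl | true  | _ | ≡.refl | false | _ | ≡.refl = solve (env φ a b c w) [] (lhs true true false) (rhs true true false) ≡.refl
  ... | true  | _ | ≡.refl | false | _ | ≡.refl | true  | _ | ≡.refl = contradiction (≡.trans (≡.sym ac) (<ᵇ-true (ℕ.<-trans (<ᵇ-true⁻¹ {a} {b} ab) (<ᵇ-true⁻¹ {b} {c} bc)))) λ ()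
  ... | true  | _ | ≡.refl | false | _ | ≡.refl | false | _ | ≡.refl = solve (env φ a b c w) [] (lhs true false false) (rhs true false false) ≡.refl
  ... | false | _ | ≡.refl | true  | _ | ≡.refl | true  | _ | ≡.refl = solve (env φ a b c w) [] (lhs false true true) (rhs false true true) ≡.refl
  ... | false | _ | ≡.refl | true  | _ | ≡.refl | false | _ | ≡.refl = contradiction (≡.trans (≡.sym ac) (<ᵇ-false (ℕ.≤-trans (<ᵇ-false⁻¹ {b} {c} bc) (<ᵇ-false⁻¹ {a} {b} ab)))) λ ()
  ... | false | _ | ≡.refl | false | _ | ≡.refl | true  | _ | ≡.refl = solve (env φ a b c w) [] (lhs false false true) (rhs false false true) ≡.refl
  ... | false | _ | ≡.refl | false | _ | ≡.refl | false | _ | ≡.refl = solve (env φ a b c w) [] (lhs false false false) (rhs false false false) ≡.refl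
  act-braid (suc i) φ (a ∷ w) (_ ∷ u) (s≤s h) = act-braid i (φ ∘ (a ∷_)) w u h

  heckeGenerators : HeckeGenerators operators n
  heckeGenerators = record
    { q         = scalar q
    ; q-central = scalar-central q
    -- Positions are counted from 0, generators from 1.
    ; T         = λ j → generator (j ∸ 1)
    ; quadratic = λ j j<n → mkᵒ λ φ w (len , u) → act-quadratic j φ w u (≡.subst (suc j <_) (≡.sym len) j<n)
    ; braid     = λ j j<n → mkᵒ λ φ w (len , u) → act-braid j φ w u (≡.subst (suc (suc j) <_) (≡.sym len) j<n)
    ; far       = λ { i (suc j) (s≤s i<j) j<n → mkᵒ λ φ w v → sym (act-far i j φ w i<j) }
    }

-- The elements T_w in a ring with Hecke generators

module BasisElements {c ℓ} (R : Ring c ℓ) (n : ℕ) (G : HeckeGenerators R n) where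
  open Ring R hiding (zero)
  open HeckeGenerators G
  open NoncommutativeSolver R
  open SetoidReasoning setoid

  word : List ℕ → Carrier
  word []       = 1#
  word (j ∷ js) = T j * word js

  word-++ : ∀ js ks → word (js ++ ks) ≈ word js * word ks
  word-++ []       ks = sym (*-identityˡ _)
  word-++ (j ∷ js) ks = trans (*-congˡ (word-++ js ks)) (sym (*-assoc _ _ _))

  basis : Perm → Carrier
  basis w = word (redWord w)

  basis-step : ∀ {w i} → Unique w → firstDescent′ w ≡ just (suc i) → ascentPos i w ≡ false →
               basis w ≈ basis (swapPos i w) * T (suc i)
  basis-step {w} {i} u eq d = trans (reflexive (≡.cong word (redWord-step u eq d)))
    (trans (word-++ (redWord (swapPos i w)) (suc i ∷ [])) (*-congˡ (*-identityʳ _)))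

  -- Matsumoto's argument: the first descent i and the descent p of w are compared
  -- through the longest element of the subgroup generated by s_i and s_p.
  basis-descent : ∀ k p {w} → Valid n w → inversions w ≤ k → ascentPos p w ≡ false →
                  basis w ≈ basis (swapPos p w) * T (suc p)
  basis-descent zero    p (_ , u) inv d = contradiction (ℕ.≤-trans (inversions-decrease p u d) inv) λ ()
  basis-descent (suc k) p {w} v@(len , u) inv d with firstDescent′-exists p w d
  ... | i , eq , i≤p , d′ with ℕ.<-cmp i p
  ...   | tri> _ _ p<i    = contradiction (ℕ.≤-trans p<i i≤p) ℕ.1+n≰n
  ...   | tri≈ _ ≡.refl _ = basis-step u eq d′
  ...   | tri< i<p _ _ with ℕ.<-cmp (suc i) p
  ...     | tri> _ _ p<1+i = contradiction (ℕ.≤-trans p<1+i i<p) ℕ.1+n≰n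
  ...     | tri< i<<p _ _ = begin
    basis w
      ≈⟨ basis-step u eq d′ ⟩
    basis (s i w) * T (suc i)
      ≈⟨ *-congʳ (basis-descent k p (valid-swapPos i v) (ℕ.≤-pred (ℕ.≤-trans (inversions-decrease i u d′) inv))
           (≡.trans (ascentPos-farʳ i p w i<<p) d)) ⟩
    basis (s p (s i w)) * T (suc p) * T (suc i)
      ≈⟨ *-assoc _ _ _ ⟩
    basis (s p (s i w)) * (T (suc p) * T (suc i))
      ≈⟨ *-cong (reflexive (≡.cong basis (≡.sym (swapPos-far i p w i<<p)))) (sym T-far) ⟩
    basis (s i (s p w)) * (T (suc i) * T (suc p))
      ≈⟨ *-assoc _ _ _ ⟨
    basis (s i (s p w)) * T (suc i) * T (suc p)
      ≈⟨ *-congʳ (basis-descent k i (valid-swapPos p v) (ℕ.≤-pred (ℕ.≤-trans (inversions-decrease p u d) inv))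
           (≡.trans (ascentPos-farˡ i p w i<<p) d′)) ⟨
    basis (s p w) * T (suc p) ∎
    where
    s = swapPos
    T-far : T (suc i) * T (suc p) ≈ T (suc p) * T (suc i)
    T-far = far i (suc p) (s≤s i<<p) (≡.subst (suc p <_) len (descent⇒< p w d))
  ...     | tri≈ _ ≡.refl _ = begin
    basis w
      ≈⟨ basis-step u eq d′ ⟩
    basis (s i w) * gᵢ
      ≈⟨ *-congʳ (basis-descent k p v₁ inv₁ descent-1) ⟩
    basis (s p (s i w)) * gₚ * gᵢ
      ≈⟨ *-congʳ (*-congʳ (basis-descent k i (valid-swapPos p v₁) (ℕ.≤-trans (ℕ.<⇒≤ (inversions-decrease p (proj₂ v₁) descent-1)) inv₁) descent-21)) ⟩
    basis (s i (s p (s i w))) * gᵢ * gₚ * gᵢ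
      ≈⟨ solve [] (basis (s i (s p (s i w))) ∷ gᵢ ∷ gₚ ∷ [])
           (var 0 :* var 1 :* var 2 :* var 1)
           (var 0 :* (var 1 :* var 2 :* var 1)) ≡.refl ⟩
    basis (s i (s p (s i w))) * (gᵢ * gₚ * gᵢ)
      ≈⟨ *-cong (reflexive (≡.cong basis swapPos-braid))
           (sym (braid i (≡.subst (suc (suc i) <_) len (descent⇒< (suc i) w d)))) ⟩
    basis (s p (s i (s p w))) * (gₚ * gᵢ * gₚ)
      ≈⟨ solve [] (basis (s p (s i (s p w))) ∷ gᵢ ∷ gₚ ∷ [])
           (var 0 :* (var 2 :* var 1 :* var 2))
           (var 0 :* var 2 :* var 1 :* var 2) ≡.refl ⟩
    basis (s p (s i (s p w))) * gₚ * gᵢ * gₚ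
      ≈⟨ *-congʳ (*-congʳ (basis-descent k p (valid-swapPos i v₂) (ℕ.≤-trans (ℕ.<⇒≤ (inversions-decrease i (proj₂ v₂) descent-2)) inv₂) descent-12)) ⟨
    basis (s i (s p w)) * gᵢ * gₚ
      ≈⟨ *-congʳ (basis-descent k i v₂ inv₂ descent-2) ⟨
    basis (s p w) * gₚ ∎
    where
    open DoubleDescent (doubleDescent i w d′ d)
    s = swapPos
    gᵢ = T (suc i)
    gₚ = T (suc (suc i))
    v₁ = valid-swapPos i v
    v₂ = valid-swapPos p v
    inv₁ = ℕ.≤-pred (ℕ.≤-trans (inversions-decrease i u d′) inv)
    inv₂ = ℕ.≤-pred (ℕ.≤-trans (inversions-decrease p u d) inv)

-- The homomorphism from formal combinations to such a ring

toCommutativeRing : ∀ {a ℓ ℓ′} (A : RawRing a ℓ) (_≈ᴬ_ : RawRing.Carrier A → RawRing.Carrier A → Set ℓ′) →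
  IsCommutativeRing _≈ᴬ_ (RawRing._+_ A) (RawRing._*_ A) (RawRing.-_ A) (RawRing.0# A) (RawRing.1# A) →
  CommutativeRing a ℓ′
toCommutativeRing A _≈ᴬ_ isCR = record { isCommutativeRing = isCR }

record ScalarMap {a ℓa c ℓ} (S : CommutativeRing a ℓa) (R : Ring c ℓ) : Set (a ⊔ ℓa ⊔ c ⊔ ℓ) where
  private
    module S = CommutativeRing S
  open Ring R
  field
    scalar         : S.Carrier → Carrier
    scalar-central : ∀ a x → scalar a * x ≈ x * scalar a
    scalar-cong    : ∀ {a b} → a S.≈ b → scalar a ≈ scalar b
    scalar-+       : ∀ a b → scalar (a S.+ b) ≈ scalar a + scalar b
    scalar-*       : ∀ a b → scalar (a S.* b) ≈ scalar a * scalar b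
    scalar-neg     : ∀ a → scalar (S.- a) ≈ - scalar a
    scalar-0       : scalar S.0# ≈ 0#
    scalar-1       : scalar S.1# ≈ 1#

module LinearExtension {a ℓa ℓa′ c ℓ} (A : RawRing a ℓa) (_≈ᴬ_ : RawRing.Carrier A → RawRing.Carrier A → Set ℓa′)
  (isCR : IsCommutativeRing _≈ᴬ_ (RawRing._+_ A) (RawRing._*_ A) (RawRing.-_ A) (RawRing.0# A) (RawRing.1# A))
  (q₀ : RawRing.Carrier A) (n : ℕ) (R : Ring c ℓ) (G : HeckeGenerators R n)
  (σ : ScalarMap (toCommutativeRing A _≈ᴬ_ isCR) R)
  (scalar-q : Ring._≈_ R (ScalarMap.scalar σ q₀) (HeckeGenerators.q G)) where

  private
    module S = CommutativeRing (toCommutativeRing A _≈ᴬ_ isCR)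
  open Ring R hiding (zero)
  open HeckeGenerators G
  open ScalarMap σ
  open NoncommutativeSolver R using (Central; solve; con; var; _:+_; _:*_; _:-_; 𝟘; 𝟙; dropRelation)
  open HeckeAlgebra R n G using (b; b*; F; F*)
  open BasisElements R n G
  open Hecke A q₀
  open SetoidReasoning setoid

  scalarᶜ : S.Carrier → Σ Carrier Central
  scalarᶜ a = scalar a , scalar-central a

  qᶜ : Σ Carrier Central
  qᶜ = q , q-central

  ⟪_⟫ : H → Carrier
  ⟪ [] ⟫          = 0#
  ⟪ (a , w) ∷ x ⟫ = scalar a * basis w + ⟪ x ⟫

  AllValid : H → Set a
  AllValid = All (λ t → Valid n (proj₂ t))

  ⟪++⟫ : ∀ x y → ⟪ x ++ y ⟫ ≈ ⟪ x ⟫ + ⟪ y ⟫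
  ⟪++⟫ []            y = sym (+-identityˡ _)
  ⟪++⟫ ((a , w) ∷ x) y = trans (+-congˡ (⟪++⟫ x y)) (sym (+-assoc _ _ _))

  basis-ascent : ∀ {i w} → Valid n w → suc i < n → ascentPos i w ≡ true →
                 basis (swapPos i w) ≈ basis w * T (suc i)
  basis-ascent {i} {w} v@(len , u) i<n asc = trans
    (basis-descent (inversions (swapPos i w)) i (valid-swapPos i v) ℕ.≤-refl
      (≡.trans (ascentPos-swapPos i u (≡.subst (suc i <_) (≡.sym len) i<n)) (≡.cong not asc)))
    (*-congʳ (reflexive (≡.cong basis (swapPos-involutive i w))))

  -- At a descent T_w = T_{w s} T, so that T_w T = T_{w s} T², and the quadratic relation produces
  -- the two terms of `mulGenTerm`. An ascent of w is a descent of w s.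
  ⟪mulGenTerm⟫ : ∀ {i a w} → Valid n w → suc i < n → ⟪ mulGenTerm (suc i) (a , w) ⟫ ≈ scalar a * basis w * T (suc i)
  ⟪mulGenTerm⟫ {i} {a} {w} v i<n with ascentPos i w in asc
  ... | true  = trans (+-identityʳ _) (trans (*-congˡ (basis-ascent v i<n asc)) (sym (*-assoc _ _ _)))
  ... | false = begin
    scalar ((q₀ S.+ S.- S.1#) S.* a) * basis w + (scalar (q₀ S.* a) * basis w′ + 0#)
      ≈⟨ +-cong (*-congʳ (trans (scalar-* _ _) (*-congʳ (trans (scalar-+ _ _)
                  (+-cong scalar-q (trans (scalar-neg _) (-‿cong scalar-1)))))))
                (+-congʳ (*-congʳ (trans (scalar-* _ _) (*-congʳ scalar-q)))) ⟩
    (q - 1#) * scalar a * basis w + (q * scalar a * basis w′ + 0#)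
      ≈⟨ trans
        (solve (qᶜ ∷ scalarᶜ a ∷ []) (basis w ∷ basis w′ ∷ T (suc i) ∷ [])
          ((con 0 :- 𝟙) :* con 1 :* var 0 :+ (con 0 :* con 1 :* var 1 :+ 𝟘))
          (con 1 :* var 0 :* var 2
            :+ (𝟘 :- con 1) :* (var 0 :- var 1 :* var 2) :* var 2
            :+ (𝟘 :- con 1 :* var 1) :* (var 2 :* var 2 :- ((con 0 :- 𝟙) :* var 2 :+ con 0)) :* 𝟙
            :+ con 1 :* (con 0 :- 𝟙) :* (var 0 :- var 1 :* var 2) :* 𝟙) ≡.refl)
        (trans (dropRelation _ _ w≈) (trans (dropRelation _ _ (quadratic i i<n)) (dropRelation _ _ w≈))) ⟩
    scalar a * basis w * T (suc i) ∎
    where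
    w′ = swapPos i w
    w≈ : basis w ≈ basis w′ * T (suc i)
    w≈ = basis-descent (inversions w) i v ℕ.≤-refl asc

  valid-mulGenTerm : ∀ j {t} → Valid n (proj₂ t) → AllValid (mulGenTerm j t)
  valid-mulGenTerm j {a , w} v with ascent w j
  ... | true  = valid-swapPos (j ∸ 1) v ∷ []
  ... | false = v ∷ valid-swapPos (j ∸ 1) v ∷ []

  valid-·T : ∀ j {x} → AllValid x → AllValid (x ·T j)
  valid-·T j []       = []
  valid-·T j (v ∷ vs) = All.++⁺ (valid-mulGenTerm j v) (valid-·T j vs)

  valid-·Tword : ∀ js {x} → AllValid x → AllValid (x ·Tword js)
  valid-·Tword []       vs = vs
  valid-·Tword (j ∷ js) vs = valid-·Tword js (valid-·T j vs)

  valid-⊙ : ∀ a {x} → AllValid x → AllValid (a ⊙ x)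
  valid-⊙ a []       = []
  valid-⊙ a (v ∷ vs) = v ∷ valid-⊙ a vs

  valid-⊗ : ∀ {x} y → AllValid x → AllValid (x ⊗ y)
  valid-⊗ []            vs = []
  valid-⊗ ((a , w) ∷ y) vs = All.++⁺ (valid-⊙ a (valid-·Tword (redWord w) vs)) (valid-⊗ y vs)

  valid-1H : AllValid (1H n)
  valid-1H = valid-idPerm n ∷ []

  ⟪·T⟫ : ∀ {j x} → 0 < j → j < n → AllValid x → ⟪ x ·T j ⟫ ≈ ⟪ x ⟫ * T j
  ⟪·T⟫ {suc i} {[]}          h j<n []       = sym (zeroˡ _)
  ⟪·T⟫ {suc i} {(a , w) ∷ x} h j<n (v ∷ vs) = trans (⟪++⟫ (mulGenTerm (suc i) (a , w)) (x ·T suc i))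
    (trans (+-cong (⟪mulGenTerm⟫ v j<n) (⟪·T⟫ h j<n vs)) (sym (distribʳ _ _ _)))

  ⟪·Tword⟫ : ∀ {js x} → InRange n js → AllValid x → ⟪ x ·Tword js ⟫ ≈ ⟪ x ⟫ * word js
  ⟪·Tword⟫ {[]}     []                vs = sym (*-identityʳ _)
  ⟪·Tword⟫ {j ∷ js} ((lo , hi) ∷ rng) vs = trans (⟪·Tword⟫ rng (valid-·T j vs))
    (trans (*-congʳ (⟪·T⟫ lo hi vs)) (*-assoc _ _ _))

  ⟪⊙⟫ : ∀ a x → ⟪ a ⊙ x ⟫ ≈ scalar a * ⟪ x ⟫
  ⟪⊙⟫ a []            = sym (zeroʳ _)
  ⟪⊙⟫ a ((d , w) ∷ x) = trans (+-cong (trans (*-congʳ (scalar-* a d)) (*-assoc _ _ _)) (⟪⊙⟫ a x))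
    (sym (distribˡ _ _ _))

  -- `⊗` multiplies by the letters of `redWord w`, and `basis w` is the product of the same letters.
  -- Everything thus reduces to a single letter, where `basis-descent` frees the argument from the
  -- chosen reduced word.
  ⟪⊗⟫ : ∀ {x y} → AllValid x → AllValid y → ⟪ x ⊗ y ⟫ ≈ ⟪ x ⟫ * ⟪ y ⟫
  ⟪⊗⟫ {x} {[]}          vs []        = sym (zeroʳ _)
  ⟪⊗⟫ {x} {(a , w) ∷ y} vs (v ∷ vs′) = begin
    ⟪ a ⊙ (x ·Tword redWord w) ++ x ⊗ y ⟫
      ≈⟨ ⟪++⟫ (a ⊙ (x ·Tword redWord w)) (x ⊗ y) ⟩
    ⟪ a ⊙ (x ·Tword redWord w) ⟫ + ⟪ x ⊗ y ⟫
      ≈⟨ +-cong (trans (⟪⊙⟫ a (x ·Tword redWord w)) (*-congˡ (⟪·Tword⟫ (redWord-inRange w (proj₁ v)) vs))) (⟪⊗⟫ vs vs′) ⟩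
    scalar a * (⟪ x ⟫ * basis w) + ⟪ x ⟫ * ⟪ y ⟫
      ≈⟨ solve (scalarᶜ a ∷ []) (⟪ x ⟫ ∷ basis w ∷ ⟪ y ⟫ ∷ [])
           (con 0 :* (var 0 :* var 1) :+ var 0 :* var 2) (var 0 :* (con 0 :* var 1 :+ var 2)) ≡.refl ⟩
    ⟪ x ⟫ * ⟪ (a , w) ∷ y ⟫ ∎

  ⟪1H⟫ : ⟪ 1H n ⟫ ≈ 1#
  ⟪1H⟫ = trans (+-identityʳ _) (trans (*-cong scalar-1 (reflexive (≡.cong word (redWord-idPerm n)))) (*-identityˡ _))

  ⟪Tword⟫ : ∀ {js} → InRange n js → ⟪ Tword n js ⟫ ≈ word js
  ⟪Tword⟫ rng = trans (⟪·Tword⟫ rng valid-1H) (trans (*-congʳ ⟪1H⟫) (*-identityˡ _))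

  valid-sum : ∀ (f : ℕ → List ℕ) is → AllValid (sumH (map (λ i → Tword n (f i)) is))
  valid-sum f []       = []
  valid-sum f (i ∷ is) = All.++⁺ (valid-·Tword (f i) valid-1H) (valid-sum f is)

  range-∷ʳ : ∀ {i m} → i ≤ m → range i (suc m) ≡ range i m ++ m ∷ []
  range-∷ʳ {i} {m} i≤m = ≡.trans (≡.cong (λ k → map (i ℕ.+_) (upTo k)) (ℕ.+-∸-assoc 1 i≤m))
    (≡.trans (≡.cong (map (i ℕ.+_)) (≡.sym (List.upTo-∷ʳ (m ∸ i))))
      (≡.trans (List.map-++ (i ℕ.+_) (upTo (m ∸ i)) _) (≡.cong (λ k → range i m ++ k ∷ []) (ℕ.m+[n∸m]≡n i≤m))))

  range-refl : ∀ m → range m m ≡ []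
  range-refl m = ≡.cong (λ k → map (m ℕ.+_) (upTo k)) (ℕ.n∸n≡0 m)

  range-bounds : ∀ i m → All (λ k → i ≤ k × k < m) (range i m)
  range-bounds i m = All.map⁺ (All.applyUpTo⁺₁ (λ k → k) (m ∸ i) λ {k} k<m∸i →
    ℕ.m≤m+n i k ,
    ℕ.<-≤-trans (ℕ.+-monoʳ-< i k<m∸i) (ℕ.≤-reflexive (ℕ.m+[n∸m]≡n {i} {m}
      (ℕ.<⇒≤ (ℕ.m∸n≢0⇒n<m {m} {i} λ eq → ℕ.n≮0 (≡.subst (k <_) eq k<m∸i))))))

  range-inRange : ∀ {i m} → 0 < i → m ≤ n → InRange n (range i m)
  range-inRange {i} {m} 0<i m≤n =
    All.map (λ (i≤k , k<m) → ℕ.≤-trans 0<i i≤k , ℕ.<-≤-trans k<m m≤n) (range-bounds i m)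

  wordSum : (ℕ → List ℕ) → List ℕ → Carrier
  wordSum f = foldr (λ i x → word (f i) + x) 0#

  ⟪sum⟫ : ∀ (f : ℕ → List ℕ) {is} → All (λ i → InRange n (f i)) is →
          ⟪ sumH (map (λ i → Tword n (f i)) is) ⟫ ≈ wordSum f is
  ⟪sum⟫ f                []           = refl
  ⟪sum⟫ f {i ∷ is} (rng ∷ rngs) = trans (⟪++⟫ (Tword n (f i)) _) (+-cong (⟪Tword⟫ rng) (⟪sum⟫ f rngs))

  wordSum-++ : ∀ f is js → wordSum f (is ++ js) ≈ wordSum f is + wordSum f js
  wordSum-++ f []       js = sym (+-identityˡ _)
  wordSum-++ f (i ∷ is) js = trans (+-congˡ (wordSum-++ f is js)) (sym (+-assoc _ _ _))

  descending : ℕ → ℕ → List ℕ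
  descending m i = reverse (range i m)

  ascending : ℕ → ℕ → List ℕ
  ascending m i = range i m

  descending-suc : ∀ {m is} → All (λ i → 1 ≤ i × i < suc m) is →
                   wordSum (descending (suc m)) is ≈ T m * wordSum (descending m) is
  descending-suc []                      = sym (zeroʳ _)
  descending-suc {m} {i ∷ is} ((_ , i≤m) ∷ h) = trans
    (+-cong (reflexive (≡.cong word (≡.trans (≡.cong reverse (range-∷ʳ (ℕ.≤-pred i≤m)))
              (List.reverse-++ (range i m) (m ∷ [])))))
            (descending-suc h))
    (sym (distribˡ _ _ _))

  ascending-suc : ∀ {m is} → All (λ i → 1 ≤ i × i < suc m) is →
                  wordSum (ascending (suc m)) is ≈ wordSum (ascending m) is * T m
  ascending-suc []                      = sym (zeroˡ _)
  ascending-suc {m} {i ∷ is} ((_ , i≤m) ∷ h) = trans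
    (+-cong (trans (reflexive (≡.cong word (range-∷ʳ (ℕ.≤-pred i≤m))))
              (trans (word-++ (range i m) (m ∷ [])) (*-congˡ (*-identityʳ _))))
            (ascending-suc h))
    (sym (distribʳ _ _ _))

  wordSum-descending : ∀ m → wordSum (descending m) (range 1 (suc m)) ≈ b m
  wordSum-descending zero    = refl
  wordSum-descending (suc m) = begin
    wordSum (descending (suc m)) (range 1 (suc (suc m)))
      ≡⟨ ≡.cong (wordSum (descending (suc m))) (range-∷ʳ {1} {suc m} (s≤s z≤n)) ⟩
    wordSum (descending (suc m)) (range 1 (suc m) ++ suc m ∷ [])
      ≈⟨ wordSum-++ (descending (suc m)) (range 1 (suc m)) (suc m ∷ []) ⟩
    wordSum (descending (suc m)) (range 1 (suc m)) + (word (descending (suc m) (suc m)) + 0#)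
      ≈⟨ +-cong (trans (descending-suc (range-bounds 1 (suc m))) (*-congˡ (wordSum-descending m)))
           (trans (+-identityʳ _) (reflexive (≡.cong (λ r → word (reverse r)) (range-refl (suc m))))) ⟩
    T m * b m + 1#
      ≈⟨ +-comm _ _ ⟩
    1# + T m * b m ∎

  wordSum-ascending : ∀ m → wordSum (ascending m) (range 1 (suc m)) ≈ b* m
  wordSum-ascending zero    = refl
  wordSum-ascending (suc m) = begin
    wordSum (ascending (suc m)) (range 1 (suc (suc m)))
      ≡⟨ ≡.cong (wordSum (ascending (suc m))) (range-∷ʳ {1} {suc m} (s≤s z≤n)) ⟩
    wordSum (ascending (suc m)) (range 1 (suc m) ++ suc m ∷ [])
      ≈⟨ wordSum-++ (ascending (suc m)) (range 1 (suc m)) (suc m ∷ []) ⟩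
    wordSum (ascending (suc m)) (range 1 (suc m)) + (word (ascending (suc m) (suc m)) + 0#)
      ≈⟨ +-cong (trans (ascending-suc (range-bounds 1 (suc m))) (*-congʳ (wordSum-ascending m)))
           (trans (+-identityʳ _) (reflexive (≡.cong word (range-refl (suc m))))) ⟩
    b* m * T m + 1#
      ≈⟨ +-comm _ _ ⟩
    1# + b* m * T m ∎

  ⟪𝓑⟫ : ∀ {m} → m ≤ n → ⟪ 𝓑 n m ⟫ ≈ b m
  ⟪𝓑⟫ {m} m≤n = trans (⟪sum⟫ (descending m) (All.map (λ (0<i , _) → All-resp-↭ (↭-sym (↭-reverse _)) (range-inRange 0<i m≤n)) (range-bounds 1 (suc m))))
    (wordSum-descending m)

  ⟪𝓑*⟫ : ∀ {m} → m ≤ n → ⟪ 𝓑* n m ⟫ ≈ b* m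
  ⟪𝓑*⟫ {m} m≤n = trans (⟪sum⟫ (ascending m) (All.map (λ (0<i , _) → range-inRange 0<i m≤n) (range-bounds 1 (suc m))))
    (wordSum-ascending m)

  valid-𝓑 : ∀ m → AllValid (𝓑 n m)
  valid-𝓑 m = valid-sum (descending m) (range 1 (suc m))

  valid-𝓑* : ∀ m → AllValid (𝓑* n m)
  valid-𝓑* m = valid-sum (ascending m) (range 1 (suc m))

  valid-𝓑nk : ∀ k → AllValid (𝓑nk n k)
  valid-𝓑nk zero    = valid-1H
  valid-𝓑nk (suc k) = valid-⊗ (𝓑nk n k) (valid-𝓑 (n ∸ k))

  valid-𝓑*nk : ∀ k → AllValid (𝓑*nk n k)
  valid-𝓑*nk zero    = valid-1H
  valid-𝓑*nk (suc k) = valid-⊗ (𝓑* n (n ∸ k)) (valid-𝓑*nk k)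

  ⟪𝓑nk⟫ : ∀ k → ⟪ 𝓑nk n k ⟫ ≈ F n k
  ⟪𝓑nk⟫ zero    = ⟪1H⟫
  ⟪𝓑nk⟫ (suc k) = trans (⟪⊗⟫ (valid-𝓑 (n ∸ k)) (valid-𝓑nk k)) (*-cong (⟪𝓑⟫ (ℕ.m∸n≤m n k)) (⟪𝓑nk⟫ k))

  ⟪𝓑*nk⟫ : ∀ k → ⟪ 𝓑*nk n k ⟫ ≈ F* n k
  ⟪𝓑*nk⟫ zero    = ⟪1H⟫
  ⟪𝓑*nk⟫ (suc k) = trans (⟪⊗⟫ (valid-𝓑*nk k) (valid-𝓑* (n ∸ k))) (*-cong (⟪𝓑*nk⟫ k) (⟪𝓑*⟫ (ℕ.m∸n≤m n k)))

  coeff-hit : ∀ {a v w} x → v ≡ w → coeff ((a , v) ∷ x) w ≡ a S.+ coeff x w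
  coeff-hit {v = v} {w} x v≡w with List.≡-dec ℕ._≟_ v w
  ... | yes _   = ≡.refl
  ... | no v≢w = contradiction v≡w v≢w

  coeff-miss : ∀ {a v w} x → v ≢ w → coeff ((a , v) ∷ x) w ≡ coeff x w
  coeff-miss {v = v} {w} x v≢w with List.≡-dec ℕ._≟_ v w
  ... | yes v≡w = contradiction v≡w v≢w
  ... | no _    = ≡.refl

  -- Merges the terms with equal permutation; this is the shape in which `𝓡` is given.
  collect : H → List Perm → H
  collect x U = map (λ w → coeff x w , w) U

  collect-[] : ∀ U → ⟪ collect [] U ⟫ ≈ 0#
  collect-[] []      = refl
  collect-[] (w ∷ U) = trans (+-cong (trans (*-congʳ scalar-0) (zeroˡ _)) (collect-[] U)) (+-identityˡ _)

  collect-miss : ∀ {a v x U} → All (v ≢_) U → ⟪ collect ((a , v) ∷ x) U ⟫ ≈ ⟪ collect x U ⟫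
  collect-miss         []        = refl
  collect-miss {x = x} (v≢w ∷ h) =
    +-cong (*-congʳ (reflexive (≡.cong scalar (coeff-miss x v≢w)))) (collect-miss {x = x} h)

  collect-hit : ∀ {a v x U} → Unique U → v ∈ U →
                ⟪ collect ((a , v) ∷ x) U ⟫ ≈ scalar a * basis v + ⟪ collect x U ⟫
  collect-hit {a} {v} {x} (v∉ ∷ u) (here ≡.refl) = begin
    scalar (coeff ((a , v) ∷ x) v) * basis v + _
      ≈⟨ +-cong (*-congʳ (trans (reflexive (≡.cong scalar (coeff-hit x ≡.refl))) (scalar-+ a (coeff x v))))
           (collect-miss {x = x} v∉) ⟩
    (scalar a + scalar (coeff x v)) * basis v + _
      ≈⟨ trans (+-congʳ (distribʳ _ _ _)) (+-assoc _ _ _) ⟩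
    scalar a * basis v + (scalar (coeff x v) * basis v + _) ∎
  collect-hit {a} {v} {x} {w ∷ U} (w∉ ∷ u) (there v∈U) = begin
    scalar (coeff ((a , v) ∷ x) w) * basis w + ⟪ collect ((a , v) ∷ x) U ⟫
      ≈⟨ +-cong (*-congʳ (reflexive (≡.cong scalar (coeff-miss x λ v≡w → All.lookup w∉ v∈U (≡.sym v≡w)))))
           (collect-hit {x = x} u v∈U) ⟩
    scalar (coeff x w) * basis w + (scalar a * basis v + ⟪ collect x U ⟫)
      ≈⟨ solve [] (scalar (coeff x w) * basis w ∷ scalar a * basis v ∷ ⟪ collect x U ⟫ ∷ [])
           (var 0 :+ (var 1 :+ var 2)) (var 1 :+ (var 0 :+ var 2)) ≡.refl ⟩
    scalar a * basis v + (scalar (coeff x w) * basis w + ⟪ collect x U ⟫) ∎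

  ⟪collect⟫ : ∀ {x U} → Unique U → All (λ t → proj₂ t ∈ U) x → ⟪ x ⟫ ≈ ⟪ collect x U ⟫
  ⟪collect⟫ {U = U}      u []        = sym (collect-[] U)
  ⟪collect⟫ {_ ∷ x} u (v∈U ∷ h) = trans (+-congˡ (⟪collect⟫ u h)) (sym (collect-hit {x = x} u v∈U))

  ⟪scaled⟫ : ∀ {f g : Perm → S.Carrier} {a U} → All (λ w → f w S.≈ a S.* g w) U →
             ⟪ map (λ w → f w , w) U ⟫ ≈ scalar a * ⟪ map (λ w → g w , w) U ⟫
  ⟪scaled⟫                     []      = sym (zeroʳ _)
  ⟪scaled⟫ {f} {g} {a} {w ∷ U} (e ∷ h) = trans
    (+-cong (trans (*-congʳ (trans (scalar-cong e) (scalar-* a (g w)))) (*-assoc _ _ _)) (⟪scaled⟫ {f} {g} h))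
    (sym (distribˡ _ _ _))

-- Recovering coefficients from operators

module CoefficientAction {c ℓ ℓ′} (A : RawRing c ℓ) (_≈ᴬ_ : RawRing.Carrier A → RawRing.Carrier A → Set ℓ′)
  (isCR : IsCommutativeRing _≈ᴬ_ (RawRing._+_ A) (RawRing._*_ A) (RawRing.-_ A) (RawRing.0# A) (RawRing.1# A))
  (q : RawRing.Carrier A) (n : ℕ) where

  open Operators A _≈ᴬ_ isCR q n

  scalarMap : ScalarMap (toCommutativeRing A _≈ᴬ_ isCR) operators
  scalarMap = record
    { scalar         = scalar
    ; scalar-central = scalar-central
    ; scalar-cong    = scalar-cong
    ; scalar-+       = scalar-+
    ; scalar-*       = scalar-*
    ; scalar-neg     = scalar-neg
    ; scalar-0       = scalar-0
    ; scalar-1       = scalar-1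
    }

  open LinearExtension A _≈ᴬ_ isCR q n operators heckeGenerators scalarMap (mkᵒ λ φ w v → CommutativeRing.refl scalars)
  open BasisElements operators n heckeGenerators using (word; basis)
  open HeckeAlgebra operators n heckeGenerators using (P; factorial; bracket; F*-F; factorial-divides-P)
  open CommutativeRing scalars hiding (zero)
  open Hecke A q
  open SetoidReasoning setoid

  coeff-++ : ∀ x y w → coeff (x ++ y) w ≈ coeff x w + coeff y w
  coeff-++ []            y w = sym (+-identityˡ _)
  coeff-++ ((a , v) ∷ x) y w with List.≡-dec ℕ._≟_ v w
  ... | yes _ = trans (+-congˡ (coeff-++ x y w)) (sym (+-assoc _ _ _))
  ... | no _  = coeff-++ x y w

  coeff-⊙ : ∀ a x w → coeff (a ⊙ x) w ≈ a * coeff x w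
  coeff-⊙ a []            w = sym (zeroʳ a)
  coeff-⊙ a ((d , v) ∷ x) w with List.≡-dec ℕ._≟_ v w
  ... | yes _ = trans (+-congˡ (coeff-⊙ a x w)) (sym (distribˡ _ _ _))
  ... | no _  = coeff-⊙ a x w

  single-hit : ∀ {a v w} → v ≡ w → coeff ((a , v) ∷ []) w ≈ a
  single-hit v≡w = trans (reflexive (coeff-hit [] v≡w)) (+-identityʳ _)

  single-miss : ∀ {a v w} → v ≢ w → coeff ((a , v) ∷ []) w ≈ 0#
  single-miss v≢w = reflexive (coeff-miss [] v≢w)

  coeff-∷ : ∀ a v x w → coeff ((a , v) ∷ x) w ≈ coeff ((a , v) ∷ []) w + coeff x w
  coeff-∷ a v x w = coeff-++ ((a , v) ∷ []) x w

  act-ascent : ∀ {i φ w} → ascentPos i w ≡ true → act i φ w ≈ q * φ (swapPos i w)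
  act-ascent asc rewrite asc = refl

  act-descent : ∀ {i φ w} → ascentPos i w ≡ false → act i φ w ≈ φ (swapPos i w) + p * φ w
  act-descent desc rewrite desc = refl

  act-vanish : ∀ i {φ w} → φ (swapPos i w) ≈ 0# → (ascentPos i w ≡ false → φ w ≈ 0#) → act i φ w ≈ 0#
  act-vanish i {w = w} φsw φw with ascentPos i w
  ... | true  = trans (*-congˡ φsw) (zeroʳ q)
  ... | false = trans (+-cong φsw (trans (*-congˡ (φw ≡.refl)) (zeroʳ p))) (+-identityˡ _)

  mulGenTerm-ascent : ∀ {i a v} → ascentPos i v ≡ true →
                      mulGenTerm (suc i) (a , v) ≡ (a , swapPos i v) ∷ []
  mulGenTerm-ascent asc rewrite asc = ≡.refl

  mulGenTerm-descent : ∀ {i a v} → ascentPos i v ≡ false →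
                       mulGenTerm (suc i) (a , v) ≡ (p * a , v) ∷ (q * a , swapPos i v) ∷ []
  mulGenTerm-descent desc rewrite desc = ≡.refl

  -- A nonzero value requires v = w or v = w s. The two exclude each other because the swap turns an
  -- ascent at i into a descent and conversely, and the ascent of v then decides which branch of
  -- `act` applies at w.
  coeff-mulGenTerm : ∀ i a v w → Valid n w → suc i < n →
                     coeff (mulGenTerm (suc i) (a , v)) w ≈ act i (coeff ((a , v) ∷ [])) w
  coeff-mulGenTerm i a v w (len , u) i<n = by-ascent (ascentPos i v) ≡.refl
    where
    φ : Vector
    φ = coeff ((a , v) ∷ [])
    asc-sw : ascentPos i (swapPos i w) ≡ not (ascentPos i w)
    asc-sw = ascentPos-swapPos i u (≡.subst (suc i <_) (≡.sym len) i<n)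
    asc-v≡ : v ≡ swapPos i w → ascentPos i v ≡ not (ascentPos i w)
    asc-v≡ v≡sw = ≡.trans (≡.cong (ascentPos i) v≡sw) asc-sw
    unswap : swapPos i v ≡ w → v ≡ swapPos i w
    unswap sv≡w = ≡.trans (≡.sym (swapPos-involutive i v)) (≡.cong (swapPos i) sv≡w)
    reswap : v ≡ swapPos i w → swapPos i v ≡ w
    reswap v≡sw = ≡.trans (≡.cong (swapPos i) v≡sw) (swapPos-involutive i w)
    differ : v ≡ w → v ≢ swapPos i w
    differ v≡w v≡sw = not-¬ (≡.cong (ascentPos i) (≡.trans (≡.sym v≡sw) v≡w)) asc-sw
    at-ascent : ascentPos i v ≡ true → Dec (swapPos i v ≡ w) → coeff ((a , swapPos i v) ∷ []) w ≈ act i φ w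
    at-ascent asc-v (yes sv≡w) = trans (single-hit sv≡w)
      (sym (trans (act-descent {i} {φ} {w} (not-injective (≡.trans (≡.sym (asc-v≡ (unswap sv≡w))) asc-v)))
        (trans (+-cong (single-hit (unswap sv≡w))
                 (trans (*-congˡ (single-miss λ v≡w → differ v≡w (unswap sv≡w))) (zeroʳ p)))
          (+-identityʳ a))))
    at-ascent asc-v (no sv≢w) = trans (single-miss sv≢w)
      (sym (act-vanish i {φ} {w} (single-miss λ v≡sw → sv≢w (reswap v≡sw))
        (λ desc-w → single-miss λ v≡w →
          contradiction (≡.trans (≡.sym asc-v) (≡.trans (≡.cong (ascentPos i) v≡w) desc-w)) λ ())))
    at-descent : ascentPos i v ≡ false → Dec (v ≡ w) → Dec (swapPos i v ≡ w) →
      coeff ((p * a , v) ∷ []) w + coeff ((q * a , swapPos i v) ∷ []) w ≈ act i φ w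
    at-descent desc-v (yes v≡w) _ = trans
      (+-cong (single-hit v≡w) (single-miss λ sv≡w → differ v≡w (unswap sv≡w)))
      (trans (+-comm _ _) (sym (trans (act-descent {i} {φ} {w} (≡.trans (≡.cong (ascentPos i) (≡.sym v≡w)) desc-v))
        (+-cong (single-miss (differ v≡w)) (*-congˡ (single-hit v≡w))))))
    at-descent desc-v (no v≢w) (yes sv≡w) = trans (+-cong (single-miss v≢w) (single-hit sv≡w))
      (trans (+-identityˡ _) (sym (trans
        (act-ascent {i} {φ} {w} (not-injective (≡.trans (≡.sym (asc-v≡ (unswap sv≡w))) desc-v)))
        (*-congˡ (single-hit (unswap sv≡w))))))
    at-descent desc-v (no v≢w) (no sv≢w) = trans (+-cong (single-miss v≢w) (single-miss sv≢w))
      (trans (+-identityˡ _) (sym (act-vanish i {φ} {w} (single-miss λ v≡sw → sv≢w (reswap v≡sw)) (λ _ → single-miss v≢w))))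
    by-ascent : ∀ x → ascentPos i v ≡ x → coeff (mulGenTerm (suc i) (a , v)) w ≈ act i φ w
    by-ascent true  asc-v = trans (reflexive (≡.cong (λ x → coeff x w) (mulGenTerm-ascent {i} {a} {v} asc-v)))
      (at-ascent asc-v (List.≡-dec ℕ._≟_ (swapPos i v) w))
    by-ascent false desc-v = trans (reflexive (≡.cong (λ x → coeff x w) (mulGenTerm-descent {i} {a} {v} desc-v)))
      (trans (coeff-∷ (p * a) v ((q * a , swapPos i v) ∷ []) w)
        (at-descent desc-v (List.≡-dec ℕ._≟_ v w) (List.≡-dec ℕ._≟_ (swapPos i v) w)))

  coeff-·T : ∀ {j} x → 0 < j → j < n → coeff (x ·T j) ≈ᵛ act (j ∸ 1) (coeff x)
  coeff-·T {suc i} []            h j<n w v = sym (act-vanish i refl (λ _ → refl))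
  coeff-·T {suc i} ((a , u) ∷ x) h j<n w v = begin
    coeff (mulGenTerm (suc i) (a , u) ++ x ·T suc i) w
      ≈⟨ coeff-++ (mulGenTerm (suc i) (a , u)) (x ·T suc i) w ⟩
    coeff (mulGenTerm (suc i) (a , u)) w + coeff (x ·T suc i) w
      ≈⟨ +-cong (coeff-mulGenTerm i a u w v j<n) (coeff-·T x h j<n w v) ⟩
    act i (coeff ((a , u) ∷ [])) w + act i (coeff x) w
      ≈⟨ +-homo (generator i) (coeff ((a , u) ∷ [])) (coeff x) w v ⟨
    act i (λ w → coeff ((a , u) ∷ []) w + coeff x w) w
      ≈⟨ Operator.cong (generator i) (λ w _ → coeff-∷ a u x w) w v ⟨
    act i (coeff ((a , u) ∷ x)) w ∎

  coeff-·Tword : ∀ {js} x → InRange n js → coeff (x ·Tword js) ≈ᵛ apply (word js) (coeff x)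
  coeff-·Tword {[]}     x []                w v = refl
  coeff-·Tword {j ∷ js} x ((lo , hi) ∷ rng) w v = trans (coeff-·Tword (x ·T j) rng w v)
    (Operator.cong (word js) (coeff-·T x lo hi) w v)

  coeff-⊗ : ∀ {x y} → AllValid y → coeff (x ⊗ y) ≈ᵛ apply ⟪ y ⟫ (coeff x)
  coeff-⊗ {x} {[]}          []       w v = refl
  coeff-⊗ {x} {(a , u) ∷ y} (vu ∷ vs) w v = begin
    coeff (a ⊙ (x ·Tword redWord u) ++ x ⊗ y) w
      ≈⟨ coeff-++ (a ⊙ (x ·Tword redWord u)) (x ⊗ y) w ⟩
    coeff (a ⊙ (x ·Tword redWord u)) w + coeff (x ⊗ y) w
      ≈⟨ +-cong (trans (coeff-⊙ a (x ·Tword redWord u) w)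
                  (*-congˡ (coeff-·Tword x (redWord-inRange u (proj₁ vu)) w v)))
                (coeff-⊗ vs w v) ⟩
    a * apply (basis u) (coeff x) w + apply ⟪ y ⟫ (coeff x) w
      ≈⟨ +-congʳ (*-homo (basis u) a (coeff x) w v) ⟨
    apply (basis u) (λ w → a * coeff x w) w + apply ⟪ y ⟫ (coeff x) w ∎

  coeff-∉ : ∀ {x w} → All (λ t → proj₂ t ≢ w) x → coeff x w ≡ 0#
  coeff-∉         []        = ≡.refl
  coeff-∉ {_ ∷ x} (u≢w ∷ h) = ≡.trans (coeff-miss x u≢w) (coeff-∉ h)

  coeff-invalid : ∀ {x w} → AllValid x → ¬ Valid n w → coeff x w ≡ 0#
  coeff-invalid vs ¬v = coeff-∉ (All.map (λ v t≡w → ¬v (≡.subst (Valid n) t≡w v)) vs)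

  coeff-∈ : ∀ {g : Vector} {U w} → Unique U → w ∈ U → coeff (map (λ u → g u , u) U) w ≈ g w
  coeff-∈ {g} {u ∷ U} (u∉ ∷ _) (here ≡.refl) = trans
    (reflexive (≡.trans (coeff-hit (map (λ u → g u , u) U) ≡.refl)
      (≡.cong (λ a → g u + a) (coeff-∉ (All.map⁺ (All.map (λ u≢v v≡u → u≢v (≡.sym v≡u)) u∉))))))
    (+-identityʳ _)
  coeff-∈ {g} {u ∷ U} (u∉ ∷ uniq) (there w∈U) = trans
    (reflexive (coeff-miss (map (λ u → g u , u) U) (All.lookup u∉ w∈U))) (coeff-∈ uniq w∈U)

  valid? : ∀ w → Dec (Valid n w)
  valid? w = (length w ℕ.≟ n) ×-dec unique? w

  δ : Vector
  δ = coeff (1H n)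

  -- Applying the operator of x to the coefficient function of the identity returns the coefficients
  -- of x; through this property an equation of operators becomes one of coefficients.
  Regular : H → Set ℓ′
  Regular x = coeff x ≈ᵛ apply ⟪ x ⟫ δ

  regular-1H : Regular (1H n)
  regular-1H w v = sym (apply≈ ⟪1H⟫ δ w v)

  -- By `coeff-⊗` the right factor already acts through its operator, so regularity passes along a
  -- chain of left factors that starts at `1H n`.
  regular-⊗ : ∀ {x y} → AllValid x → AllValid y → Regular x → Regular (x ⊗ y)
  regular-⊗ {x} {y} vx vy reg w v = trans (coeff-⊗ {x} {y} vy w v)
    (trans (Operator.cong ⟪ y ⟫ reg w v) (sym (apply≈ (⟪⊗⟫ vx vy) δ w v)))

  regular-𝓑*nk : ∀ k → Regular (𝓑*nk n k)
  regular-𝓑*nk zero    = regular-1H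
  regular-𝓑*nk (suc k) = regular-⊗ {𝓑*nk n k} {𝓑* n (n ∸ k)} (valid-𝓑*nk k) (valid-𝓑* (n ∸ k)) (regular-𝓑*nk k)

  𝓟 : ℕ → H
  𝓟 k = 𝓑*nk n k ⊗ 𝓑nk n k

  valid-𝓟 : ∀ k → AllValid (𝓟 k)
  valid-𝓟 k = valid-⊗ (𝓑nk n k) (valid-𝓑*nk k)

  regular-𝓟 : ∀ k → Regular (𝓟 k)
  regular-𝓟 k = regular-⊗ {𝓑*nk n k} {𝓑nk n k} (valid-𝓑*nk k) (valid-𝓑nk k) (regular-𝓑*nk k)

  ⟪𝓟⟫ : ∀ k → ⟪ 𝓟 k ⟫ E.≈ P n k
  ⟪𝓟⟫ k = E.trans (⟪⊗⟫ (valid-𝓑*nk k) (valid-𝓑nk k)) (E.trans (E.*-cong (⟪𝓑*nk⟫ k) (⟪𝓑nk⟫ k)) (F*-F n k))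

  [_]q : ℕ → Carrier
  [ zero ]q  = 0#
  [ suc k ]q = 1# + q * [ k ]q

  [_]!q : ℕ → Carrier
  [ zero ]!q  = 1#
  [ suc k ]!q = [ k ]!q * [ suc k ]q

  bracket-scalar : ∀ k → bracket k E.≈ scalar [ k ]q
  bracket-scalar zero    = E.sym scalar-0
  bracket-scalar (suc k) = E.sym (E.trans (scalar-+ _ _)
    (E.+-cong scalar-1 (E.trans (scalar-* _ _) (E.*-congˡ (E.sym (bracket-scalar k))))))

  factorial-scalar : ∀ k → factorial k E.≈ scalar [ k ]!q
  factorial-scalar zero    = E.sym scalar-1
  factorial-scalar (suc k) = E.sym (E.trans (scalar-* _ _)
    (E.*-cong (E.sym (factorial-scalar k)) (E.sym (bracket-scalar (suc k)))))

  -- The factorization of the operator is applied to `δ`: the scalar [k]!_q acts first and is pulled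
  -- out of `Z` by linearity, so the quotients are the values of `apply Z δ`.
  factorial-divides-coeff : ∀ k → ∃ λ (ψ : Vector) → coeff (𝓟 k) ≈ᵛ λ w → [ k ]!q * ψ w
  factorial-divides-coeff k with factorial-divides-P n k ℕ.≤-refl
  ... | Z , P≈ = apply Z δ , λ w v → begin
    coeff (𝓟 k) w                          ≈⟨ regular-𝓟 k w v ⟩
    apply ⟪ 𝓟 k ⟫ δ w                      ≈⟨ apply≈ (E.trans (⟪𝓟⟫ k) P≈) δ w v ⟩
    apply Z (apply (factorial k) δ) w      ≈⟨ Operator.cong Z (apply≈ (factorial-scalar k) δ) w v ⟩
    apply Z (λ w → [ k ]!q * δ w) w        ≈⟨ *-homo Z _ δ w v ⟩
    [ k ]!q * apply Z δ w                  ∎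

  module _ (q-cancel : ∀ x y → q * x ≈ q * y → x ≈ y) where

    ⟪𝓟⟫-commute : ∀ i j → ⟪ 𝓟 i ⟫ E.* ⟪ 𝓟 j ⟫ E.≈ ⟪ 𝓟 j ⟫ E.* ⟪ 𝓟 i ⟫
    ⟪𝓟⟫-commute i j = E.trans (E.*-cong (⟪𝓟⟫ i) (⟪𝓟⟫ j))
      (E.trans (P-commute operators n heckeGenerators scalar-q-cancel n i j ℕ.≤-refl)
        (E.sym (E.*-cong (⟪𝓟⟫ j) (⟪𝓟⟫ i))))
      where
      scalar-q-cancel : ∀ f g → scalar q E.* f E.≈ scalar q E.* g → f E.≈ g
      scalar-q-cancel f g eq = mkᵒ λ φ w v → q-cancel _ _
        (trans (sym (*-homo f q φ w v)) (trans (apply≈ eq φ w v) (*-homo g q φ w v)))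

    -- The division stays abstract here: d k stands for [k]!_q and g k for the coefficients of the
    -- quotient, which together with the support of `𝓟 k` determine the formal combination `r k`.
    module _ (d : ℕ → Carrier) (d-cancel : ∀ k x y → d k * x ≈ d k * y → x ≈ y)
             (g : ℕ → Vector) (d-g : ∀ k → coeff (𝓟 k) ≈ᵛ (λ w → d k * g k w)) where

      support : ℕ → List Perm
      support k = deduplicate (List.≡-dec ℕ._≟_) (map proj₂ (𝓟 k))

      support-unique : ∀ k → Unique (support k)
      support-unique k = deduplicate-! (List.≡-dec ℕ._≟_) (map proj₂ (𝓟 k))

      support-valid : ∀ k → All (Valid n) (support k)
      support-valid k = All.deduplicate⁺ (List.≡-dec ℕ._≟_) (All.map⁺ (valid-𝓟 k))

      ∈-support : ∀ k → All (λ t → proj₂ t ∈ support k) (𝓟 k)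
      ∈-support k = All.tabulate λ t∈ → ∈-deduplicate⁺ (List.≡-dec ℕ._≟_) (∈-map⁺ proj₂ t∈)

      r : ℕ → H
      r k = map (λ w → g k w , w) (support k)

      valid-r : ∀ k → AllValid (r k)
      valid-r k = All.map⁺ (support-valid k)

      d-r : ∀ k → coeff (𝓟 k) ≈ᵛ (λ w → d k * coeff (r k) w)
      d-r k w v with Any.any? (λ u → List.≡-dec ℕ._≟_ w u) (support k)
      ... | yes w∈ = trans (d-g k w v) (*-congˡ (sym (coeff-∈ (support-unique k) w∈)))
      ... | no w∉  = trans (reflexive (coeff-∉ (All.map (λ t∈ t≡w → w∉ (≡.subst (_∈ support k) t≡w t∈)) (∈-support k))))
        (sym (trans (*-congˡ (reflexive (coeff-∉ (All.map⁺ (All.tabulate λ u∈ u≡w → w∉ (≡.subst (_∈ support k) u≡w u∈))))))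
          (zeroʳ (d k))))

      d-⟪r⟫ : ∀ k → ⟪ 𝓟 k ⟫ E.≈ scalar (d k) E.* ⟪ r k ⟫
      d-⟪r⟫ k = E.trans (⟪collect⟫ (support-unique k) (∈-support k)) (⟪scaled⟫ {coeff (𝓟 k)} {g k} {d k} (All.map (λ {w} → d-g k w) (support-valid k)))

      -- Regularity is known for `𝓟 i`, so the left factor is divided by d i through its
      -- coefficients, while the right factor is divided by d j through its operator.
      coeff-𝓟𝓟 : ∀ i j w → Valid n w → apply (⟪ 𝓟 i ⟫ E.* ⟪ 𝓟 j ⟫) δ w ≈ d j * (d i * coeff (r i ⊗ r j) w)
      coeff-𝓟𝓟 i j w v = begin
        apply ⟪ 𝓟 j ⟫ (apply ⟪ 𝓟 i ⟫ δ) w           ≈⟨ Operator.cong ⟪ 𝓟 j ⟫ (regular-𝓟 i) w v ⟨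
        apply ⟪ 𝓟 j ⟫ (coeff (𝓟 i)) w               ≈⟨ apply≈ (d-⟪r⟫ j) (coeff (𝓟 i)) w v ⟩
        apply ⟪ r j ⟫ (λ w → d j * coeff (𝓟 i) w) w ≈⟨ *-homo ⟪ r j ⟫ (d j) (coeff (𝓟 i)) w v ⟩
        d j * apply ⟪ r j ⟫ (coeff (𝓟 i)) w         ≈⟨ *-congˡ (Operator.cong ⟪ r j ⟫ (d-r i) w v) ⟩
        d j * apply ⟪ r j ⟫ (λ w → d i * coeff (r i) w) w
                                                    ≈⟨ *-congˡ (*-homo ⟪ r j ⟫ (d i) (coeff (r i)) w v) ⟩
        d j * (d i * apply ⟪ r j ⟫ (coeff (r i)) w) ≈⟨ *-congˡ (*-congˡ (coeff-⊗ {r i} {r j} (valid-r j) w v)) ⟨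
        d j * (d i * coeff (r i ⊗ r j) w)           ∎

      quotients-commute : ∀ i j w → coeff (r i ⊗ r j) w ≈ coeff (r j ⊗ r i) w
      quotients-commute i j w with valid? w
      -- Operators say nothing about such w, but no term of either product carries one.
      ... | no ¬v = reflexive (≡.trans (coeff-invalid (valid-⊗ (r j) (valid-r i)) ¬v)
                      (≡.sym (coeff-invalid (valid-⊗ (r i) (valid-r j)) ¬v)))
      ... | yes v = d-cancel i _ _ (d-cancel j _ _ (begin
        d j * (d i * coeff (r i ⊗ r j) w)   ≈⟨ coeff-𝓟𝓟 i j w v ⟨
        apply (⟪ 𝓟 i ⟫ E.* ⟪ 𝓟 j ⟫) δ w     ≈⟨ apply≈ (⟪𝓟⟫-commute i j) δ w v ⟩
        apply (⟪ 𝓟 j ⟫ E.* ⟪ 𝓟 i ⟫) δ w     ≈⟨ coeff-𝓟𝓟 j i w v ⟩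
        d i * (d j * coeff (r j ⊗ r i) w)   ≈⟨ trans (sym (*-assoc _ _ _)) (trans (*-congʳ (*-comm _ _)) (*-assoc _ _ _)) ⟩
        d j * (d i * coeff (r j ⊗ r i) w)   ∎))

-- Specialisation

module Specialisation {c ℓ} (F : Field c ℓ) (q₀ : Field.Carrier F) where
  open Field F hiding (zero)
  open Evaluation F q₀
  private
    module Q = Hecke ℤ[q] qPoly
    module K = Hecke rawRing q₀

  -- Which terms a product generates depends on the permutations alone. The computations over ℤ[q]
  -- and over the field therefore run in parallel, and their lists correspond term by term.
  _∼ₜ_ : Poly × Perm → Carrier × Perm → Set ℓ
  (p , v) ∼ₜ (a , w) = eval p ≈ a × v ≡ w

  infix 4 _∼_
  _∼_ : Q.H → K.H → Set (c ⊔ ℓ)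
  _∼_ = Pointwise _∼ₜ_

  ∼-mulGenTerm : ∀ j {t t′} → t ∼ₜ t′ → Q.mulGenTerm j t ∼ K.mulGenTerm j t′
  ∼-mulGenTerm j {p , v} {a , .v} (e , ≡.refl) with ascent v j
  ... | true  = (e , ≡.refl) ∷ []
  ... | false = (trans (eval-* (padd qPoly -1ₚ) p) (*-cong q-1 e) , ≡.refl)
              ∷ (trans (eval-* qPoly p) (*-cong eval-q e) , ≡.refl) ∷ []
    where
    -1ₚ : Poly
    -1ₚ = map (λ z → ℤ.- z) (1ℤ ∷ [])
    q-1 : eval (padd qPoly -1ₚ) ≈ q₀ + - 1#
    q-1 = trans (eval-+ qPoly -1ₚ) (+-cong eval-q (trans (eval-neg (1ℤ ∷ [])) (-‿cong eval-1)))

  ∼-·T : ∀ j {x y} → x ∼ y → x Q.·T j ∼ y K.·T j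
  ∼-·T j []      = []
  ∼-·T j (e ∷ h) = Pointwise.++⁺ (∼-mulGenTerm j e) (∼-·T j h)

  ∼-·Tword : ∀ js {x y} → x ∼ y → x Q.·Tword js ∼ y K.·Tword js
  ∼-·Tword []       h = h
  ∼-·Tword (j ∷ js) h = ∼-·Tword js (∼-·T j h)

  ∼-⊙ : ∀ {p a x y} → eval p ≈ a → x ∼ y → p Q.⊙ x ∼ a K.⊙ y
  ∼-⊙ e []                             = []
  ∼-⊙ {p} e (_∷_ {r , v} (f , eq) h) = (trans (eval-* p r) (*-cong e f) , eq) ∷ ∼-⊙ {p} e h

  ∼-⊗ : ∀ {x x′ y y′} → x ∼ x′ → y ∼ y′ → x Q.⊗ y ∼ x′ K.⊗ y′
  ∼-⊗ hx []                                   = []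
  ∼-⊗ hx (_∷_ {p , v} {a , .v} (e , ≡.refl) h) = Pointwise.++⁺ (∼-⊙ {p} e (∼-·Tword (redWord v) hx)) (∼-⊗ hx h)

  ∼-coeff : ∀ {x y} → x ∼ y → ∀ w → eval (Q.coeff x w) ≈ K.coeff y w
  ∼-coeff []                                   w = refl
  ∼-coeff (_∷_ {p , v} {a , .v} {x} (e , ≡.refl) h) w with List.≡-dec ℕ._≟_ v w
  ... | yes _ = trans (eval-+ p (Q.coeff x w)) (+-cong e (∼-coeff h w))
  ... | no _  = ∼-coeff h w

  ∼-map : ∀ (f : Perm → Poly) U → map (λ w → f w , w) U ∼ map (λ w → eval (f w) , w) U
  ∼-map f []      = []
  ∼-map f (w ∷ U) = (refl , ≡.refl) ∷ ∼-map f U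

-- The quotients by [k]!_q over ℤ[q]

module IntegralQuotients (n : ℕ) where
  open CommutativeRing ℤ[q]-commutativeRing hiding (zero)
  open CoefficientAction ℤ[q] _≈ₚ_ ≈ₚ-isCommutativeRing qPoly n
  open Hecke ℤ[q] qPoly

  qint-≈ : ∀ k → qint k ≈ₚ [ k ]q
  qint-≈ zero    = refl
  qint-≈ (suc k) = trans (mk≈ step) (+-congˡ {1ℤ ∷ []} (*-congˡ {qPoly} (qint-≈ k)))
    where
    step : ∀ i → at (1ℤ ∷ qint k) i ≡ at (padd (1ℤ ∷ []) (pmul qPoly (qint k))) i
    step zero    = ≡.sym (≡.trans (at-padd (1ℤ ∷ []) (pmul qPoly (qint k)) 0)
      (≡.trans (≡.cong (λ a → 1ℤ ℤ.+ a) (at-pmul-zero ℤ.0ℤ (1ℤ ∷ []) (qint k))) (ℤ.+-identityʳ 1ℤ)))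
    step (suc i) = ≡.sym (≡.trans (at-padd (1ℤ ∷ []) (pmul qPoly (qint k)) (suc i))
      (≡.trans (ℤ.+-identityˡ _) (≡.trans (at-pmul-suc ℤ.0ℤ (1ℤ ∷ []) (qint k) i)
        (≡.trans (ℤ.+-identityˡ _) (_≈ₚ_.at≡ (*-identityˡ (qint k)) i)))))

  qfact-≈ : ∀ k → qfact k ≈ₚ [ k ]!q
  qfact-≈ zero    = refl
  qfact-≈ (suc k) = *-cong {qfact k} {[ k ]!q} {qint (suc k)} {[ suc k ]q} (qfact-≈ k) (qint-≈ (suc k))

  quotient : ℕ → Perm → Poly
  quotient k w = pquot (coeff (𝓟 k) w) (qfact k)

  -- An exact quotient ψ exists by `factorial-divides-coeff`; division by a monic polynomial is
  -- unique, so `pquot` returns ψ up to trailing zeros.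
  qfact-quotient : ∀ k w → Valid n w → coeff (𝓟 k) w ≈ₚ pmul (qfact k) (quotient k w)
  qfact-quotient k w v with factorial-divides-coeff k
  ... | ψ , eq = trans 𝓟≈ (*-congˡ {qfact k} (sym (pquot-≈ {qfact k} (lastOne-qfact k) 𝓟≈)))
    where
    𝓟≈ : coeff (𝓟 k) w ≈ₚ pmul (qfact k) (ψ w)
    𝓟≈ = trans (eq w v) (*-congʳ {ψ w} (sym (qfact-≈ k)))

  quotient-element : ℕ → H
  quotient-element k = map (λ w → quotient k w , w) (deduplicate (List.≡-dec ℕ._≟_) (map proj₂ (𝓟 k)))

  commute : ∀ i j w → coeff (quotient-element i ⊗ quotient-element j) w ≈ₚ coeff (quotient-element j ⊗ quotient-element i) w
  commute = quotients-commute cancellable-q qfact (λ k → cancellable-qfact k) quotient qfact-quotient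

theorem4p1 : ∀ {c ℓ : Level} (F : Field c ℓ) (q : Field.Carrier F) (n i j : ℕ) →
    let open Hecke (Field.rawRing F) q in
    (𝓡 F q n i ⊗ 𝓡 F q n j) ≋ (𝓡 F q n j ⊗ 𝓡 F q n i)
theorem4p1 F q n i j w = trans (sym (∼-coeff (∼-⊗ (∼-𝓡 i) (∼-𝓡 j)) w))
  (trans (eval-cong (commute i j w)) (∼-coeff (∼-⊗ (∼-𝓡 j) (∼-𝓡 i)) w))
  where
  open Field F using (trans; sym)
  open Evaluation F q
  open Specialisation F q
  open IntegralQuotients n
  ∼-𝓡 : ∀ k → quotient-element k ∼ 𝓡 F q n k
  -- `𝓡` is by definition the termwise evaluation of `quotient-element k`.
  ∼-𝓡 k = ∼-map (quotient k) _
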